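{- Let $k$ and $n$ be positive integers. (i) Let $p$ be a prime with $p \equiv 2 \pmod 3$, and let $r$ be a non-negative integer with $p \mid 3r+2$. Then $$B_{3,7}\left(p^{k+1}n+pr+ \frac{2p-1}{3}\right)\equiv -\left(\frac{ -7}{p}\right)_{L} B_{3,7}\left(p^{k-1}n+ \frac{3r+2-p}{3p} \right) \pmod3.$$ (ii) Let $p$ be a prime with $p \equiv 3 \pmod 4$, and let $r$ be a non-negative integer with $p \mid 4r+3$. Then $$B_{3,5}\left(p^{k+1}n+pr+ \frac{3p-1}{4}\right)\equiv -\left(\frac{ -5}{p}\right)_{L} B_{3,5}\left(p^{k-1}n+ \frac{4r+3-p}{4p} \right) \pmod3.$$ (iii) Let $t \in \{3,5,7\}$, let $p$ be a prime with $p \equiv t \pmod 8$, and let $r$ be a non-negative integer with $p\mid 8r+t$. Then $$B_{3,2}\left(p^{k+1}n+pr+ \frac{tp-1}{8}\right)\equiv -\left(\frac{ -2}{p}\right)_{L} B_{3,2}\left(p^{k-1}n+ \frac{8r+t-p}{8p} \right) \pmod3.$$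
   Context: For integers $u,v\ge 2$, $B_{u,v}(n)$ is the number of bipartitions $(\alpha,\beta)$ of $n$ with $\alpha$ having no part divisible by $u$ and $\beta$ having no part divisible by $v$; $B_{u,v}(0)=1$ and $\sum_{n\ge0}B_{u,v}(n)q^n=\frac{f_uf_v}{f_1^2}$, $f_t=\prod_{k\ge1}(1-q^{tk})$. For an odd prime $p$, $\left(\frac{a}{p}\right)_L$ is the Legendre symbol (equal to $0$ if $p\mid a$); for $p=2$ it is understood as the Kronecker symbol. -}

module Defs where

open import Data.Bool using (Bool; true; false; if_then_else_)
open import Data.Nat as ℕ using (ℕ; zero; suc; _+_; _*_; _∸_; _≤ᵇ_; _≡ᵇ_)
open import Data.Nat.Divisibility using (_∣?_)
open import Data.List using (List; upTo; map)
open import Data.Nat.ListAction using (sum)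
open import Data.Bool.ListAction using (any)
open import Data.Integer as ℤ using (ℤ; +_; -[1+_]; _%ℕ_)
open import Relation.Nullary.Decidable using (does)

-- pcount u m n = number of partitions of n all of whose parts are ≤ m
-- and none of whose parts is divisible by u.
-- Recursion on the largest allowed part size m: a partition with parts ≤ suc m
-- uses the part (suc m) some j ≥ 0 times (j = 0 only, if u ∣ suc m).
pcount : ℕ → ℕ → ℕ → ℕ
pcount u zero n = if n ≡ᵇ 0 then 1 else 0
pcount u (suc m) n =
  if does (u ∣? suc m)
  then pcount u m n
  else sum (map (λ j → if j * suc m ≤ᵇ n then pcount u m (n ∸ j * suc m) else 0)
                (upTo (suc n)))

pnd : ℕ → ℕ → ℕ
pnd u n = pcount u n n

-- B u v n = number of bipartitions (α , β) of n with α having no part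
-- divisible by u and β having no part divisible by v
-- (|α| = j, |β| = n ∸ j, summed over j = 0 … n).
B : ℕ → ℕ → ℕ → ℕ
B u v n = sum (map (λ j → pnd u j * pnd v (n ∸ j)) (upTo (suc n)))

kronecker2 : ℤ → ℤ
kronecker2 a with a %ℕ 8
... | 1 = + 1
... | 7 = + 1
... | 3 = -[1+ 0 ]
... | 5 = -[1+ 0 ]
... | _ = + 0

-- Legendre symbol (a / p) for an odd prime p (0 if p ∣ a, 1 if a is a nonzero
-- quadratic residue mod p, -1 otherwise); for p = 2 the Kronecker symbol.
-- (Value at p = 0, 1 is irrelevant.)
legendre : ℤ → ℕ → ℤ
legendre a zero = + 0
legendre a (suc (suc zero)) = kronecker2 a
legendre a p@(suc q) =
  if (a %ℕ p) ≡ᵇ 0 then + 0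
  else if any (λ x → ((x * x) ℕ.% p) ≡ᵇ (a %ℕ p)) (upTo p) then + 1
  else -[1+ 0 ]

-- natural-number division, total in the divisor (x ⊘ 0 = 0); only used with
-- nonzero divisors that divide x exactly.
_⊘_ : ℕ → ℕ → ℕ
x ⊘ zero = 0
x ⊘ suc d = x ℕ./ suc d
infixl 7 _⊘_

{-# OPTIONS --safe #-}

-- Modulo 3 one has f₃ = f₁³, so the generating function of B₃,ᵥ is f₁ f_v. The Jacobi triple product turns f₁ f_v into
-- binary theta series: two pentagonal series give a signed sum over 24 n + 1 + v = x² + v y², while
-- f₁ f₅ = f(−q,−q⁴) f(−q²,−q³) and f₁ f₂ = f(−q,−q³) f(−q²,−q²) give signed sums over 40 n + 10 = x² + y² and
-- 8 n + 1 = x² + y². The arguments of B in the theorem are those for which the represented number K is replaced by p² K.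
-- If p is inert in the quadratic field of the form, every representation of p² K is p times one of K, and only
-- the signs have to be compared. This settles (−v / p) = −1 by the form x² + v y². If (−v / p) = 1 and v = 5 or 2, Thue's
-- lemma restricts p modulo 20 or 8, and p ≡ 3 (mod 4) is inert in ℚ(i). If (−7 / p) = 1, then p = π π̄ in ℤ[√−7], and
-- the contributions of π β and π̄ β cancel modulo 3; p = 2 is treated through the square of (1 ± √−7) / 2.

module Submission where

open import Defs
open import Level using (0ℓ)
open import Algebra.Bundles using (AbelianGroup; CommutativeRing)
import Algebra.Properties.Group as GroupProps
import Algebra.Properties.Ring as RingProps
import Algebra.Solver.Ring.NaturalCoefficients.Default as SemiringSolver
open import Data.Bool using (Bool; true; false; if_then_else_) renaming (T to IsTrue)
open import Data.Bool.ListAction using (any)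
open import Data.Empty using (⊥; ⊥-elim)
open import Data.Fin as Fin using (Fin; toℕ; fromℕ<)
import Data.Fin.Properties as FinP
open import Data.Integer as ℤ using (ℤ; +_; -[1+_]; ∣_∣; _%ℕ_)
import Data.Integer.Properties as ℤP
import Data.Integer.DivMod as ℤDM
open import Data.Integer.Divisibility as ℤD using ()
open import Data.Integer.Divisibility.Signed as ℤS using (divides) renaming (_∣_ to _∣ℤ_; _∣?_ to _∣ℤ?_)
import Data.Integer.Tactic.RingSolver as ℤT
open import Data.List using (List; []; _∷_; map; _++_; upTo; applyUpTo; cartesianProduct)
import Data.List.Properties as ListP
open import Data.List.Membership.Propositional using (_∈_)
open import Data.List.Membership.Propositional.Properties
  using (∈-map⁺; ∈-map⁻; ∈-upTo⁺; ∈-upTo⁻; ∈-cartesianProduct⁺)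
open import Data.List.Relation.Unary.Any using (here; there)
import Data.List.Relation.Unary.All as All
import Data.List.Relation.Unary.AllPairs as AllPairs
open import Data.List.Relation.Unary.Unique.Propositional using (Unique)
import Data.List.Relation.Unary.Unique.Propositional.Properties as UniqueP
open import Data.Nat as ℕ using (ℕ; zero; suc; z≤n; s≤s; _≤ᵇ_; _≡ᵇ_)
import Data.Nat.Properties as ℕP
import Data.Nat.DivMod as ℕDM
import Data.Nat.Divisibility as ℕD
open import Data.Nat.Coprimality using (Coprime; coprime-Bézout)
open import Data.Nat.GCD using (module Bézout)
open import Data.Nat.ListAction using (sum)
open import Data.Nat.Primality
  using (Prime; euclidsLemma; prime⇒irreducible; prime⇒nonZero; ¬prime[0]; ¬prime[1]; prime?)
import Data.Nat.Tactic.RingSolver as ℕS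
open import Data.Product using (_×_; _,_; proj₁; proj₂; ∃)
open import Data.Product.Properties using (≡-dec; ,-injectiveˡ; ,-injectiveʳ)
open import Data.Sum using (_⊎_; inj₁; inj₂; [_,_]′; reduce)
open import Function using (_∘_)
open import Relation.Binary.Definitions using (DecidableEquality)
open import Relation.Binary.PropositionalEquality as ≡ using (_≡_; _≢_)
import Relation.Binary.Reasoning.Setoid as SetoidReasoning
open import Relation.Nullary using (¬_; Dec; yes; no)
open import Relation.Nullary.Decidable using (from-yes; _⊎-dec_; _×-dec_; _→-dec_; ¬?)

-- No infinite product or sum is formed: series are compared up to a degree T, products stop after 2
-- T factors, sums over ℤ run over a box that holds all solutions, and division by f₁² becomes
-- cancellation. The prime 3 acts three times: as Frobenius, as 2 ≡ -1 when a theta sum over one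
-- progression is doubled to a sum over all integers, and as χ₁₂(x) ≡ x (-4 / x), which makes the
-- sign of a representation depend on x y alone. The obstacle is (-v / p) = 1: then p² K may have
-- representations that are not p times one of K. For v = 5 and 2 a second product of theta series
-- helps, because its form x² + y² is anisotropic modulo p. For v = 7 the minus sign is a matter of
-- counting: every β of norm p² K is a multiple of π or of π̄, and of both exactly when p ∣ β. So
-- the sum for p² K plus the sum for K equals the sum over the multiples of π plus that over the
-- multiples of π̄, which is 0. The parameters k, n, r enter only through m N′ + 1 = p² (m N + 1)
-- with m = 3, 4, 8.

module Rearrange (R : CommutativeRing 0ℓ 0ℓ) where
  open CommutativeRing R hiding (zero)
  open RingProps ring using (-‿distribˡ-*; -‿distribʳ-*)
  open SemiringSolver commutativeSemiring

  [a+b]+[c+d] : ∀ a b c d → (a + b) + (c + d) ≈ (a + c) + (b + d)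
  [a+b]+[c+d] = solve 4 (λ a b c d → (a :+ b) :+ (c :+ d) := (a :+ c) :+ (b :+ d)) refl

  a+[[b+c]+d] : ∀ a b c d → a + ((b + c) + d) ≈ (a + b) + (c + d)
  a+[[b+c]+d] = solve 4 (λ a b c d → a :+ ((b :+ c) :+ d) := (a :+ b) :+ (c :+ d)) refl

  ab+[ac+d] : ∀ a b c d → a * b + (a * c + d) ≈ a * (b + c) + d
  ab+[ac+d] = solve 4 (λ a b c d → a :* b :+ (a :* c :+ d) := a :* (b :+ c) :+ d) refl

  [ab][cd] : ∀ a b c d → (a * b) * (c * d) ≈ (a * c) * (b * d)
  [ab][cd] = solve 4 (λ a b c d → (a :* b) :* (c :* d) := (a :* c) :* (b :* d)) refl

  pascal-left : ∀ g h x p d r e → (g + x * h) * ((p * d) * (r * e)) ≈ g * ((p * d) * r) * e + x * (h * (p * (r * e)) * d)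
  pascal-left = solve 7 (λ g h x p d r e → (g :+ x :* h) :* ((p :* d) :* (r :* e))
    := g :* ((p :* d) :* r) :* e :+ x :* (h :* (p :* (r :* e)) :* d)) refl

  pascal-right : ∀ g h x p d r e → (x * g + h) * ((p * d) * (r * e)) ≈ x * (g * ((p * d) * r) * e) + h * (p * (r * e)) * d
  pascal-right = solve 7 (λ g h x p d r e → (x :* g :+ h) :* ((p :* d) :* (r :* e))
    := x :* (g :* ((p :* d) :* r) :* e) :+ h :* (p :* (r :* e)) :* d) refl

  factor-left : ∀ p e x d → p * e + x * (p * d) ≈ p * (e + x * d)
  factor-left = solve 4 (λ p e x d → p :* e :+ x :* (p :* d) := p :* (e :+ x :* d)) refl

  factor-right : ∀ p e x d → x * (p * e) + p * d ≈ p * (d + x * e)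
  factor-right = solve 4 (λ p e x d → x :* (p :* e) :+ p :* d := p :* (d :+ x :* e)) refl

  1-x+x[1-y] : ∀ x y → (1# + - x) + x * (1# + - y) ≈ (1# + - (x * y)) + (- x + x)
  1-x+x[1-y] x y = trans
    (solve 4 (λ u x n m → (u :+ n) :+ x :* (con 1 :+ m) := (u :+ x :* m) :+ (n :+ x)) refl 1# x (- x) (- y))
    (+-congʳ (+-congˡ (sym (-‿distribʳ-* x y))))

  a+-xa : ∀ a x → a + (- x) * a ≈ a * (1# + - x)
  a+-xa a x = solve 2 (λ a x → a :+ x :* a := a :* (con 1 :+ x)) refl a (- x)

  -xa+a : ∀ a x → (- x) * a + a ≈ a * (1# + - x)
  -xa+a a x = solve 2 (λ a x → x :* a :+ a := a :* (con 1 :+ x)) refl a (- x)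

  a[bg] : ∀ a b g → a * (b * g) ≈ (a * b) * g
  a[bg] a b g = sym (*-assoc a b g)

  a[tg] : ∀ a t g → a * (t * g) ≈ t * (a * g)
  a[tg] = solve 3 (λ a t g → a :* (t :* g) := t :* (a :* g)) refl

  [ad]b : ∀ a d b → (a * d) * b ≈ (a * b) * d
  [ad]b = solve 3 (λ a d b → (a :* d) :* b := (a :* b) :* d) refl

-- Convolution sums and truncated power series.

module Antidiagonal (R : CommutativeRing 0ℓ 0ℓ) where
  open CommutativeRing R hiding (zero)
  open Rearrange R

  -- The sum over i + k = n. Both indices are handed to the summand, so no truncated subtraction n ∸
  -- i appears in the ring laws.
  anti : ℕ → (ℕ → ℕ → Carrier) → Carrier
  anti zero    g = g 0 0
  anti (suc n) g = g 0 (suc n) + anti n (λ i k → g (suc i) k)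

  anti-cong : ∀ n {g h} → (∀ i k → i ℕ.+ k ≡ n → g i k ≈ h i k) → anti n g ≈ anti n h
  anti-cong zero    e = e 0 0 ≡.refl
  anti-cong (suc n) e = +-cong (e 0 (suc n) ≡.refl)
    (anti-cong n (λ i k p → e (suc i) k (≡.cong suc p)))

  anti-+ : ∀ n g h → anti n (λ i k → g i k + h i k) ≈ anti n g + anti n h
  anti-+ zero    g h = refl
  anti-+ (suc n) g h = trans (+-congˡ (anti-+ n _ _)) ([a+b]+[c+d] _ _ _ _)

  anti-*ˡ : ∀ n c g → anti n (λ i k → c * g i k) ≈ c * anti n g
  anti-*ˡ zero    c g = refl
  anti-*ˡ (suc n) c g = trans (+-congˡ (anti-*ˡ n c _)) (sym (distribˡ c _ _))

  anti-0 : ∀ n → anti n (λ _ _ → 0#) ≈ 0#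
  anti-0 zero    = refl
  anti-0 (suc n) = trans (+-identityˡ _) (anti-0 n)

  anti-last : ∀ n g → anti (suc n) g ≈ anti n (λ i k → g i (suc k)) + g (suc n) 0
  anti-last zero    g = refl
  anti-last (suc n) g = trans (+-congˡ (anti-last n (λ i k → g (suc i) k))) (sym (+-assoc _ _ _))

  anti-flip : ∀ n g → anti n (λ i k → g k i) ≈ anti n g
  anti-flip zero    g = refl
  anti-flip (suc n) g = trans (+-congˡ (anti-flip n (λ i k → g i (suc k))))
    (trans (+-comm _ _) (sym (anti-last n g)))

  -- The shape of a Pascal recursion: each interior entry receives two contributions, the two end
  -- entries one each. It carries the induction step of the finite triple product.
  anti-split : ∀ n (h u v : ℕ → ℕ → Carrier) →
    (∀ k → h 0 (suc k) ≈ u 0 k) → (∀ i → h (suc i) 0 ≈ v i 0) →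
    (∀ i k → h (suc i) (suc k) ≈ u (suc i) k + v i (suc k)) →
    anti (suc n) h ≈ anti n u + anti n v
  anti-split zero    h u v e₀ e₁ e = +-cong (e₀ 0) (e₁ 0)
  anti-split (suc n) h u v e₀ e₁ e = begin
    h 0 (suc (suc n)) + anti (suc n) h′
      ≈⟨ +-cong (e₀ (suc n)) (anti-last n h′) ⟩
    u 0 (suc n) + (anti n (λ i k → h′ i (suc k)) + h′ (suc n) 0)
      ≈⟨ +-congˡ (+-cong (anti-cong n (λ i k _ → e i k)) (e₁ (suc n))) ⟩
    u 0 (suc n) + (anti n (λ i k → u (suc i) k + v i (suc k)) + v (suc n) 0)
      ≈⟨ +-congˡ (+-congʳ (anti-+ n _ _)) ⟩
    u 0 (suc n) + ((anti n (λ i k → u (suc i) k) + anti n (λ i k → v i (suc k))) + v (suc n) 0)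
      ≈⟨ a+[[b+c]+d] _ _ _ _ ⟩
    anti (suc n) u + (anti n (λ i k → v i (suc k)) + v (suc n) 0)
      ≈⟨ +-congˡ (sym (anti-last n v)) ⟩
    anti (suc n) u + anti (suc n) v ∎
    where
    open SetoidReasoning setoid
    h′ : ℕ → ℕ → Carrier
    h′ i k = h (suc i) k

-- Power series over R, compared only in degrees at most T.
module PowerSeries (R : CommutativeRing 0ℓ 0ℓ) (T : ℕ) where
  private module R = CommutativeRing R
  open R using (Carrier) renaming (_≈_ to _≈ᴿ_)
  open Antidiagonal R public using (anti)
  private module A = Antidiagonal R

  Series : Set
  Series = ℕ → Carrier

  infixl 6 _⊕_
  infixl 7 _⊗_
  infix 8 ⊝_
  infix 4 _≋_

  _≋_ : Series → Series → Set
  f ≋ g = ∀ n → n ℕ.≤ T → f n ≈ᴿ g n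

  _⊕_ _⊗_ : Series → Series → Series
  (f ⊕ g) n = f n R.+ g n
  (f ⊗ g) n = anti n (λ i k → f i R.* g k)

  ⊝_ : Series → Series
  (⊝ f) n = R.- f n

  𝟘 𝟙 : Series
  𝟘 _ = R.0#
  𝟙 zero = R.1#
  𝟙 (suc _) = R.0#

  private
    tail : Series → Series
    tail f n = f (suc n)

    -- Names ending in ᵖ are laws in a single degree n. A product in degree n involves only degrees
    -- up to n, which is why equality up to T is respected by multiplication.
    ⊗-congᵖ : ∀ n {f f′ g g′} → (∀ i → i ℕ.≤ n → f i ≈ᴿ f′ i) → (∀ i → i ℕ.≤ n → g i ≈ᴿ g′ i) →
      (f ⊗ g) n ≈ᴿ (f′ ⊗ g′) n
    ⊗-congᵖ n p r = A.anti-cong n (λ i k e → R.*-cong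
      (p i (≡.subst (i ℕ.≤_) e (ℕP.m≤m+n i k))) (r k (≡.subst (k ℕ.≤_) e (ℕP.m≤n+m k i))))

    ⊗-distribʳᵖ : ∀ n h f g → ((f ⊕ g) ⊗ h) n ≈ᴿ (f ⊗ h) n R.+ (g ⊗ h) n
    ⊗-distribʳᵖ n h f g = R.trans (A.anti-cong n (λ i k _ → R.distribʳ _ _ _)) (A.anti-+ n _ _)

    ⊗-commᵖ : ∀ n f g → (f ⊗ g) n ≈ᴿ (g ⊗ f) n
    ⊗-commᵖ n f g = R.trans (R.sym (A.anti-flip n _)) (A.anti-cong n (λ i k _ → R.*-comm _ _))

    ⊗-zeroˡᵖ : ∀ n f → (𝟘 ⊗ f) n ≈ᴿ R.0#
    ⊗-zeroˡᵖ n f = R.trans (A.anti-cong n (λ i k _ → R.zeroˡ _)) (A.anti-0 n)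

    ⊗-identityˡᵖ : ∀ n f → (𝟙 ⊗ f) n ≈ᴿ f n
    ⊗-identityˡᵖ zero    f = R.*-identityˡ _
    ⊗-identityˡᵖ (suc n) f = R.trans (R.+-cong (R.*-identityˡ _) (⊗-zeroˡᵖ n f)) (R.+-identityʳ _)

    ⊗-scaleᵖ : ∀ n c f g → ((λ i → c R.* f i) ⊗ g) n ≈ᴿ c R.* (f ⊗ g) n
    ⊗-scaleᵖ n c f g = R.trans (A.anti-cong n (λ i k _ → R.*-assoc _ _ _)) (A.anti-*ˡ n c _)

    -- By the recursion of `anti`, the tail of f ⊗ g is f 0 · tail g + tail f ⊗ g definitionally, so
    -- the degree drops by one and induction applies.
    ⊗-assocᵖ : ∀ n f g h → ((f ⊗ g) ⊗ h) n ≈ᴿ (f ⊗ (g ⊗ h)) n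
    ⊗-assocᵖ zero    f g h = R.*-assoc _ _ _
    ⊗-assocᵖ (suc n) f g h = begin
      (f 0 R.* g 0) R.* h (suc n) R.+ (((λ i → f 0 R.* tail g i) ⊕ (tail f ⊗ g)) ⊗ h) n
        ≈⟨ R.+-cong (R.*-assoc _ _ _) (⊗-distribʳᵖ n h _ _) ⟩
      f 0 R.* (g 0 R.* h (suc n)) R.+ (((λ i → f 0 R.* tail g i) ⊗ h) n R.+ ((tail f ⊗ g) ⊗ h) n)
        ≈⟨ R.+-congˡ (R.+-cong (⊗-scaleᵖ n (f 0) (tail g) h) (⊗-assocᵖ n (tail f) g h)) ⟩
      f 0 R.* (g 0 R.* h (suc n)) R.+ (f 0 R.* (tail g ⊗ h) n R.+ (tail f ⊗ (g ⊗ h)) n)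
        ≈⟨ Rearrange.ab+[ac+d] R _ _ _ _ ⟩
      f 0 R.* (g 0 R.* h (suc n) R.+ (tail g ⊗ h) n) R.+ (tail f ⊗ (g ⊗ h)) n ∎
      where
      open SetoidReasoning R.setoid

  seriesRing : CommutativeRing 0ℓ 0ℓ
  seriesRing = record
    { Carrier = Series ; _≈_ = _≋_ ; _+_ = _⊕_ ; _*_ = _⊗_ ; -_ = ⊝_ ; 0# = 𝟘 ; 1# = 𝟙
    ; isCommutativeRing = record
      { isRing = record
        { +-isAbelianGroup = record
          { isGroup = record
            { isMonoid = record
              { isSemigroup = record
                { isMagma = record
                  { isEquivalence = record
                    { refl = λ _ _ → R.refl
                    ; sym = λ e n p → R.sym (e n p)
                    ; trans = λ e e′ n p → R.trans (e n p) (e′ n p) }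
                  ; ∙-cong = λ e e′ n p → R.+-cong (e n p) (e′ n p) }
                ; assoc = λ _ _ _ _ _ → R.+-assoc _ _ _ }
              ; identity = (λ _ _ _ → R.+-identityˡ _) , (λ _ _ _ → R.+-identityʳ _) }
            ; inverse = (λ _ _ _ → R.-‿inverseˡ _) , (λ _ _ _ → R.-‿inverseʳ _)
            ; ⁻¹-cong = λ e n p → R.-‿cong (e n p) }
          ; comm = λ _ _ _ _ → R.+-comm _ _ }
        ; *-cong = λ e e′ n p → ⊗-congᵖ n (λ i q → e i (ℕP.≤-trans q p)) (λ i q → e′ i (ℕP.≤-trans q p))
        ; *-assoc = λ f g h n _ → ⊗-assocᵖ n f g h
        ; *-identity = (λ f n _ → ⊗-identityˡᵖ n f)
                     , (λ f n _ → R.trans (⊗-commᵖ n f 𝟙) (⊗-identityˡᵖ n f))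
        ; distrib = (λ h f g n _ → R.trans (⊗-commᵖ n h _)
                        (R.trans (⊗-distribʳᵖ n h f g) (R.+-cong (⊗-commᵖ n f h) (⊗-commᵖ n g h))))
                  , (λ h f g n _ → ⊗-distribʳᵖ n h f g) }
      ; *-comm = λ f g n _ → ⊗-commᵖ n f g } }

  q^_ : ℕ → Series
  (q^ zero) zero = R.1#
  (q^ zero) (suc n) = R.0#
  (q^ suc k) zero = R.0#
  (q^ suc k) (suc n) = (q^ k) n

  private
    q^-suc-⊗ : ∀ k f n → (q^ suc k ⊗ f) (suc n) ≈ᴿ (q^ k ⊗ f) n
    q^-suc-⊗ k f n = R.trans (R.+-congʳ (R.zeroˡ _)) (R.+-identityˡ _)

  q^0 : q^ 0 ≋ 𝟙
  q^0 zero    _ = R.refl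
  q^0 (suc n) _ = R.refl

  q^-shift : ∀ k f n → (q^ k ⊗ f) (k ℕ.+ n) ≈ᴿ f n
  q^-shift zero f n = R.trans (⊗-congᵖ n {g = f} (λ { zero _ → R.refl ; (suc i) _ → R.refl }) (λ _ _ → R.refl)) (⊗-identityˡᵖ n f)
  q^-shift (suc k) f n = R.trans (q^-suc-⊗ k f (k ℕ.+ n)) (q^-shift k f n)

  q^-low : ∀ k f n → n ℕ.< k → (q^ k ⊗ f) n ≈ᴿ R.0#
  q^-low (suc k) f zero    _       = R.zeroˡ _
  q^-low (suc k) f (suc n) (s≤s p) = R.trans (q^-suc-⊗ k f n) (q^-low k f n p)

  q^-hit : ∀ k → (q^ k) k ≈ᴿ R.1#
  q^-hit zero    = R.refl
  q^-hit (suc k) = q^-hit k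

  q^-miss : ∀ k n → k ≢ n → (q^ k) n ≈ᴿ R.0#
  q^-miss zero    zero    p = ⊥-elim (p ≡.refl)
  q^-miss zero    (suc n) p = R.refl
  q^-miss (suc k) zero    p = R.refl
  q^-miss (suc k) (suc n) p = q^-miss k n (λ e → p (≡.cong suc e))

  private
    q^-+ᵖ : ∀ k l n → (q^ k ⊗ q^ l) n ≈ᴿ (q^ (k ℕ.+ l)) n
    q^-+ᵖ zero    l n       = q^-shift 0 (q^ l) n
    q^-+ᵖ (suc k) l zero    = R.zeroˡ _
    q^-+ᵖ (suc k) l (suc n) = R.trans (q^-suc-⊗ k (q^ l) n) (q^-+ᵖ k l n)

  q^-+ : ∀ k l → q^ k ⊗ q^ l ≋ q^ (k ℕ.+ l)
  q^-+ k l n _ = q^-+ᵖ k l n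

  q^-big : ∀ k → T ℕ.< k → q^ k ≋ 𝟘
  q^-big k p n r = q^-miss k n (λ e → ℕP.<⇒≱ p (≡.subst (ℕ._≤ T) (≡.sym e) r))

  D : ℕ → Series
  D k = 𝟙 ⊕ ⊝ (q^ k)

  private
    D⊗ : ∀ k f n → (D k ⊗ f) n ≈ᴿ f n R.+ R.- (q^ k ⊗ f) n
    D⊗ k f n = R.trans (⊗-distribʳᵖ n f 𝟙 (⊝ (q^ k)))
      (R.+-cong (⊗-identityˡᵖ n f)
        (R.trans (A.anti-cong n (λ _ _ _ → R.sym (-‿distribˡ-* _ _)))
          (R.trans (A.anti-cong n (λ _ _ _ → R.sym (-1*x≈-x _))) (R.trans (A.anti-*ˡ n _ _) (-1*x≈-x _)))))
      where open RingProps R.ring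

  D-low : ∀ k f n → n ℕ.< k → (D k ⊗ f) n ≈ᴿ f n
  D-low k f n p = R.trans (D⊗ k f n) (R.trans (R.+-congˡ
    (R.trans (R.-‿cong (q^-low k f n p)) (RingProps.-0#≈0# R.ring))) (R.+-identityʳ _))

  D-shift : ∀ k f n → (D k ⊗ f) (k ℕ.+ n) ≈ᴿ f (k ℕ.+ n) R.+ R.- f n
  D-shift k f n = R.trans (D⊗ k f (k ℕ.+ n)) (R.+-congˡ (R.-‿cong (q^-shift k f n)))

  D-big : ∀ k → T ℕ.< k → D k ≋ 𝟙
  D-big k p n r = R.trans (R.+-congˡ (R.trans (R.-‿cong (q^-big k p n r)) (RingProps.-0#≈0# R.ring))) (R.+-identityʳ _)

  -- The coefficient of f in degree n is that of the product in degree n plus that of f in degree n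
  -- - (k + 1), so coefficients are recovered in increasing order. The bound `b` makes this descent
  -- structural.
  D-cancel : ∀ k {f g} → D (suc k) ⊗ f ≋ D (suc k) ⊗ g → f ≋ g
  D-cancel k {f} {g} e n = go n n ℕP.≤-refl
    where
    go : ∀ b n → n ℕ.≤ b → n ℕ.≤ T → f n ≈ᴿ g n
    go b n n≤b n≤T with suc k ℕ.≤? n
    ... | no k≰n = R.trans (R.sym (D-low (suc k) f n k>n)) (R.trans (e n n≤T) (D-low (suc k) g n k>n))
      where
      k>n : n ℕ.< suc k
      k>n = ℕP.≰⇒> k≰n
    go zero n n≤b n≤T | yes k≤n = ⊥-elim (ℕP.1+n≰n (ℕP.≤-trans (ℕP.≤-trans (s≤s z≤n) k≤n) n≤b))
    go (suc b) n n≤b n≤T | yes k≤n with ℕP.m≤n⇒∃[o]m+o≡n k≤n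
    ... | m , ≡.refl = RingProps.+-cancelʳ R.ring (R.- f m) (f (suc k ℕ.+ m)) (g (suc k ℕ.+ m))
        (R.trans (R.sym (D-shift (suc k) f m)) (R.trans (e _ n≤T) (R.trans (D-shift (suc k) g m)
          (R.+-congˡ (R.-‿cong (R.sym (go b m m≤b (ℕP.≤-trans (ℕP.m≤n+m m (suc k)) n≤T))))))))
      where
      m≤b : m ℕ.≤ b
      m≤b = ℕP.≤-trans (ℕP.m≤n+m m k) (ℕP.≤-pred n≤b)

-- Finite sums over lists and their reindexing.

module Summation (R : CommutativeRing 0ℓ 0ℓ) where
  open CommutativeRing R hiding (zero)
  open Rearrange R
  open Antidiagonal R using (anti)

  private variable
    I J : Set

  ∑ : List I → (I → Carrier) → Carrier
  ∑ []       g = 0#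
  ∑ (x ∷ xs) g = g x + ∑ xs g

  ∑-cong : ∀ (xs : List I) {g h} → (∀ x → g x ≈ h x) → ∑ xs g ≈ ∑ xs h
  ∑-cong []       e = refl
  ∑-cong (x ∷ xs) e = +-cong (e x) (∑-cong xs e)

  ∑-0 : ∀ (xs : List I) → ∑ xs (λ _ → 0#) ≈ 0#
  ∑-0 []       = refl
  ∑-0 (x ∷ xs) = trans (+-identityˡ _) (∑-0 xs)

  ∑-+ : ∀ (xs : List I) g h → ∑ xs (λ x → g x + h x) ≈ ∑ xs g + ∑ xs h
  ∑-+ []       g h = sym (+-identityˡ _)
  ∑-+ (x ∷ xs) g h = trans (+-congˡ (∑-+ xs g h)) ([a+b]+[c+d] _ _ _ _)

  ∑-*ˡ : ∀ c (xs : List I) g → ∑ xs (λ x → c * g x) ≈ c * ∑ xs g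
  ∑-*ˡ c []       g = sym (zeroʳ c)
  ∑-*ˡ c (x ∷ xs) g = trans (+-congˡ (∑-*ˡ c xs g)) (sym (distribˡ c _ _))

  ∑-swap : ∀ (xs : List I) (ys : List J) (g : I → J → Carrier) →
    ∑ xs (λ x → ∑ ys (g x)) ≈ ∑ ys (λ y → ∑ xs (λ x → g x y))
  ∑-swap []       ys g = sym (∑-0 ys)
  ∑-swap (x ∷ xs) ys g = trans (+-congˡ (∑-swap xs ys g)) (sym (∑-+ ys _ _))

  ∑-++ : ∀ (xs ys : List I) g → ∑ (xs ++ ys) g ≈ ∑ xs g + ∑ ys g
  ∑-++ []       ys g = sym (+-identityˡ _)
  ∑-++ (x ∷ xs) ys g = trans (+-congˡ (∑-++ xs ys g)) (sym (+-assoc _ _ _))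

  ∑-map : ∀ (f : I → J) xs g → ∑ (map f xs) g ≈ ∑ xs (λ x → g (f x))
  ∑-map f []       g = refl
  ∑-map f (x ∷ xs) g = +-congˡ (∑-map f xs g)

  ∑-× : ∀ (xs : List I) (ys : List J) (g : I × J → Carrier) →
    ∑ (cartesianProduct xs ys) g ≈ ∑ xs (λ x → ∑ ys (λ y → g (x , y)))
  ∑-× []       ys g = refl
  ∑-× (x ∷ xs) ys g = trans (∑-++ (map (x ,_) ys) _ g) (+-cong (∑-map (x ,_) ys g) (∑-× xs ys g))

  infixl 5 _when_
  _when_ : ∀ {p} {P : Set p} → Carrier → Dec P → Carrier
  c when yes _ = c
  c when no  _ = 0#

  when-cong : ∀ {P Q : Set} {c d} (p : Dec P) (q : Dec Q) → (P → Q) → (Q → P) → (P → c ≈ d) →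
    (c when p) ≈ (d when q)
  when-cong (yes p) (yes q) f g e = e p
  when-cong (yes p) (no ¬q) f g e = ⊥-elim (¬q (f p))
  when-cong (no ¬p) (yes q) f g e = ⊥-elim (¬p (g q))
  when-cong (no ¬p) (no ¬q) f g e = refl

  when-0 : ∀ {P : Set} {c} (p : Dec P) → c ≈ 0# → (c when p) ≈ 0#
  when-0 (yes _) e = e
  when-0 (no _)  e = refl

  when-yes : ∀ {P : Set} {c} (p : Dec P) → P → (c when p) ≈ c
  when-yes (yes _) p = refl
  when-yes (no ¬p) p = ⊥-elim (¬p p)

  when-no : ∀ {P : Set} {c} (p : Dec P) → ¬ P → (c when p) ≈ 0#
  when-no (yes p) ¬p = ⊥-elim (¬p p)
  when-no (no _)  ¬p = refl

  ∑-zero : ∀ (xs : List I) g → (∀ x → x ∈ xs → g x ≈ 0#) → ∑ xs g ≈ 0#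
  ∑-zero []       g e = refl
  ∑-zero (x ∷ xs) g e = trans (+-cong (e x (here ≡.refl)) (∑-zero xs g (λ y m → e y (there m)))) (+-identityˡ _)

  ∑-single : ∀ {xs : List I} {a} → Unique xs → a ∈ xs → ∀ g → (∀ x → x ≢ a → g x ≈ 0#) → ∑ xs g ≈ g a
  ∑-single (x∉xs AllPairs.∷ _) (here ≡.refl) g e =
    trans (+-congˡ (∑-zero _ g (λ y m → e y (λ y≡a → All.lookup x∉xs m (≡.sym y≡a))))) (+-identityʳ _)
  ∑-single (x∉xs AllPairs.∷ u) (there m) g e =
    trans (+-cong (e _ (All.lookup x∉xs m)) (∑-single u m g e)) (+-identityˡ _)

  ∑-cong-∈ : ∀ (xs : List I) {g h} → (∀ x → x ∈ xs → g x ≈ h x) → ∑ xs g ≈ ∑ xs h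
  ∑-cong-∈ []       e = refl
  ∑-cong-∈ (x ∷ xs) e = +-cong (e x (here ≡.refl)) (∑-cong-∈ xs (λ y m → e y (there m)))

  -- Double counting of the pairs with f a = b. The alternatives `≈ 0#` allow indices of weight zero
  -- to leave the target list or to have no preimage, so a bijection is needed only between the
  -- supports.
  ∑-reindex : ∀ {I J : Set} → DecidableEquality J → ∀ {xs : List I} {ys : List J} → Unique xs → Unique ys →
    ∀ (f : I → J) {g h} → (∀ {a a′} → f a ≡ f a′ → a ≡ a′) →
    (∀ a → a ∈ xs → g a ≈ 0# ⊎ (f a ∈ ys × h (f a) ≈ g a)) →
    (∀ b → b ∈ ys → h b ≈ 0# ⊎ ∃ λ a → a ∈ xs × f a ≡ b × g a ≈ h b) →
    ∑ xs g ≈ ∑ ys h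
  ∑-reindex _≟_ {xs} {ys} uxs uys f {g} {h} inj to from = begin
    ∑ xs g                                        ≈⟨ ∑-cong-∈ xs expand ⟩
    ∑ xs (λ a → ∑ ys (λ b → g a when (f a ≟ b)))  ≈⟨ ∑-swap xs ys _ ⟩
    ∑ ys (λ b → ∑ xs (λ a → g a when (f a ≟ b)))  ≈⟨ ∑-cong-∈ ys collect ⟩
    ∑ ys h                                        ∎
    where
    open SetoidReasoning setoid
    expand : ∀ a → a ∈ xs → g a ≈ ∑ ys (λ b → g a when (f a ≟ b))
    expand a m′ with to a m′
    ... | inj₁ z = trans z (sym (∑-zero ys _ (λ b _ → when-0 (f a ≟ b) z)))
    ... | inj₂ (m , _) = sym (trans (∑-single uys m _ (λ b n → when-no (f a ≟ b) (λ e → n (≡.sym e))))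
                                    (when-yes (f a ≟ f a) ≡.refl))
    collect : ∀ b → b ∈ ys → ∑ xs (λ a → g a when (f a ≟ b)) ≈ h b
    collect b m′ with from b m′
    ... | inj₂ (a , m , ≡.refl , e) = trans
      (∑-single uxs m _ (λ a′ n → when-no (f a′ ≟ f a) (λ e′ → n (inj e′))))
      (trans (when-yes (f a ≟ f a) ≡.refl) e)
    ... | inj₁ z = trans (∑-zero xs _ vanish) (sym z)
      where
      vanish : ∀ a → a ∈ xs → (g a when (f a ≟ b)) ≈ 0#
      vanish a m with f a ≟ b
      ... | no _ = refl
      ... | yes ≡.refl with to a m
      ...   | inj₁ e = e
      ...   | inj₂ (_ , e) = trans (sym e) z

-- Finite products, Gaussian binomial coefficients and the Jacobi triple product.

module FiniteProduct (R : CommutativeRing 0ℓ 0ℓ) where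
  open CommutativeRing R hiding (zero)
  open Rearrange R

  ∏ : (ℕ → Carrier) → ℕ → Carrier
  ∏ f zero    = 1#
  ∏ f (suc n) = ∏ f n * f n

  ∏-cong : ∀ {f g} n → (∀ k → f k ≈ g k) → ∏ f n ≈ ∏ g n
  ∏-cong zero    e = refl
  ∏-cong (suc n) e = *-cong (∏-cong n e) (e n)

  ∏-* : ∀ f g n → ∏ (λ k → f k * g k) n ≈ ∏ f n * ∏ g n
  ∏-* f g zero    = sym (*-identityˡ _)
  ∏-* f g (suc n) = trans (*-congʳ (∏-* f g n)) ([ab][cd] _ _ _ _)

  ∏-+ : ∀ f m n → ∏ f (m ℕ.+ n) ≈ ∏ f m * ∏ (λ k → f (m ℕ.+ k)) n
  ∏-+ f m zero    rewrite ℕP.+-identityʳ m = sym (*-identityʳ _)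
  ∏-+ f m (suc n) rewrite ℕP.+-suc m n = trans (*-congʳ (∏-+ f m n)) (*-assoc _ _ _)

  ∏-blocks : ∀ f b n → ∏ f (n ℕ.* b) ≈ ∏ (λ k → ∏ (λ i → f (k ℕ.* b ℕ.+ i)) b) n
  ∏-blocks f b zero    = refl
  ∏-blocks f b (suc n) rewrite ℕP.+-comm b (n ℕ.* b) =
    trans (∏-+ f (n ℕ.* b) b) (*-congʳ (∏-blocks f b n))

  -- Takes the place of invertibility: identities with quotients are proved after clearing
  -- denominators, and the common factor is then removed.
  Cancellable : Carrier → Set
  Cancellable c = ∀ {x y} → c * x ≈ c * y → x ≈ y

  *-cancellable : ∀ {a b} → Cancellable a → Cancellable b → Cancellable (a * b)
  *-cancellable ca cb e = cb (ca (trans (sym (*-assoc _ _ _)) (trans e (*-assoc _ _ _))))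

  ∏-cancellable : ∀ f n → (∀ k → Cancellable (f k)) → Cancellable (∏ f n)
  ∏-cancellable f zero    c e = trans (sym (*-identityˡ _)) (trans e (*-identityˡ _))
  ∏-cancellable f (suc n) c   = *-cancellable (∏-cancellable f n c) (c n)

module TripleProduct (R : CommutativeRing 0ℓ 0ℓ) (T : ℕ) where
  open PowerSeries R T public using (Series; q^_; q^-+; q^0; q^-big; D; D-big; D-cancel; D-low; D-shift; seriesRing; q^-hit; q^-miss)
  open CommutativeRing seriesRing hiding (zero)
  open FiniteProduct seriesRing public
  open Rearrange seriesRing
  open RingProps ring using (-‿distribˡ-*; -0#≈0#)
  open SetoidReasoning setoid

  D-cong : ∀ {k l} → k ≡ l → D k ≈ D l
  D-cong ≡.refl = refl

  D-cancellable : ∀ k → 0 ℕ.< k → Cancellable (D k)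
  D-cancellable (suc k) _ = D-cancel k

  -- (1 - x) + x (1 - y) = 1 - x y with x = q^k and y = q^l; both q-Pascal rules rest on it.
  D-+ : ∀ k l → D k + q^ k * D l ≈ D (k ℕ.+ l)
  D-+ k l = begin
    D k + q^ k * D l ≈⟨ 1-x+x[1-y] (q^ k) (q^ l) ⟩
    (1# + - (q^ k * q^ l)) + (- (q^ k) + q^ k) ≈⟨ +-cong (+-congˡ (-‿cong (q^-+ k l))) (-‿inverseˡ (q^ k)) ⟩
    D (k ℕ.+ l) + 0# ≈⟨ +-identityʳ _ ⟩
    D (k ℕ.+ l) ∎

  -- The q-Pochhammer symbol (Q; Q)_n with Q = q^M.
  poch : ℕ → ℕ → Series
  poch M n = ∏ (λ k → D (M ℕ.* suc k)) n

  poch-cancellable : ∀ {M} n → 0 ℕ.< M → Cancellable (poch M n)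
  poch-cancellable {M} n M>0 = ∏-cancellable _ n (λ k → D-cancellable _ (ℕP.≤-trans M>0 (ℕP.m≤m*n M (suc k))))

  ∏-stable : ∀ f → (∀ k → T ℕ.≤ k → f k ≈ 1#) → ∀ d → ∏ f (T ℕ.+ d) ≈ ∏ f T
  ∏-stable f big zero    rewrite ℕP.+-identityʳ T = refl
  ∏-stable f big (suc d) rewrite ℕP.+-suc T d =
    trans (*-cong (∏-stable f big d) (big _ (ℕP.m≤m+n T d))) (*-identityʳ _)

  -- Factors from index T on are 1 up to degree T, so any T or more factors already give the
  -- infinite product. This replaces every passage to the limit.
  ∏-large : ∀ f → (∀ k → T ℕ.≤ k → f k ≈ 1#) → ∀ {m n} → T ℕ.≤ m → T ℕ.≤ n → ∏ f m ≈ ∏ f n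
  ∏-large f big p r with ℕP.m≤n⇒∃[o]m+o≡n p | ℕP.m≤n⇒∃[o]m+o≡n r
  ... | d , ≡.refl | d′ , ≡.refl = trans (∏-stable f big d) (sym (∏-stable f big d′))

  poch-large : ∀ {M m n} → 0 ℕ.< M → T ℕ.≤ m → T ℕ.≤ n → poch M m ≈ poch M n
  poch-large {M} M>0 = ∏-large _ (λ k T≤k → D-big _
    (ℕP.≤-trans (s≤s T≤k) (ℕP.m≤n*m (suc k) M {{ℕ.>-nonZero M>0}})))

  -- gauss M i k is the Gaussian binomial coefficient [i+k choose i] in q^M.
  gauss : ℕ → ℕ → ℕ → Series
  gauss M zero    k       = 1#
  gauss M (suc i) zero    = 1#
  gauss M (suc i) (suc k) = gauss M (suc i) k + q^ (M ℕ.* suc k) * gauss M i (suc k)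

  -- The quotient formula (Q; Q)_{i+k} / ((Q; Q)_i (Q; Q)_k) with denominators cleared. The
  -- induction on i + k uses 1 - Q^(i+k+2) = (1 - Q^(k+1)) + Q^(k+1) (1 - Q^(i+1)).
  gauss-poch : ∀ M i k → gauss M i k * (poch M i * poch M k) ≈ poch M (i ℕ.+ k)
  gauss-poch M zero    k    = trans (*-identityˡ _) (*-identityˡ _)
  gauss-poch M (suc i) zero rewrite ℕP.+-identityʳ i = trans (*-identityˡ _) (*-identityʳ _)
  gauss-poch M (suc i) (suc k) = begin
    gauss M (suc i) (suc k) * (poch M (suc i) * poch M (suc k))
      ≈⟨ pascal-left _ _ _ _ _ _ _ ⟩
    gauss M (suc i) k * (poch M (suc i) * poch M k) * Dₖ + x * (gauss M i (suc k) * (poch M i * poch M (suc k)) * Dᵢ)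
      ≈⟨ +-cong (*-congʳ (gauss-poch M (suc i) k)) (*-congˡ (*-congʳ ih)) ⟩
    P * Dₖ + x * (P * Dᵢ)    ≈⟨ factor-left _ _ _ _ ⟩
    P * (Dₖ + x * Dᵢ)        ≈⟨ *-congˡ {P} (D-+ (M ℕ.* suc k) (M ℕ.* suc i)) ⟩
    P * D (M ℕ.* suc k ℕ.+ M ℕ.* suc i) ≈⟨ *-congˡ (D-cong (arith M i k)) ⟩
    P * D (M ℕ.* suc (suc i ℕ.+ k)) ≡⟨ ≡.cong (poch M) (≡.sym (ℕP.+-suc (suc i) k)) ⟩
    poch M (suc i ℕ.+ suc k) ∎
    where
    x = q^ (M ℕ.* suc k)
    Dₖ = D (M ℕ.* suc k)
    Dᵢ = D (M ℕ.* suc i)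
    P = poch M (suc i ℕ.+ k)
    ih : gauss M i (suc k) * (poch M i * poch M (suc k)) ≈ P
    ih = trans (gauss-poch M i (suc k)) (reflexive (≡.cong (poch M) (ℕP.+-suc i k)))
    arith : ∀ M i k → M ℕ.* suc k ℕ.+ M ℕ.* suc i ≡ M ℕ.* suc (suc i ℕ.+ k)
    arith = ℕS.solve-∀

  -- The second q-Pascal rule, the first being the definition. Both sides agree after multiplication
  -- by Pochhammer symbols, where the roles of i and k are interchangeable.
  gauss-pascal : ∀ M → 0 ℕ.< M → ∀ i k →
    gauss M (suc i) (suc k) ≈ q^ (M ℕ.* suc i) * gauss M (suc i) k + gauss M i (suc k)
  gauss-pascal M M>0 i k = *-cancellable (poch-cancellable (suc i) M>0) (poch-cancellable (suc k) M>0) (begin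
    (poch M (suc i) * poch M (suc k)) * gauss M (suc i) (suc k) ≈⟨ trans (*-comm _ _) (gauss-poch M (suc i) (suc k)) ⟩
    poch M (suc i ℕ.+ suc k) ≡⟨ ≡.cong (poch M) (ℕP.+-suc (suc i) k) ⟩
    P * D (M ℕ.* suc (suc i ℕ.+ k)) ≈⟨ *-congˡ (D-cong (arith M i k)) ⟩
    P * D (M ℕ.* suc i ℕ.+ M ℕ.* suc k) ≈⟨ *-congˡ {P} (sym (D-+ (M ℕ.* suc i) (M ℕ.* suc k))) ⟩
    P * (Dᵢ + x * Dₖ) ≈⟨ sym (factor-right _ _ _ _) ⟩
    x * (P * Dₖ) + P * Dᵢ
      ≈⟨ sym (+-cong (*-congˡ (*-congʳ (gauss-poch M (suc i) k))) (*-congʳ ih)) ⟩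
    x * (gauss M (suc i) k * (poch M (suc i) * poch M k) * Dₖ) + gauss M i (suc k) * (poch M i * poch M (suc k)) * Dᵢ
      ≈⟨ sym (pascal-right _ _ _ _ _ _ _) ⟩
    (x * gauss M (suc i) k + gauss M i (suc k)) * (poch M (suc i) * poch M (suc k)) ≈⟨ *-comm _ _ ⟩
    (poch M (suc i) * poch M (suc k)) * (x * gauss M (suc i) k + gauss M i (suc k)) ∎)
    where
    x = q^ (M ℕ.* suc i)
    Dₖ = D (M ℕ.* suc k)
    Dᵢ = D (M ℕ.* suc i)
    P = poch M (suc i ℕ.+ k)
    ih : gauss M i (suc k) * (poch M i * poch M (suc k)) ≈ P
    ih = trans (gauss-poch M i (suc k)) (reflexive (≡.cong (poch M) (ℕP.+-suc i k)))
    arith : ∀ M i k → M ℕ.* suc (suc i ℕ.+ k) ≡ M ℕ.* suc i ℕ.+ M ℕ.* suc k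
    arith = ℕS.solve-∀

  ±[_] : ℕ → Series → Series
  ±[ zero  ] f = f
  ±[ suc n ] f = - ±[ n ] f

  ±-cong : ∀ n {f g} → f ≈ g → ±[ n ] f ≈ ±[ n ] g
  ±-cong zero    e = e
  ±-cong (suc n) e = -‿cong (±-cong n e)

  ±-*ˡ : ∀ n f g → ±[ n ] f * g ≈ ±[ n ] (f * g)
  ±-*ˡ zero    f g = refl
  ±-*ˡ (suc n) f g = trans (sym (-‿distribˡ-* _ _)) (-‿cong (±-*ˡ n f g))

  ±-0 : ∀ n {f} → f ≈ 0# → ±[ n ] f ≈ 0#
  ±-0 zero    e = e
  ±-0 (suc n) e = trans (-‿cong (±-0 n e)) -0#≈0#

-- With j = i − m, exponent a c i m = (a + c) j (j − 1) / 2 + a j.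
exponent : ℕ → ℕ → ℕ → ℕ → ℕ
exponent a c zero    zero    = 0
exponent a c (suc i) (suc m) = exponent a c i m
exponent a c (suc i) zero    = exponent a c i zero ℕ.+ (a ℕ.+ (a ℕ.+ c) ℕ.* i)
exponent a c zero    (suc m) = exponent a c zero m ℕ.+ (c ℕ.+ (a ℕ.+ c) ℕ.* m)

-- With j = i - m the exponent grows by a + (a + c) j from j to j + 1, and i + k = n + m means k = n
-- - j, so j drops out. The right side is then the exponent carried by the factor with index n of
-- the first half product.
exponent-sucˡ : ∀ a c i m n k → i ℕ.+ k ≡ n ℕ.+ m →
  exponent a c (suc i) m ℕ.+ (a ℕ.+ c) ℕ.* k ≡ (a ℕ.+ (a ℕ.+ c) ℕ.* n) ℕ.+ exponent a c i m
exponent-sucˡ a c zero    zero    n k e rewrite ≡.trans e (ℕP.+-identityʳ n) = lemma a c n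
  where
  lemma : ∀ a c n → a ℕ.+ (a ℕ.+ c) ℕ.* 0 ℕ.+ (a ℕ.+ c) ℕ.* n ≡ a ℕ.+ (a ℕ.+ c) ℕ.* n ℕ.+ 0
  lemma = ℕS.solve-∀
exponent-sucˡ a c (suc i) zero    n k e rewrite ≡.sym (≡.trans e (ℕP.+-identityʳ n)) =
  lemma a c i k (exponent a c i zero)
  where
  lemma : ∀ a c i k x → x ℕ.+ (a ℕ.+ (a ℕ.+ c) ℕ.* i) ℕ.+ (a ℕ.+ (a ℕ.+ c) ℕ.* (suc i)) ℕ.+ (a ℕ.+ c) ℕ.* k
    ≡ a ℕ.+ (a ℕ.+ c) ℕ.* (suc i ℕ.+ k) ℕ.+ (x ℕ.+ (a ℕ.+ (a ℕ.+ c) ℕ.* i))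
  lemma = ℕS.solve-∀
exponent-sucˡ a c zero    (suc m) n k e rewrite e = lemma a c n m (exponent a c zero m)
  where
  lemma : ∀ a c n m x → x ℕ.+ (a ℕ.+ c) ℕ.* (n ℕ.+ suc m)
    ≡ a ℕ.+ (a ℕ.+ c) ℕ.* n ℕ.+ (x ℕ.+ (c ℕ.+ (a ℕ.+ c) ℕ.* m))
  lemma = ℕS.solve-∀
exponent-sucˡ a c (suc i) (suc m) n k e =
  exponent-sucˡ a c i m n k (ℕP.suc-injective (≡.trans e (ℕP.+-suc n m)))

-- The same computation for the step from j to j - 1, where i - j = m; it serves the factors 1 -
-- q^(c + (a + c) m).
exponent-sucʳ : ∀ a c i m →
  exponent a c i (suc m) ℕ.+ (a ℕ.+ c) ℕ.* i ≡ (c ℕ.+ (a ℕ.+ c) ℕ.* m) ℕ.+ exponent a c i m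
exponent-sucʳ a c zero    m = lemma a c m (exponent a c zero m)
  where
  lemma : ∀ a c m x → x ℕ.+ (c ℕ.+ (a ℕ.+ c) ℕ.* m) ℕ.+ (a ℕ.+ c) ℕ.* 0 ≡ (c ℕ.+ (a ℕ.+ c) ℕ.* m) ℕ.+ x
  lemma = ℕS.solve-∀
exponent-sucʳ a c (suc i) zero    = lemma a c i (exponent a c i zero)
  where
  lemma : ∀ a c i x → x ℕ.+ (a ℕ.+ c) ℕ.* suc i ≡ (c ℕ.+ (a ℕ.+ c) ℕ.* 0) ℕ.+ (x ℕ.+ (a ℕ.+ (a ℕ.+ c) ℕ.* i))
  lemma = ℕS.solve-∀
exponent-sucʳ a c (suc i) (suc m) = ≡.trans (lemma₁ a c i (exponent a c i (suc m)))
  (≡.trans (≡.cong (ℕ._+ (a ℕ.+ c)) (exponent-sucʳ a c i m)) (lemma₂ a c m (exponent a c i m)))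
  where
  lemma₁ : ∀ a c i x → x ℕ.+ (a ℕ.+ c) ℕ.* suc i ≡ x ℕ.+ (a ℕ.+ c) ℕ.* i ℕ.+ (a ℕ.+ c)
  lemma₁ = ℕS.solve-∀
  lemma₂ : ∀ a c m x → (c ℕ.+ (a ℕ.+ c) ℕ.* m) ℕ.+ x ℕ.+ (a ℕ.+ c) ≡ (c ℕ.+ (a ℕ.+ c) ℕ.* suc m) ℕ.+ x
  lemma₂ = ℕS.solve-∀

-- Together with its mirror image this bounds |i - m| by the exponent, so terms far from the centre
-- lie beyond the truncation degree.
exponent-≥ˡ : ∀ {a c} → 0 ℕ.< a → ∀ i m → i ℕ.≤ exponent a c i m ℕ.+ m
exponent-≥ˡ a>0 zero    m       = z≤n
exponent-≥ˡ {a} {c} a>0 (suc i) zero    = ≡.subst (suc i ℕ.≤_) (≡.sym (ℕP.+-identityʳ _))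
  (≡.subst (ℕ._≤ exponent a c (suc i) zero) (ℕP.+-comm i 1) (ℕP.+-mono-≤
    (≡.subst (i ℕ.≤_) (ℕP.+-identityʳ _) (exponent-≥ˡ a>0 i zero)) (ℕP.≤-trans a>0 (ℕP.m≤m+n _ _))))
exponent-≥ˡ {a} {c} a>0 (suc i) (suc m) = ≡.subst (suc i ℕ.≤_) (≡.sym (ℕP.+-suc _ m)) (s≤s (exponent-≥ˡ a>0 i m))

exponent-≥ʳ : ∀ {a c} → 0 ℕ.< c → ∀ i m → m ℕ.≤ exponent a c i m ℕ.+ i
exponent-≥ʳ c>0 i       zero    = z≤n
exponent-≥ʳ {a} {c} c>0 zero (suc m) = ≡.subst (suc m ℕ.≤_) (≡.sym (ℕP.+-identityʳ _))
  (≡.subst (ℕ._≤ exponent a c zero (suc m)) (ℕP.+-comm m 1) (ℕP.+-mono-≤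
    (≡.subst (m ℕ.≤_) (ℕP.+-identityʳ _) (exponent-≥ʳ c>0 zero m)) (ℕP.≤-trans c>0 (ℕP.m≤m+n _ _))))
exponent-≥ʳ {a} {c} c>0 (suc i) (suc m) = ≡.subst (suc m ℕ.≤_) (≡.sym (ℕP.+-suc _ i)) (s≤s (exponent-≥ʳ c>0 i m))

module JTP (R : CommutativeRing 0ℓ 0ℓ) (T a c : ℕ) (a>0 : 0 ℕ.< a) (c>0 : 0 ℕ.< c) where
  open TripleProduct R T
  open CommutativeRing seriesRing hiding (zero)
  open Rearrange seriesRing
  open RingProps ring using (-‿distribˡ-*; -‿involutive)
  open Antidiagonal seriesRing using (anti; anti-cong; anti-*ˡ; anti-split)
  open SetoidReasoning setoid

  private
    M : ℕ
    M = a ℕ.+ c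
    M>0 : 0 ℕ.< M
    M>0 = ℕP.≤-trans a>0 (ℕP.m≤m+n a c)

  halfA halfC : ℕ → Series
  halfA = ∏ (λ k → D (a ℕ.+ M ℕ.* k))
  halfC = ∏ (λ k → D (c ℕ.+ M ℕ.* k))

  -- The term with index j = i - m of the theta series; i + m has the parity of j and stays in ℕ.
  term : ℕ → ℕ → Series
  term m i = ±[ i ℕ.+ m ] (q^ exponent a c i m)

  private
    gauss₀ : ∀ i → gauss M i 0 ≡ 1#
    gauss₀ zero    = ≡.refl
    gauss₀ (suc i) = ≡.refl

    q^M0* : ∀ f → q^ (M ℕ.* 0) * f ≈ f
    q^M0* f rewrite ℕP.*-zeroʳ M = trans (*-congʳ q^0) (*-identityˡ f)

    q^-mul : ∀ s u {x y} → s ℕ.+ u ≡ x ℕ.+ y → q^ s * q^ u ≈ q^ x * q^ y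
    q^-mul s u {x} {y} e = trans (q^-+ s u) (trans (reflexive (≡.cong q^_ e)) (sym (q^-+ x y)))

    ±-q : ∀ p s u {x y} g → s ℕ.+ u ≡ x ℕ.+ y → ±[ p ] (q^ s) * (q^ u * g) ≈ q^ x * (±[ p ] (q^ y) * g)
    ±-q p s u {x} {y} g e = begin
      ±[ p ] (q^ s) * (q^ u * g)  ≈⟨ a[bg] _ _ _ ⟩
      (±[ p ] (q^ s) * q^ u) * g  ≈⟨ *-congʳ (±-*ˡ p _ _) ⟩
      ±[ p ] (q^ s * q^ u) * g    ≈⟨ *-congʳ (±-cong p (trans (q^-mul s u {x} {y} e) (*-comm (q^ x) (q^ y)))) ⟩
      ±[ p ] (q^ y * q^ x) * g    ≈⟨ *-congʳ (sym (±-*ˡ p _ _)) ⟩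
      (±[ p ] (q^ y) * q^ x) * g  ≈⟨ *-congʳ (*-comm _ _) ⟩
      (q^ x * ±[ p ] (q^ y)) * g  ≈⟨ *-assoc _ _ _ ⟩
      q^ x * (±[ p ] (q^ y) * g)  ∎

    neg-out : ∀ {s g x y} → s * g ≈ x * y → (- s) * g ≈ (- x) * y
    neg-out e = trans (sym (-‿distribˡ-* _ _)) (trans (-‿cong e) (-‿distribˡ-* _ _))

  -- The finite triple product with j = i - m and Gaussian binomial [n+m choose m+j]. Induction on
  -- n, and on m once n = 0: multiplying by one more factor adds a shifted copy of the sum, and a
  -- Pascal rule merges the two.
  finite-JTP : ∀ n m → halfA n * halfC m ≈ anti (n ℕ.+ m) (λ i k → term m i * gauss M i k)
  finite-JTP zero zero = *-congʳ (sym q^0)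
  finite-JTP (suc n) m = begin
    (halfA n * D (a ℕ.+ M ℕ.* n)) * halfC m ≈⟨ [ad]b _ _ _ ⟩
    (halfA n * halfC m) * D (a ℕ.+ M ℕ.* n) ≈⟨ *-congʳ (finite-JTP n m) ⟩
    anti N α * D (a ℕ.+ M ℕ.* n) ≈⟨ sym (a+-xa _ _) ⟩
    anti N α + (- x) * anti N α ≈⟨ +-congˡ (sym (anti-*ˡ N (- x) α)) ⟩
    anti N α + anti N (λ i k → (- x) * α i k) ≈⟨ +-congˡ (anti-cong N (λ i k e → sym (shift i k e))) ⟩
    anti N α + anti N β ≈⟨ sym (anti-split N (λ i k → term m i * gauss M i k) α β (λ k → refl) edge middle) ⟩
    anti (suc N) (λ i k → term m i * gauss M i k) ∎
    where
    N = n ℕ.+ m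
    x = q^ (a ℕ.+ M ℕ.* n)
    α β : ℕ → ℕ → Series
    α i k = term m i * gauss M i k
    β i k = term m (suc i) * (q^ (M ℕ.* k) * gauss M i k)
    shift : ∀ i k → i ℕ.+ k ≡ N → β i k ≈ (- x) * α i k
    shift i k e = neg-out {g = q^ (M ℕ.* k) * gauss M i k} (±-q (i ℕ.+ m) (exponent a c (suc i) m) (M ℕ.* k) {a ℕ.+ M ℕ.* n} {exponent a c i m} (gauss M i k) (exponent-sucˡ a c i m n k e))
    edge : ∀ i → term m (suc i) * gauss M (suc i) 0 ≈ β i 0
    edge i = *-congˡ (sym (trans (q^M0* _) (reflexive (gauss₀ i))))
    -- The defining recursion of `gauss` carries the power of q that depends on k, exactly as `β`
    -- does; only distributivity is left.
    middle : ∀ i k → term m (suc i) * gauss M (suc i) (suc k) ≈ α (suc i) k + β i (suc k)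
    middle i k = distribˡ _ _ _
  finite-JTP zero (suc m) = begin
    1# * (halfC m * D (c ℕ.+ M ℕ.* m)) ≈⟨ sym (*-assoc _ _ _) ⟩
    (1# * halfC m) * D (c ℕ.+ M ℕ.* m) ≈⟨ *-congʳ (finite-JTP zero m) ⟩
    anti m β * D (c ℕ.+ M ℕ.* m) ≈⟨ sym (-xa+a _ _) ⟩
    (- x) * anti m β + anti m β ≈⟨ +-congʳ (sym (anti-*ˡ m (- x) β)) ⟩
    anti m (λ i k → (- x) * β i k) + anti m β ≈⟨ +-congʳ (anti-cong m (λ i k _ → sym (shift i k))) ⟩
    anti m α + anti m β ≈⟨ sym (anti-split m (λ i k → term (suc m) i * gauss M i k) α β first edge middle) ⟩
    anti (suc m) (λ i k → term (suc m) i * gauss M i k) ∎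
    where
    x = q^ (c ℕ.+ M ℕ.* m)
    α β : ℕ → ℕ → Series
    α i k = term (suc m) i * (q^ (M ℕ.* i) * gauss M i k)
    β i k = term m i * gauss M i k
    shift : ∀ i k → α i k ≈ (- x) * β i k
    shift i k rewrite ℕP.+-suc i m = neg-out {g = q^ (M ℕ.* i) * gauss M i k} (±-q (i ℕ.+ m) (exponent a c i (suc m)) (M ℕ.* i) {c ℕ.+ M ℕ.* m} {exponent a c i m} (gauss M i k) (exponent-sucʳ a c i m))
    term-suc : ∀ i → term (suc m) (suc i) ≈ term m i
    term-suc i rewrite ℕP.+-suc i m = -‿involutive _
    first : ∀ k → term (suc m) 0 * gauss M 0 (suc k) ≈ α 0 k
    first k = *-congˡ (sym (q^M0* _))
    edge : ∀ i → term (suc m) (suc i) * gauss M (suc i) 0 ≈ β i 0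
    edge i = *-cong (term-suc i) (reflexive (≡.sym (gauss₀ i)))
    -- Here the shifted copy carries a power of q that depends on i, so the other Pascal rule is
    -- required.
    middle : ∀ i k → term (suc m) (suc i) * gauss M (suc i) (suc k) ≈ α (suc i) k + β i (suc k)
    middle i k = trans (*-congˡ (gauss-pascal M M>0 i k)) (trans (distribˡ _ _ _) (+-congˡ (*-congʳ (term-suc i))))

  -- The index j runs from -2 T to 2 T although exponents up to T already force |j| ≤ T: the wider
  -- window leaves i ≥ T and k ≥ T for these j, so that their binomials have stabilised.
  theta : Series
  theta = anti ((T ℕ.+ T) ℕ.+ (T ℕ.+ T)) (λ i k → term (T ℕ.+ T) i)

  -- If i and k are at least T, the Gaussian binomial times (Q; Q)_∞ is 1 up to degree T. If not,
  -- then |i - n| > T, the exponent exceeds T, and the term vanishes on both sides.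
  jacobi-triple : poch M (T ℕ.+ T) * (halfA (T ℕ.+ T) * halfC (T ℕ.+ T)) ≈ theta
  jacobi-triple = begin
    E * (halfA n * halfC n) ≈⟨ *-congˡ (finite-JTP n n) ⟩
    E * anti (n ℕ.+ n) (λ i k → term n i * gauss M i k) ≈⟨ sym (anti-*ˡ (n ℕ.+ n) E _) ⟩
    anti (n ℕ.+ n) (λ i k → E * (term n i * gauss M i k)) ≈⟨ anti-cong (n ℕ.+ n) limit ⟩
    theta ∎
    where
    n = T ℕ.+ T
    E = poch M n
    stable : ∀ i → T ℕ.≤ i → poch M i ≈ E
    stable i p = poch-large M>0 p (ℕP.m≤m+n T T)
    E*gauss : ∀ i k → T ℕ.≤ i → T ℕ.≤ k → E * gauss M i k ≈ 1#
    E*gauss i k p r = poch-cancellable n M>0 (begin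
      E * (E * gauss M i k) ≈⟨ trans (sym (*-assoc _ _ _)) (*-comm _ _) ⟩
      gauss M i k * (E * E) ≈⟨ *-congˡ (*-cong (sym (stable i p)) (sym (stable k r))) ⟩
      gauss M i k * (poch M i * poch M k) ≈⟨ gauss-poch M i k ⟩
      poch M (i ℕ.+ k) ≈⟨ stable (i ℕ.+ k) (ℕP.≤-trans p (ℕP.m≤m+n i k)) ⟩
      E ≈⟨ sym (*-identityʳ E) ⟩
      E * 1# ∎)
    vanish : ∀ i k → T ℕ.< exponent a c i n → E * (term n i * gauss M i k) ≈ term n i
    vanish i k p = trans (*-congˡ (trans (*-congʳ t≈0) (zeroˡ _))) (trans (zeroʳ E) (sym t≈0))
      where
      t≈0 : term n i ≈ 0#
      t≈0 = ±-0 (i ℕ.+ n) (q^-big _ p)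
    limit : ∀ i k → i ℕ.+ k ≡ n ℕ.+ n → E * (term n i * gauss M i k) ≈ term n i
    limit i k e with T ℕ.≤? i | T ℕ.≤? k
    ... | yes p | yes r = trans (a[tg] _ _ _) (trans (*-congˡ (E*gauss i k p r)) (*-identityʳ _))
    ... | no p | _ = vanish i k (ℕP.+-cancelʳ-< T _ _ (ℕP.≤-<-trans (exponent-≥ʳ c>0 i n)
          (ℕP.+-monoʳ-< _ (ℕP.≰⇒> p))))
    ... | yes _ | no r = vanish i k (ℕP.+-cancelʳ-< n _ _ (ℕP.<-≤-trans T+n<i (exponent-≥ˡ a>0 i n)))
      where
      T+n<i : T ℕ.+ n ℕ.< i
      T+n<i = ℕP.+-cancelʳ-< k _ _ (≡.subst (T ℕ.+ n ℕ.+ k ℕ.<_) (≡.sym (≡.trans e (shuffle T)))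
        (ℕP.+-monoʳ-< (T ℕ.+ n) (ℕP.≰⇒> r)))
        where
        shuffle : ∀ T → (T ℕ.+ T) ℕ.+ (T ℕ.+ T) ≡ T ℕ.+ (T ℕ.+ T) ℕ.+ T
        shuffle = ℕS.solve-∀

-- Integers modulo 3 and the generating functions of restricted partitions.

record Congruent (m : ℕ) (x y : ℤ) : Set where
  constructor congruent
  field difference : + m ∣ℤ x ℤ.- y

-- The ring ℤ/m: integers, compared modulo m.
ℤ/ : ℕ → CommutativeRing 0ℓ 0ℓ
ℤ/ m = record
  { Carrier = ℤ ; _≈_ = Congruent m ; _+_ = ℤ._+_ ; _*_ = ℤ._*_ ; -_ = ℤ.-_ ; 0# = + 0 ; 1# = + 1
  ; isCommutativeRing = record
    { isRing = record
      { +-isAbelianGroup = record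
        { isGroup = record
          { isMonoid = record
            { isSemigroup = record
              { isMagma = record
                { isEquivalence = record { refl = exact ≡.refl ; sym = ~-sym ; trans = ~-trans }
                ; ∙-cong = +-cong }
              ; assoc = λ x y z → exact (ℤP.+-assoc x y z) }
            ; identity = (λ x → exact (ℤP.+-identityˡ x)) , (λ x → exact (ℤP.+-identityʳ x)) }
          ; inverse = (λ x → exact (ℤP.+-inverseˡ x)) , (λ x → exact (ℤP.+-inverseʳ x))
          ; ⁻¹-cong = neg-cong }
        ; comm = λ x y → exact (ℤP.+-comm x y) }
      ; *-cong = *-cong
      ; *-assoc = λ x y z → exact (ℤP.*-assoc x y z)
      ; *-identity = (λ x → exact (ℤP.*-identityˡ x)) , (λ x → exact (ℤP.*-identityʳ x))
      ; distrib = (λ x y z → exact (ℤP.*-distribˡ-+ x y z)) , (λ x y z → exact (ℤP.*-distribʳ-+ x y z)) }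
    ; *-comm = λ x y → exact (ℤP.*-comm x y) } }
  where
  _~_ = Congruent m
  along : ∀ {x y d} → d ≡ x ℤ.- y → + m ∣ℤ d → x ~ y
  along ≡.refl = congruent
  exact : ∀ {x y} → x ≡ y → x ~ y
  exact {x} ≡.refl = congruent (divides (+ 0) (ℤP.+-inverseʳ x))
  ~-sym : ∀ {x y} → x ~ y → y ~ x
  ~-sym {x} {y} (congruent p) = along (flip x y) (ℤS.∣m⇒∣-m p)
    where
    flip : ∀ x y → ℤ.- (x ℤ.- y) ≡ y ℤ.- x
    flip = ℤT.solve-∀
  ~-trans : ∀ {x y z} → x ~ y → y ~ z → x ~ z
  ~-trans {x} {y} {z} (congruent p) (congruent r) = along (add x y z) (ℤS.∣m∣n⇒∣m+n p r)
    where
    add : ∀ x y z → (x ℤ.- y) ℤ.+ (y ℤ.- z) ≡ x ℤ.- z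
    add = ℤT.solve-∀
  +-cong : ∀ {x y u v} → x ~ y → u ~ v → (x ℤ.+ u) ~ (y ℤ.+ v)
  +-cong {x} {y} {u} {v} (congruent p) (congruent r) = along (add x y u v) (ℤS.∣m∣n⇒∣m+n p r)
    where
    add : ∀ x y u v → (x ℤ.- y) ℤ.+ (u ℤ.- v) ≡ (x ℤ.+ u) ℤ.- (y ℤ.+ v)
    add = ℤT.solve-∀
  neg-cong : ∀ {x y} → x ~ y → (ℤ.- x) ~ (ℤ.- y)
  neg-cong {x} {y} (congruent p) = along (neg x y) (ℤS.∣m⇒∣-m p)
    where
    neg : ∀ x y → ℤ.- (x ℤ.- y) ≡ (ℤ.- x) ℤ.- (ℤ.- y)
    neg = ℤT.solve-∀
  *-cong : ∀ {x y u v} → x ~ y → u ~ v → (x ℤ.* u) ~ (y ℤ.* v)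
  *-cong {x} {y} {u} {v} (congruent p) (congruent r) = along (mul x y u v)
    (ℤS.∣m∣n⇒∣m+n (ℤS.∣m⇒∣m*n u p) (ℤS.∣n⇒∣m*n y r))
    where
    mul : ∀ x y u v → (x ℤ.- y) ℤ.* u ℤ.+ y ℤ.* (u ℤ.- v) ≡ x ℤ.* u ℤ.- y ℤ.* v
    mul = ℤT.solve-∀

module F₃ = CommutativeRing (ℤ/ 3)

sumTo : (ℕ → ℕ) → ℕ → ℕ
sumTo g n = sum (map g (upTo n))

private
  sum-applyUpTo : ∀ (g f : ℕ → ℕ) n → sum (map g (applyUpTo f n)) ≡ sumTo (g ∘ f) n
  sum-applyUpTo g f n = ≡.cong sum
    (≡.trans (ListP.map-applyUpTo f g n) (≡.sym (ListP.map-applyUpTo (λ k → k) (g ∘ f) n)))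

sumTo-suc : ∀ g n → sumTo g (suc n) ≡ g 0 ℕ.+ sumTo (g ∘ suc) n
sumTo-suc g n = ≡.cong (g 0 ℕ.+_) (sum-applyUpTo g suc n)

sumTo-cong : ∀ {g h} n → (∀ k → g k ≡ h k) → sumTo g n ≡ sumTo h n
sumTo-cong n e = ≡.cong sum (ListP.map-cong e (upTo n))

sumTo-0 : ∀ {g} n → (∀ k → g k ≡ 0) → sumTo g n ≡ 0
sumTo-0 zero e = ≡.refl
sumTo-0 {g} (suc n) e = ≡.trans (sumTo-suc g n) (≡.cong₂ ℕ._+_ (e 0) (sumTo-0 n (λ k → e (suc k))))

sumTo-cut : ∀ {g} m d → (∀ k → m ℕ.≤ k → g k ≡ 0) → sumTo g (m ℕ.+ d) ≡ sumTo g m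
sumTo-cut zero d e = sumTo-0 d (λ k → e k z≤n)
sumTo-cut {g} (suc m) d e = ≡.trans (sumTo-suc g (m ℕ.+ d))
  (≡.trans (≡.cong (g 0 ℕ.+_) (sumTo-cut m d (λ k p → e (suc k) (s≤s p)))) (≡.sym (sumTo-suc g m)))

private
  ≤ᵇ-true : ∀ {m n} → m ℕ.≤ n → (m ≤ᵇ n) ≡ true
  ≤ᵇ-true {m} {n} p with m ≤ᵇ n in e
  ... | true = ≡.refl
  ... | false = ⊥-elim (≡.subst IsTrue e (ℕP.≤⇒≤ᵇ p))
  ≤ᵇ-false : ∀ {m n} → n ℕ.< m → (m ≤ᵇ n) ≡ false
  ≤ᵇ-false {m} {n} p with m ≤ᵇ n in e
  ... | false = ≡.refl
  ... | true = ⊥-elim (ℕP.<⇒≱ p (ℕP.≤ᵇ⇒≤ m n (≡.subst IsTrue (≡.sym e) _)))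

-- The coefficients of f / (1 - q^s), in the form to which `pcount` unfolds.
geometric : ℕ → (ℕ → ℕ) → ℕ → ℕ
geometric s f n = sumTo (λ j → if j ℕ.* s ≤ᵇ n then f (n ℕ.∸ j ℕ.* s) else 0) (suc n)

geometric-low : ∀ s f n → n ℕ.< s → geometric s f n ≡ f n
geometric-low s f n n<s = ≡.trans (sumTo-suc _ n)
  (≡.trans (≡.cong (f n ℕ.+_) (sumTo-0 n beyond)) (ℕP.+-identityʳ _))
  where
  beyond : ∀ j → (if suc j ℕ.* s ≤ᵇ n then f (n ℕ.∸ suc j ℕ.* s) else 0) ≡ 0
  beyond j rewrite ≤ᵇ-false {suc j ℕ.* s} {n} (ℕP.<-≤-trans n<s (ℕP.m≤m+n s (j ℕ.* s))) = ≡.refl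

-- This is (1 - q^s) · (f / (1 - q^s)) = f read off in degree s + n: the summand j = 0 splits off,
-- the others are re-indexed, and those beyond the shorter range are zero.
geometric-shift : ∀ s f n → 0 ℕ.< s → geometric s f (s ℕ.+ n) ≡ f (s ℕ.+ n) ℕ.+ geometric s f n
geometric-shift (suc s) f n _ = ≡.trans (sumTo-suc h (suc s ℕ.+ n)) (≡.cong (f (suc s ℕ.+ n) ℕ.+_)
  (≡.trans (sumTo-cong (suc s ℕ.+ n) term)
    (≡.trans (≡.cong (sumTo g) (≡.cong suc (ℕP.+-comm s n))) (sumTo-cut (suc n) s beyond))))
  where
  S = suc s
  h : ℕ → ℕ
  h j = if j ℕ.* S ≤ᵇ S ℕ.+ n then f (S ℕ.+ n ℕ.∸ j ℕ.* S) else 0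
  g : ℕ → ℕ
  g j = if j ℕ.* S ≤ᵇ n then f (n ℕ.∸ j ℕ.* S) else 0
  beyond : ∀ k → suc n ℕ.≤ k → g k ≡ 0
  beyond k n<k rewrite ≤ᵇ-false {k ℕ.* S} {n} (ℕP.<-≤-trans n<k (ℕP.m≤m*n k S)) = ≡.refl
  term : ∀ j → (if suc j ℕ.* S ≤ᵇ S ℕ.+ n then f (S ℕ.+ n ℕ.∸ suc j ℕ.* S) else 0) ≡ g j
  term j with j ℕ.* S ℕ.≤? n
  ... | yes p rewrite ≤ᵇ-true p | ≤ᵇ-true (ℕP.+-monoʳ-≤ S p) = ≡.cong f (ℕP.[m+n]∸[m+o]≡n∸o S n (j ℕ.* S))
  ... | no p rewrite ≤ᵇ-false (ℕP.≰⇒> p) | ≤ᵇ-false (ℕP.+-monoʳ-< S (ℕP.≰⇒> p)) = ≡.refl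

pcount-∣ : ∀ u m n → u ℕD.∣ suc m → pcount u (suc m) n ≡ pcount u m n
pcount-∣ u m n d with u ℕD.∣? suc m
... | yes _ = ≡.refl
... | no ¬d = ⊥-elim (¬d d)

pcount-∤ : ∀ u m n → ¬ u ℕD.∣ suc m → pcount u (suc m) n ≡ geometric (suc m) (pcount u m) n
pcount-∤ u m n ¬d with u ℕD.∣? suc m
... | yes d = ⊥-elim (¬d d)
... | no _ = ≡.refl

-- A part larger than n cannot occur in a partition of n, so the bound in `pnd`, which varies with
-- n, can be replaced by a single bound for all degrees.
pcount-stable : ∀ u n d → pcount u (n ℕ.+ d) n ≡ pnd u n
pcount-stable u n zero rewrite ℕP.+-identityʳ n = ≡.refl
pcount-stable u n (suc d) rewrite ℕP.+-suc n d with u ℕD.∣? suc (n ℕ.+ d)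
... | yes _ = pcount-stable u n d
... | no _ = ≡.trans (geometric-low (suc (n ℕ.+ d)) (pcount u (n ℕ.+ d)) n (s≤s (ℕP.m≤m+n n d))) (pcount-stable u n d)

module PartitionSeries (T : ℕ) where
  open TripleProduct (ℤ/ 3) T public
  open CommutativeRing seriesRing hiding (zero)
  open Rearrange seriesRing
  open SetoidReasoning setoid

  N : ℕ
  N = T ℕ.+ T

  T≤N : T ℕ.≤ N
  T≤N = ℕP.m≤m+n T T

  parts : ℕ → ℕ → Series
  parts u m n = + pcount u m n

  bipartitions : ℕ → ℕ → Series
  bipartitions u v n = + B u v n

  parts-0 : ∀ u → parts u 0 ≈ 1#
  parts-0 u zero    _ = F₃.refl
  parts-0 u (suc n) _ = F₃.refl

  parts-step : ∀ u m → ¬ u ℕD.∣ suc m → D (suc m) * parts u (suc m) ≈ parts u m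
  parts-step u m ¬d n _ with suc m ℕ.≤? n
  ... | no p = F₃.trans (D-low (suc m) (parts u (suc m)) n (ℕP.≰⇒> p))
        (F₃.reflexive (≡.cong +_ (≡.trans (pcount-∤ u m n ¬d) (geometric-low (suc m) (pcount u m) n (ℕP.≰⇒> p)))))
  ... | yes p with ℕP.m≤n⇒∃[o]m+o≡n p
  ...   | k , ≡.refl = F₃.trans (D-shift (suc m) (parts u (suc m)) k) (F₃.reflexive
          (≡.trans (≡.cong₂ (λ x y → + x ℤ.- + y)
                     (≡.trans (pcount-∤ u m _ ¬d) (geometric-shift (suc m) (pcount u m) k (s≤s z≤n))) (pcount-∤ u m k ¬d))
          (≡.trans (≡.cong (ℤ._- + g) (ℤP.pos-+ (pcount u m (suc m ℕ.+ k)) g))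
                   (cancel (+ pcount u m (suc m ℕ.+ k)) (+ g)))))
    where
    g = geometric (suc m) (pcount u m) k
    cancel : ∀ x y → x ℤ.+ y ℤ.- y ≡ x
    cancel = ℤT.solve-∀

  multipleFactor : ℕ → ℕ → Series
  multipleFactor u k with u ℕD.∣? suc k
  ... | yes _ = D (suc k)
  ... | no  _ = 1#

  multipleFactor-∣ : ∀ u k → u ℕD.∣ suc k → multipleFactor u k ≈ D (suc k)
  multipleFactor-∣ u k d with u ℕD.∣? suc k
  ... | yes _ = refl
  ... | no ¬d = ⊥-elim (¬d d)

  multipleFactor-∤ : ∀ u k → ¬ u ℕD.∣ suc k → multipleFactor u k ≈ 1#
  multipleFactor-∤ u k ¬d with u ℕD.∣? suc k
  ... | yes d = ⊥-elim (¬d d)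
  ... | no _  = refl

  -- The factor 1 - q^(m+1) cancels the geometric series of an allowed part m + 1 and survives when
  -- u ∣ m + 1.
  poch-parts : ∀ u m → poch 1 m * parts u m ≈ ∏ (multipleFactor u) m
  poch-parts u zero    = trans (*-identityˡ _) (parts-0 u)
  poch-parts u (suc m) = step (u ℕD.∣? suc m)
    where
    step : Dec (u ℕD.∣ suc m) → poch 1 (suc m) * parts u (suc m) ≈ ∏ (multipleFactor u) (suc m)
    step (yes d) = begin
      (poch 1 m * D (1 ℕ.* suc m)) * parts u (suc m) ≈⟨ [ad]b (poch 1 m) (D (1 ℕ.* suc m)) (parts u (suc m)) ⟩
      (poch 1 m * parts u (suc m)) * D (1 ℕ.* suc m)
        ≈⟨ *-cong (*-congˡ {poch 1 m} (λ n _ → F₃.reflexive (≡.cong +_ (pcount-∣ u m n d)))) (D-cong (ℕP.*-identityˡ (suc m))) ⟩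
      (poch 1 m * parts u m) * D (suc m) ≈⟨ *-cong (poch-parts u m) (sym (multipleFactor-∣ u m d)) ⟩
      ∏ (multipleFactor u) m * multipleFactor u m ∎
    step (no ¬d) = begin
      (poch 1 m * D (1 ℕ.* suc m)) * parts u (suc m) ≈⟨ *-assoc (poch 1 m) (D (1 ℕ.* suc m)) (parts u (suc m)) ⟩
      poch 1 m * (D (1 ℕ.* suc m) * parts u (suc m))
        ≈⟨ *-congˡ {poch 1 m} (trans (*-congʳ (D-cong (ℕP.*-identityˡ (suc m)))) (parts-step u m ¬d)) ⟩
      poch 1 m * parts u m ≈⟨ poch-parts u m ⟩
      ∏ (multipleFactor u) m ≈⟨ sym (*-identityʳ _) ⟩
      ∏ (multipleFactor u) m * 1# ≈⟨ *-congˡ {∏ (multipleFactor u) m} (sym (multipleFactor-∤ u m ¬d)) ⟩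
      ∏ (multipleFactor u) m * multipleFactor u m ∎

  ∏-ones : ∀ f n → (∀ k → k ℕ.< n → f k ≈ 1#) → ∏ f n ≈ 1#
  ∏-ones f zero    e = refl
  ∏-ones f (suc n) e = trans (*-cong (∏-ones f n (λ k p → e k (ℕP.m≤n⇒m≤1+n p))) (e n ℕP.≤-refl)) (*-identityˡ _)

  -- The product is lengthened to N u factors, which changes nothing up to degree T, and cut into N
  -- blocks of length u. Only the last entry of a block is a multiple of u.
  multiplesProduct : ∀ u → 0 ℕ.< u → ∏ (multipleFactor u) N ≈ poch u N
  multiplesProduct (suc u) _ = begin
    ∏ f N                                             ≈⟨ ∏-large f big T≤N (ℕP.≤-trans T≤N (ℕP.m≤m*n N (suc u))) ⟩
    ∏ f (N ℕ.* suc u)                                 ≈⟨ ∏-blocks f (suc u) N ⟩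
    ∏ (λ k → ∏ (λ i → f (k ℕ.* suc u ℕ.+ i)) (suc u)) N ≈⟨ ∏-cong N block ⟩
    poch (suc u) N ∎
    where
    f = multipleFactor (suc u)
    big : ∀ k → T ℕ.≤ k → f k ≈ 1#
    big k p with suc u ℕD.∣? suc k
    ... | yes _ = D-big (suc k) (s≤s p)
    ... | no _  = refl
    inside : ∀ k i → i ℕ.< u → f (k ℕ.* suc u ℕ.+ i) ≈ 1#
    inside k i p with suc u ℕD.∣? suc (k ℕ.* suc u ℕ.+ i)
    ... | no _  = refl
    ... | yes d = ⊥-elim (ℕD.>⇒∤ (s≤s p) (ℕD.∣m+n∣m⇒∣n
            (≡.subst (suc u ℕD.∣_) (≡.sym (ℕP.+-suc (k ℕ.* suc u) i)) d) (ℕD.n∣m*n k)))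
    last : ∀ k → f (k ℕ.* suc u ℕ.+ u) ≈ D (suc u ℕ.* suc k)
    last k with suc u ℕD.∣? suc (k ℕ.* suc u ℕ.+ u)
    ... | yes _ = D-cong (arith k u)
      where
      arith : ∀ k u → suc (k ℕ.* suc u ℕ.+ u) ≡ suc u ℕ.* suc k
      arith = ℕS.solve-∀
    ... | no ¬d = ⊥-elim (¬d (ℕD.divides (suc k) (arith k u)))
      where
      arith : ∀ k u → suc (k ℕ.* suc u ℕ.+ u) ≡ suc k ℕ.* suc u
      arith = ℕS.solve-∀
    block : ∀ k → ∏ (λ i → f (k ℕ.* suc u ℕ.+ i)) (suc u) ≈ D (suc u ℕ.* suc k)
    block k = trans (*-cong (∏-ones _ u (inside k)) (last k)) (*-identityˡ _)

  poch-parts-N : ∀ u → 0 ℕ.< u → poch 1 N * parts u N ≈ poch u N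
  poch-parts-N u u>0 = trans (poch-parts u N) (multiplesProduct u u>0)

  bipartitions-parts : ∀ u v → bipartitions u v ≈ parts u N * parts v N
  bipartitions-parts u v n n≤T = F₃.trans (F₃.reflexive (convolution (pnd u) (pnd v) n))
    (anti-cong n (λ i k e → F₃.reflexive (≡.cong₂ (λ x y → + x ℤ.* + y)
      (≡.sym (stable u i (≡.subst (i ℕ.≤_) e (ℕP.m≤m+n i k))))
      (≡.sym (stable v k (≡.subst (k ℕ.≤_) e (ℕP.m≤n+m k i)))))))
    where
    open Antidiagonal (ℤ/ 3) using (anti; anti-cong)
    stable : ∀ u i → i ℕ.≤ n → pcount u N i ≡ pnd u i
    stable u i p with ℕP.m≤n⇒∃[o]m+o≡n (ℕP.≤-trans p (ℕP.≤-trans n≤T T≤N))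
    ... | d , e = ≡.trans (≡.cong (λ m → pcount u m i) (≡.sym e)) (pcount-stable u i d)
    convolution : ∀ (f g : ℕ → ℕ) n →
      + sumTo (λ j → f j ℕ.* g (n ℕ.∸ j)) (suc n) ≡ anti n (λ i k → + f i ℤ.* + g k)
    convolution f g zero    = ≡.trans (≡.cong +_ (ℕP.+-identityʳ _)) (ℤP.pos-* (f 0) (g 0))
    convolution f g (suc n) = ≡.trans (≡.cong +_ (sumTo-suc (λ j → f j ℕ.* g (suc n ℕ.∸ j)) (suc n)))
      (≡.trans (ℤP.pos-+ (f 0 ℕ.* g (suc n)) _)
        (≡.cong₂ ℤ._+_ (ℤP.pos-* (f 0) (g (suc n))) (convolution (f ∘ suc) g n)))

  triple : ∀ f → f + (f + f) ≈ 0#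
  triple f n _ = congruent (divides (f n) (arith (f n)))
    where
    arith : ∀ x → x ℤ.+ (x ℤ.+ x) ℤ.- + 0 ≡ x ℤ.* + 3
    arith = ℤT.solve-∀

  -- Frobenius modulo 3: (1 + y)³ = 1 + y³ + 3 (y + y²) with y = -q^k.
  D-cube : ∀ k → D k * (D k * D k) ≈ D (3 ℕ.* k)
  D-cube k = begin
    D k * (D k * D k) ≈⟨ expand (- (q^ k)) ⟩
    (1# + - x * (- x * - x)) + ((- x + - x * - x) + ((- x + - x * - x) + (- x + - x * - x)))
      ≈⟨ +-cong (+-congˡ {1#} cube) (triple (- x + - x * - x)) ⟩
    D (3 ℕ.* k) + 0# ≈⟨ +-identityʳ _ ⟩
    D (3 ℕ.* k) ∎
    where
    x = q^ k
    open SemiringSolver commutativeSemiring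
    open RingProps ring using (-‿distribˡ-*; -‿distribʳ-*; -‿involutive)
    expand : ∀ y → (1# + y) * ((1# + y) * (1# + y)) ≈ (1# + y * (y * y)) + ((y + y * y) + ((y + y * y) + (y + y * y)))
    expand = solve 1 (λ y → (con 1 :+ y) :* ((con 1 :+ y) :* (con 1 :+ y))
      := (con 1 :+ y :* (y :* y)) :+ ((y :+ y :* y) :+ ((y :+ y :* y) :+ (y :+ y :* y)))) refl
    neg² : - x * - x ≈ x * x
    neg² = trans (sym (-‿distribˡ-* x (- x))) (trans (-‿cong (sym (-‿distribʳ-* x x))) (-‿involutive _))
    cube : - x * (- x * - x) ≈ - (q^ (3 ℕ.* k))
    cube = trans (*-congˡ { - x} neg²) (trans (sym (-‿distribˡ-* x (x * x)))
      (-‿cong (trans (*-congˡ {x} (q^-+ k k)) (trans (q^-+ k (k ℕ.+ k))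
        (reflexive (≡.cong (λ j → q^ (k ℕ.+ (k ℕ.+ j))) (≡.sym (ℕP.+-identityʳ k))))))))

  poch-cube : ∀ n → poch 3 n ≈ poch 1 n * (poch 1 n * poch 1 n)
  poch-cube n = begin
    poch 3 n ≈⟨ ∏-cong n (λ k → trans (sym (D-cube (suc k))) (sym (*-cong (one k) (*-cong (one k) (one k))))) ⟩
    ∏ (λ k → d k * (d k * d k)) n ≈⟨ ∏-* d (λ k → d k * d k) n ⟩
    poch 1 n * ∏ (λ k → d k * d k) n ≈⟨ *-congˡ {poch 1 n} (∏-* d d n) ⟩
    poch 1 n * (poch 1 n * poch 1 n) ∎
    where
    d : ℕ → Series
    d k = D (1 ℕ.* suc k)
    one : ∀ k → d k ≈ D (suc k)
    one k = D-cong (ℕP.*-identityˡ (suc k))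

  -- Modulo 3 one has f₃ = f₁³, so f₃ f_v / f₁² = f₁ f_v.
  bipartitions-poch : ∀ v → 0 ℕ.< v → bipartitions 3 v ≈ poch 1 N * poch v N
  bipartitions-poch v v>0 = *-cancellable {E} {E} (λ {f} {g} → E-cancel {f} {g}) (λ {f} {g} → E-cancel {f} {g}) (begin
    (E * E) * bipartitions 3 v              ≈⟨ *-congˡ {E * E} (bipartitions-parts 3 v) ⟩
    (E * E) * (parts 3 N * parts v N)       ≈⟨ [ab][cd] E E (parts 3 N) (parts v N) ⟩
    (E * parts 3 N) * (E * parts v N)
      ≈⟨ *-cong (trans (poch-parts-N 3 (s≤s z≤n)) (poch-cube N)) (poch-parts-N v v>0) ⟩
    (E * (E * E)) * poch v N                ≈⟨ regroup E (poch v N) ⟩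
    (E * E) * (E * poch v N)                ∎)
    where
    E = poch 1 N
    E-cancel : Cancellable E
    E-cancel {f} {g} = poch-cancellable {1} N (s≤s z≤n) {f} {g}
    open SemiringSolver commutativeSemiring
    regroup : ∀ e p → (e * (e * e)) * p ≈ (e * e) * (e * p)
    regroup = solve 2 (λ e p → (e :* (e :* e)) :* p := (e :* e) :* (e :* p)) refl

-- Products of theta series and their coefficients.

module AntidiagonalSum (R : CommutativeRing 0ℓ 0ℓ) where
  open CommutativeRing R hiding (zero)
  open Summation R
  open Antidiagonal R using (anti)

  ∑-upTo-suc : ∀ n g → ∑ (upTo (suc n)) g ≈ g 0 + ∑ (upTo n) (g ∘ suc)
  ∑-upTo-suc n g = +-congˡ (trans (reflexive (≡.cong (λ xs → ∑ xs g) (≡.sym (ListP.map-upTo suc n)))) (∑-map suc (upTo n) g))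

  anti-∑ : ∀ n g → anti n (λ i _ → g i) ≈ ∑ (upTo (suc n)) g
  anti-∑ zero    g = sym (+-identityʳ _)
  anti-∑ (suc n) g = trans (+-congˡ (anti-∑ n (g ∘ suc))) (sym (∑-upTo-suc (suc n) g))

  ∑-*-∑ : ∀ {A B : Set} (xs : List A) (ys : List B) g h → ∑ xs g * ∑ ys h ≈ ∑ xs (λ x → ∑ ys (λ y → g x * h y))
  ∑-*-∑ xs ys g h = trans (trans (*-comm _ _) (sym (∑-*ˡ _ xs g)))
    (∑-cong xs (λ x → trans (*-comm _ _) (sym (∑-*ˡ _ ys h))))

  sgn : ℕ → Carrier
  sgn zero    = 1#
  sgn (suc n) = - sgn n

module ThetaProducts (R : CommutativeRing 0ℓ 0ℓ) (T : ℕ) where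
  private
    module R = CommutativeRing R
    module S where
      open Summation (PowerSeries.seriesRing R T) public
      open AntidiagonalSum (PowerSeries.seriesRing R T) public
  open TripleProduct R T public
  open CommutativeRing seriesRing hiding (zero)
  open Rearrange seriesRing
  open SetoidReasoning setoid
  open Summation R using (∑; _when_; ∑-cong; when-yes; when-no)
  open AntidiagonalSum R using (sgn)

  N : ℕ
  N = T ℕ.+ T

  T≤N : T ℕ.≤ N
  T≤N = ℕP.m≤m+n T T

  theta : ∀ a c → 0 ℕ.< a → 0 ℕ.< c → Series
  theta = JTP.theta R T

  -- Euler's pentagonal number theorem in q^c. The factors with exponents c, 2 c and 3 c modulo 3 c
  -- interleave to all multiples of c, which is why the product is read in blocks of three.
  theta-euler : ∀ c (c>0 : 0 ℕ.< c) (2c>0 : 0 ℕ.< c ℕ.+ c) → theta c (c ℕ.+ c) c>0 2c>0 ≈ poch c N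
  theta-euler c c>0 2c>0 = begin
    theta c (c ℕ.+ c) c>0 2c>0 ≈⟨ sym (JTP.jacobi-triple R T c (c ℕ.+ c) c>0 2c>0) ⟩
    ∏ h₃ N * (∏ h₁ N * ∏ h₂ N) ≈⟨ *-congˡ {∏ h₃ N} (sym (∏-* h₁ h₂ N)) ⟩
    ∏ h₃ N * ∏ (λ k → h₁ k * h₂ k) N ≈⟨ sym (∏-* h₃ _ N) ⟩
    ∏ (λ k → h₃ k * (h₁ k * h₂ k)) N ≈⟨ ∏-cong N block ⟩
    ∏ (λ k → ∏ (λ i → f (k ℕ.* 3 ℕ.+ i)) 3) N ≈⟨ sym (∏-blocks f 3 N) ⟩
    poch c (N ℕ.* 3) ≈⟨ poch-large c>0 (ℕP.≤-trans T≤N (ℕP.m≤m*n N 3)) T≤N ⟩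
    poch c N ∎
    where
    M = c ℕ.+ (c ℕ.+ c)
    h₁ h₂ h₃ f : ℕ → Series
    h₁ k = D (c ℕ.+ M ℕ.* k)
    h₂ k = D ((c ℕ.+ c) ℕ.+ M ℕ.* k)
    h₃ k = D (M ℕ.* suc k)
    f k = D (c ℕ.* suc k)
    open SemiringSolver commutativeSemiring
    rotate : ∀ x y z → z * (x * y) ≈ ((1# * x) * y) * z
    rotate = solve 3 (λ x y z → z :* (x :* y) := ((con 1 :* x) :* y) :* z) refl
    block : ∀ k → h₃ k * (h₁ k * h₂ k) ≈ ((1# * f (k ℕ.* 3 ℕ.+ 0)) * f (k ℕ.* 3 ℕ.+ 1)) * f (k ℕ.* 3 ℕ.+ 2)
    block k = trans (rotate _ _ _) (*-cong (*-cong (*-congˡ {1#} (D-cong (e₁ c k))) (D-cong (e₂ c k))) (D-cong (e₃ c k)))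
      where
      e₁ : ∀ c k → c ℕ.+ (c ℕ.+ (c ℕ.+ c)) ℕ.* k ≡ c ℕ.* suc (k ℕ.* 3 ℕ.+ 0)
      e₁ = ℕS.solve-∀
      e₂ : ∀ c k → c ℕ.+ c ℕ.+ (c ℕ.+ (c ℕ.+ c)) ℕ.* k ≡ c ℕ.* suc (k ℕ.* 3 ℕ.+ 1)
      e₂ = ℕS.solve-∀
      e₃ : ∀ c k → (c ℕ.+ (c ℕ.+ c)) ℕ.* suc k ≡ c ℕ.* suc (k ℕ.* 3 ℕ.+ 2)
      e₃ = ℕS.solve-∀

  private
    pos : ∀ {k} → 0 ℕ.< suc k
    pos = s≤s z≤n

  -- The half products cover the residues 1, 4 and 2, 3 modulo 5 once each, and each triple product
  -- brings a factor f₅. One f₅ supplies the residue 0 and completes f₁; the other remains.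
  theta-quintic : theta 1 4 pos pos * theta 2 3 pos pos ≈ poch 1 N * poch 5 N
  theta-quintic = begin
    theta 1 4 pos pos * theta 2 3 pos pos
      ≈⟨ sym (*-cong (JTP.jacobi-triple R T 1 4 pos pos) (JTP.jacobi-triple R T 2 3 pos pos)) ⟩
    (E * (∏ h₁ N * ∏ h₄ N)) * (E * (∏ h₂ N * ∏ h₃ N)) ≈⟨ regroup E _ _ _ _ ⟩
    ((((∏ h₁ N * ∏ h₂ N) * ∏ h₃ N) * ∏ h₄ N) * E) * E ≈⟨ *-congʳ combine ⟩
    ∏ (λ k → (((h₁ k * h₂ k) * h₃ k) * h₄ k) * D (5 ℕ.* suc k)) N * E ≈⟨ *-congʳ (∏-cong N block) ⟩
    ∏ (λ k → ∏ (λ i → f (k ℕ.* 5 ℕ.+ i)) 5) N * E ≈⟨ *-congʳ (sym (∏-blocks f 5 N)) ⟩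
    poch 1 (N ℕ.* 5) * E ≈⟨ *-congʳ (poch-large {1} pos (ℕP.≤-trans T≤N (ℕP.m≤m*n N 5)) T≤N) ⟩
    poch 1 N * E ∎
    where
    E = poch 5 N
    h₁ h₂ h₃ h₄ f : ℕ → Series
    h₁ k = D (1 ℕ.+ 5 ℕ.* k)
    h₂ k = D (2 ℕ.+ 5 ℕ.* k)
    h₃ k = D (3 ℕ.+ 5 ℕ.* k)
    h₄ k = D (4 ℕ.+ 5 ℕ.* k)
    f k = D (1 ℕ.* suc k)
    open SemiringSolver commutativeSemiring
    regroup : ∀ e a b c d → (e * (a * d)) * (e * (b * c)) ≈ ((((a * b) * c) * d) * e) * e
    regroup = solve 5 (λ e a b c d → (e :* (a :* d)) :* (e :* (b :* c)) := ((((a :* b) :* c) :* d) :* e) :* e) refl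
    combine : (((∏ h₁ N * ∏ h₂ N) * ∏ h₃ N) * ∏ h₄ N) * E ≈ ∏ (λ k → (((h₁ k * h₂ k) * h₃ k) * h₄ k) * D (5 ℕ.* suc k)) N
    combine = sym (trans (∏-* _ _ N) (*-congʳ (trans (∏-* _ _ N) (*-congʳ (trans (∏-* _ _ N) (*-congʳ (∏-* h₁ h₂ N)))))))
    block : ∀ k → (((h₁ k * h₂ k) * h₃ k) * h₄ k) * D (5 ℕ.* suc k) ≈ ∏ (λ i → f (k ℕ.* 5 ℕ.+ i)) 5
    block k = *-cong (*-cong (*-cong (*-cong (trans (D-cong (e₁ k)) (sym (*-identityˡ _))) (D-cong (e₂ k))) (D-cong (e₃ k))) (D-cong (e₄ k))) (D-cong (e₅ k))
      where
      e₁ : ∀ k → 1 ℕ.+ 5 ℕ.* k ≡ 1 ℕ.* suc (k ℕ.* 5 ℕ.+ 0)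
      e₁ = ℕS.solve-∀
      e₂ : ∀ k → 2 ℕ.+ 5 ℕ.* k ≡ 1 ℕ.* suc (k ℕ.* 5 ℕ.+ 1)
      e₂ = ℕS.solve-∀
      e₃ : ∀ k → 3 ℕ.+ 5 ℕ.* k ≡ 1 ℕ.* suc (k ℕ.* 5 ℕ.+ 2)
      e₃ = ℕS.solve-∀
      e₄ : ∀ k → 4 ℕ.+ 5 ℕ.* k ≡ 1 ℕ.* suc (k ℕ.* 5 ℕ.+ 3)
      e₄ = ℕS.solve-∀
      e₅ : ∀ k → 5 ℕ.* suc k ≡ 1 ℕ.* suc (k ℕ.* 5 ℕ.+ 4)
      e₅ = ℕS.solve-∀

  -- Modulo 4 the residues 1 and 3 occur once, 2 occurs twice, and f₄ twice. One copy of each of 1,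
  -- 2, 3, 0 makes f₁; the remaining 2 and 0 make f₂.
  theta-quartic : theta 1 3 pos pos * theta 2 2 pos pos ≈ poch 1 N * poch 2 N
  theta-quartic = begin
    theta 1 3 pos pos * theta 2 2 pos pos
      ≈⟨ sym (*-cong (JTP.jacobi-triple R T 1 3 pos pos) (JTP.jacobi-triple R T 2 2 pos pos)) ⟩
    (E * (∏ h₁ N * ∏ h₃ N)) * (E * (∏ h₂ N * ∏ h₂ N)) ≈⟨ regroup E _ _ _ ⟩
    (((∏ h₁ N * ∏ h₂ N) * ∏ h₃ N) * E) * (∏ h₂ N * E) ≈⟨ *-cong combine₁ (sym (∏-* h₂ _ N)) ⟩
    ∏ (λ k → ((h₁ k * h₂ k) * h₃ k) * D (4 ℕ.* suc k)) N * ∏ (λ k → h₂ k * D (4 ℕ.* suc k)) N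
      ≈⟨ *-cong (∏-cong N block₁) (∏-cong N block₂) ⟩
    ∏ (λ k → ∏ (λ i → f (k ℕ.* 4 ℕ.+ i)) 4) N * ∏ (λ k → ∏ (λ i → g (k ℕ.* 2 ℕ.+ i)) 2) N
      ≈⟨ sym (*-cong (∏-blocks f 4 N) (∏-blocks g 2 N)) ⟩
    poch 1 (N ℕ.* 4) * poch 2 (N ℕ.* 2)
      ≈⟨ *-cong (poch-large {1} pos (ℕP.≤-trans T≤N (ℕP.m≤m*n N 4)) T≤N) (poch-large {2} pos (ℕP.≤-trans T≤N (ℕP.m≤m*n N 2)) T≤N) ⟩
    poch 1 N * poch 2 N ∎
    where
    E = poch 4 N
    h₁ h₂ h₃ f g : ℕ → Series
    h₁ k = D (1 ℕ.+ 4 ℕ.* k)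
    h₂ k = D (2 ℕ.+ 4 ℕ.* k)
    h₃ k = D (3 ℕ.+ 4 ℕ.* k)
    f k = D (1 ℕ.* suc k)
    g k = D (2 ℕ.* suc k)
    open SemiringSolver commutativeSemiring
    regroup : ∀ e a b c → (e * (a * c)) * (e * (b * b)) ≈ (((a * b) * c) * e) * (b * e)
    regroup = solve 4 (λ e a b c → (e :* (a :* c)) :* (e :* (b :* b)) := (((a :* b) :* c) :* e) :* (b :* e)) refl
    combine₁ : ((∏ h₁ N * ∏ h₂ N) * ∏ h₃ N) * E ≈ ∏ (λ k → ((h₁ k * h₂ k) * h₃ k) * D (4 ℕ.* suc k)) N
    combine₁ = sym (trans (∏-* _ _ N) (*-congʳ (trans (∏-* _ _ N) (*-congʳ (∏-* h₁ h₂ N)))))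
    block₁ : ∀ k → ((h₁ k * h₂ k) * h₃ k) * D (4 ℕ.* suc k) ≈ ∏ (λ i → f (k ℕ.* 4 ℕ.+ i)) 4
    block₁ k = *-cong (*-cong (*-cong (trans (D-cong (e₁ k)) (sym (*-identityˡ _))) (D-cong (e₂ k))) (D-cong (e₃ k))) (D-cong (e₄ k))
      where
      e₁ : ∀ k → 1 ℕ.+ 4 ℕ.* k ≡ 1 ℕ.* suc (k ℕ.* 4 ℕ.+ 0)
      e₁ = ℕS.solve-∀
      e₂ : ∀ k → 2 ℕ.+ 4 ℕ.* k ≡ 1 ℕ.* suc (k ℕ.* 4 ℕ.+ 1)
      e₂ = ℕS.solve-∀
      e₃ : ∀ k → 3 ℕ.+ 4 ℕ.* k ≡ 1 ℕ.* suc (k ℕ.* 4 ℕ.+ 2)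
      e₃ = ℕS.solve-∀
      e₄ : ∀ k → 4 ℕ.* suc k ≡ 1 ℕ.* suc (k ℕ.* 4 ℕ.+ 3)
      e₄ = ℕS.solve-∀
    block₂ : ∀ k → h₂ k * D (4 ℕ.* suc k) ≈ ∏ (λ i → g (k ℕ.* 2 ℕ.+ i)) 2
    block₂ k = *-cong (trans (D-cong (e₁ k)) (sym (*-identityˡ _))) (D-cong (e₂ k))
      where
      e₁ : ∀ k → 2 ℕ.+ 4 ℕ.* k ≡ 2 ℕ.* suc (k ℕ.* 2 ℕ.+ 0)
      e₁ = ℕS.solve-∀
      e₂ : ∀ k → 4 ℕ.* suc k ≡ 2 ℕ.* suc (k ℕ.* 2 ℕ.+ 1)
      e₂ = ℕS.solve-∀

  private
    ∑-coefficient : ∀ {A : Set} (xs : List A) (g : A → Series) n → S.∑ xs g n R.≈ ∑ xs (λ x → g x n)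
    ∑-coefficient []       g n = R.refl
    ∑-coefficient (x ∷ xs) g n = R.+-congˡ (∑-coefficient xs g n)

    ±-coefficient : ∀ p f n → ±[ p ] f n R.≈ sgn p R.* f n
    ±-coefficient zero    f n = R.sym (R.*-identityˡ _)
    ±-coefficient (suc p) f n = R.trans (R.-‿cong (±-coefficient p f n)) (RingProps.-‿distribˡ-* R.ring _ _)

    term-* : ∀ p p′ e e′ n → n ℕ.≤ T →
      (±[ p ] (q^ e) * ±[ p′ ] (q^ e′)) n R.≈ (sgn p R.* sgn p′ when (e ℕ.+ e′ ℕ.≟ n))
    term-* p p′ e e′ n n≤T = R.trans (product n n≤T) (R.trans (±-coefficient p (±[ p′ ] (q^ (e ℕ.+ e′))) n)
      (R.trans (R.*-congˡ (±-coefficient p′ (q^ (e ℕ.+ e′)) n)) (hit (e ℕ.+ e′ ℕ.≟ n))))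
      where
      product : ±[ p ] (q^ e) * ±[ p′ ] (q^ e′) ≈ ±[ p ] (±[ p′ ] (q^ (e ℕ.+ e′)))
      product = trans (±-*ˡ p (q^ e) (±[ p′ ] (q^ e′))) (±-cong p (trans (*-comm (q^ e) (±[ p′ ] (q^ e′)))
        (trans (±-*ˡ p′ (q^ e′) (q^ e)) (±-cong p′ (trans (*-comm (q^ e′) (q^ e)) (q^-+ e e′))))))
      hit : (d : Dec (e ℕ.+ e′ ≡ n)) → sgn p R.* (sgn p′ R.* (q^ (e ℕ.+ e′)) n) R.≈ (sgn p R.* sgn p′ when d)
      hit (yes ≡.refl) = R.*-congˡ (R.trans (R.*-congˡ (q^-hit (e ℕ.+ e′))) (R.*-identityʳ _))
      hit (no ¬e) = R.trans (R.*-congˡ (R.trans (R.*-congˡ (q^-miss (e ℕ.+ e′) n ¬e)) (R.zeroʳ _))) (R.zeroʳ _)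

  theta-*-coefficient : ∀ a c a>0 c>0 a′ c′ a′>0 c′>0 n → n ℕ.≤ T →
    (theta a c a>0 c>0 * theta a′ c′ a′>0 c′>0) n R.≈
    ∑ (upTo (suc (N ℕ.+ N))) (λ i → ∑ (upTo (suc (N ℕ.+ N))) (λ i′ →
      sgn (i ℕ.+ N) R.* sgn (i′ ℕ.+ N) when (exponent a c i N ℕ.+ exponent a′ c′ i′ N ℕ.≟ n)))
  theta-*-coefficient a c a>0 c>0 a′ c′ a′>0 c′>0 n n≤T = R.trans (expand n n≤T)
    (R.trans (∑-coefficient range (λ i → S.∑ range (λ i′ → t i * t′ i′)) n) (∑-cong range (λ i →
      R.trans (∑-coefficient range (λ i′ → t i * t′ i′) n) (∑-cong range (λ i′ →
        term-* (i ℕ.+ N) (i′ ℕ.+ N) (exponent a c i N) (exponent a′ c′ i′ N) n n≤T)))))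
    where
    range = upTo (suc (N ℕ.+ N))
    t t′ : ℕ → Series
    t  i = ±[ i ℕ.+ N ] (q^ exponent a c i N)
    t′ i = ±[ i ℕ.+ N ] (q^ exponent a′ c′ i N)
    expand : theta a c a>0 c>0 * theta a′ c′ a′>0 c′>0 ≈ S.∑ range (λ i → S.∑ range (λ i′ → t i * t′ i′))
    expand = trans (*-cong (S.anti-∑ (N ℕ.+ N) t) (S.anti-∑ (N ℕ.+ N) t′)) (S.∑-*-∑ range range t t′)

-- From theta exponents to binary quadratic forms.

module _ where
  open import Data.Integer using (_+_; _*_; _-_; -_; _≟_)
  open import Relation.Binary.PropositionalEquality using (refl; sym; trans; cong; cong₂; subst; subst₂)

  private module ℤGroup = GroupProps (AbelianGroup.group ℤP.+-0-abelianGroup)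

  open Summation (ℤ/ 3) public
  open AntidiagonalSum (ℤ/ 3) using (sgn) public

  infix 4 _≡₃_
  _≡₃_ : ℤ → ℤ → Set
  _≡₃_ = Congruent 3

  ints : ℕ → List ℤ
  ints K = map (λ i → + i - + K) (upTo (suc (K ℕ.+ K)))

  box : ℕ → List (ℤ × ℤ)
  box K = cartesianProduct (ints K) (ints K)

  centred : ∀ K {x} → ∣ x ∣ ℕ.≤ K → ∃ λ i → i ℕ.< suc (K ℕ.+ K) × + i - + K ≡ x
  centred K {+ n} p = n ℕ.+ K , s≤s (ℕP.+-monoˡ-≤ K p) , trans (cong (_- + K) (ℤP.pos-+ n K)) (cancel (+ n) (+ K))
    where
    cancel : ∀ x y → x + y - y ≡ x
    cancel = ℤT.solve-∀
  centred K { -[1+ n ]} p with ℕP.m≤n⇒∃[o]m+o≡n p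
  ... | o , refl = o , s≤s (ℕP.≤-trans (ℕP.m≤n+m o (suc n)) (ℕP.m≤m+n _ _)) ,
    trans (cong (λ z → + o - z) (ℤP.pos-+ (suc n) o)) (cancel (+ o) (+ suc n))
    where
    cancel : ∀ x y → x - (y + x) ≡ - y
    cancel = ℤT.solve-∀

  shift-injective : ∀ K {i i′} → + i - + K ≡ + i′ - + K → i ≡ i′
  shift-injective K {i} {i′} e = ℤP.+-injective (ℤGroup.∙-cancelʳ (- + K) (+ i) (+ i′) e)

  ints-unique : ∀ K → Unique (ints K)
  ints-unique K = UniqueP.map⁺ (shift-injective K) (UniqueP.upTo⁺ _)

  ∈-ints : ∀ {K x} → ∣ x ∣ ℕ.≤ K → x ∈ ints K
  ∈-ints {K} {x} p with centred K {x} p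
  ... | i , i<n , refl = ∈-map⁺ (λ i → + i - + K) (∈-upTo⁺ i<n)

  ∈-ints⁻ : ∀ {K x} → x ∈ ints K → ∣ x ∣ ℕ.≤ K
  ∈-ints⁻ {K} m with ∈-map⁻ (λ i → + i - + K) m
  ... | i , i∈ , refl with ℕP.≤-total K i
  ...   | inj₁ p with ℕP.m≤n⇒∃[o]m+o≡n p
  ...     | o , refl = subst (λ z → ∣ z ∣ ℕ.≤ K) (sym (trans (cong (_- + K) (ℤP.pos-+ K o)) (cancel (+ K) (+ o))))
              (ℕP.+-cancelˡ-≤ K o K (ℕP.≤-pred (∈-upTo⁻ i∈)))
    where
    cancel : ∀ x y → x + y - x ≡ y
    cancel = ℤT.solve-∀
  ∈-ints⁻ {K} m | i , i∈ , refl | inj₂ p with ℕP.m≤n⇒∃[o]m+o≡n p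
  ...     | o , refl = subst (λ z → ∣ z ∣ ℕ.≤ i ℕ.+ o) (sym (trans (cong (λ z → + i - z) (ℤP.pos-+ i o)) (cancel (+ i) (+ o))))
              (subst (ℕ._≤ i ℕ.+ o) (sym (ℤP.∣-i∣≡∣i∣ (+ o))) (ℕP.m≤n+m o i))
    where
    cancel : ∀ x y → x - (x + y) ≡ - y
    cancel = ℤT.solve-∀

  box-unique : ∀ K → Unique (box K)
  box-unique K = UniqueP.cartesianProduct⁺ (ints-unique K) (ints-unique K)

  ∈-box : ∀ {K x y} → ∣ x ∣ ℕ.≤ K → ∣ y ∣ ℕ.≤ K → (x , y) ∈ box K
  ∈-box p q = ∈-cartesianProduct⁺ (∈-ints p) (∈-ints q)

  σ : ℤ → ℤ
  σ j = sgn ∣ j ∣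

  σ-suc : ∀ j → σ (j + + 1) ≡ - σ j
  σ-suc (+ n) rewrite ℕP.+-comm n 1 = refl
  σ-suc -[1+ zero ] = refl
  σ-suc -[1+ suc n ] = sym (ℤP.neg-involutive _)

  σ-pred : ∀ j → σ (j - + 1) ≡ - σ j
  σ-pred j = trans (sym (ℤP.neg-involutive _)) (cong -_ (trans (sym (σ-suc (j - + 1))) (cong σ (arith j))))
    where
    arith : ∀ j → j - + 1 + + 1 ≡ j
    arith = ℤT.solve-∀

  σ-difference : ∀ i m → σ (+ i - + m) ≡ sgn (i ℕ.+ m)
  σ-difference i zero    = cong sgn (trans (cong ∣_∣ (ℤP.+-identityʳ (+ i))) (sym (ℕP.+-identityʳ i)))
  σ-difference i (suc m) = trans (cong σ (arith (+ i) (+ m))) (trans (σ-pred (+ i - + m))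
    (trans (cong -_ (σ-difference i m)) (cong sgn (sym (ℕP.+-suc i m)))))
    where
    arith : ∀ i m → i - (+ 1 + m) ≡ i - m - + 1
    arith = ℤT.solve-∀

  -- Completing the square: with M = a + c and j = i - m the exponent is (M j² + (a - c) j) / 2, and
  -- multiplying by 8 M makes it a square up to the constant (a - c)². All the constants 24, 40 and
  -- 8 come from here.
  exponent-square : ∀ a c i m →
    + 8 * (+ a + + c) * + exponent a c i m + (+ a - + c) * (+ a - + c) ≡
    (+ 2 * (+ a + + c) * (+ i - + m) + (+ a - + c)) * (+ 2 * (+ a + + c) * (+ i - + m) + (+ a - + c))
  exponent-square a c zero zero = base (+ a) (+ c)
    where
    base : ∀ a c → + 8 * (a + c) * + 0 + (a - c) * (a - c) ≡
      (+ 2 * (a + c) * (+ 0 - + 0) + (a - c)) * (+ 2 * (a + c) * (+ 0 - + 0) + (a - c))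
    base = ℤT.solve-∀
  exponent-square a c (suc i) (suc m) = trans (exponent-square a c i m)
    (cong (λ z → (+ 2 * (+ a + + c) * z + (+ a - + c)) * (+ 2 * (+ a + + c) * z + (+ a - + c)))
      (arith (+ i) (+ m)))
    where
    arith : ∀ i m → i - m ≡ (+ 1 + i) - (+ 1 + m)
    arith = ℤT.solve-∀
  exponent-square a c (suc i) zero = trans (cong (λ z → + 8 * (+ a + + c) * z + (+ a - + c) * (+ a - + c)) cast)
    (trans (split (+ a) (+ c) (+ i) (+ exponent a c i 0))
      (trans (cong (_+ extra (+ a) (+ c) (+ i)) (exponent-square a c i 0)) (join (+ a) (+ c) (+ i))))
    where
    extra : ℤ → ℤ → ℤ → ℤ
    extra a c i = + 8 * (a + c) * (a + (a + c) * i)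
    cast : + exponent a c (suc i) 0 ≡ + exponent a c i 0 + (+ a + (+ a + + c) * + i)
    cast = trans (ℤP.pos-+ (exponent a c i 0) _) (cong (λ z → + exponent a c i 0 + z)
      (trans (ℤP.pos-+ a _) (cong (λ z → + a + z) (trans (ℤP.pos-* (a ℕ.+ c) i) (cong (_* + i) (ℤP.pos-+ a c))))))
    split : ∀ a c i e → + 8 * (a + c) * (e + (a + (a + c) * i)) + (a - c) * (a - c) ≡
      + 8 * (a + c) * e + (a - c) * (a - c) + + 8 * (a + c) * (a + (a + c) * i)
    split = ℤT.solve-∀
    join : ∀ a c i →
      (+ 2 * (a + c) * (i - + 0) + (a - c)) * (+ 2 * (a + c) * (i - + 0) + (a - c))
        + + 8 * (a + c) * (a + (a + c) * i) ≡
      (+ 2 * (a + c) * ((+ 1 + i) - + 0) + (a - c)) * (+ 2 * (a + c) * ((+ 1 + i) - + 0) + (a - c))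
    join = ℤT.solve-∀
  exponent-square a c zero (suc m) = trans (cong (λ z → + 8 * (+ a + + c) * z + (+ a - + c) * (+ a - + c)) cast)
    (trans (split (+ a) (+ c) (+ m) (+ exponent a c 0 m))
      (trans (cong (_+ extra (+ a) (+ c) (+ m)) (exponent-square a c 0 m)) (join (+ a) (+ c) (+ m))))
    where
    extra : ℤ → ℤ → ℤ → ℤ
    extra a c i = + 8 * (a + c) * (c + (a + c) * i)
    cast : + exponent a c 0 (suc m) ≡ + exponent a c 0 m + (+ c + (+ a + + c) * + m)
    cast = trans (ℤP.pos-+ (exponent a c 0 m) _) (cong (λ z → + exponent a c 0 m + z)
      (trans (ℤP.pos-+ c _) (cong (λ z → + c + z) (trans (ℤP.pos-* (a ℕ.+ c) m) (cong (_* + m) (ℤP.pos-+ a c))))))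
    split : ∀ a c i e → + 8 * (a + c) * (e + (c + (a + c) * i)) + (a - c) * (a - c) ≡
      + 8 * (a + c) * e + (a - c) * (a - c) + + 8 * (a + c) * (c + (a + c) * i)
    split = ℤT.solve-∀
    join : ∀ a c i →
      (+ 2 * (a + c) * (+ 0 - i) + (a - c)) * (+ 2 * (a + c) * (+ 0 - i) + (a - c))
        + + 8 * (a + c) * (c + (a + c) * i) ≡
      (+ 2 * (a + c) * (+ 0 - (+ 1 + i)) + (a - c)) * (+ 2 * (a + c) * (+ 0 - (+ 1 + i)) + (a - c))
    join = ℤT.solve-∀

  halfWeight : ℕ → ℤ → ℤ → ℤ
  halfWeight α β x with + α ∣ℤ? x - β
  ... | yes (divides j _) = σ j
  ... | no _              = + 0

  -- Made even in x, because the quadratic form sees only x². Where both progressions meet, as for β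
  -- = 0, the two contributions add.
  weight : ℕ → ℤ → ℤ → ℤ
  weight α β x = halfWeight α β x + halfWeight α β (- x)

  halfWeight-on : ∀ α β j → halfWeight (suc α) β (+ suc α * j + β) ≡ σ j
  halfWeight-on α β j with + suc α ∣ℤ? + suc α * j + β - β
  ... | yes (divides j′ e) = cong σ (ℤP.*-cancelʳ-≡ j′ j (+ suc α) (trans (sym e) (arith (+ suc α) j β)))
    where
    arith : ∀ a j b → a * j + b - b ≡ j * a
    arith = ℤT.solve-∀
  ... | no ¬d = ⊥-elim (¬d (divides j (arith (+ suc α) j β)))
    where
    arith : ∀ a j b → a * j + b - b ≡ j * a
    arith = ℤT.solve-∀

  halfWeight-support : ∀ α β x → halfWeight (suc α) β x ≡ + 0 ⊎ ∃ λ j → x ≡ + suc α * j + β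
  halfWeight-support α β x with + suc α ∣ℤ? x - β
  ... | no _ = inj₁ refl
  ... | yes (divides j e) = inj₂ (j , trans (arith x β) (trans (cong (_+ β) e) (cong (_+ β) (ℤP.*-comm j (+ suc α)))))
    where
    arith : ∀ x b → x ≡ x - b + b
    arith = ℤT.solve-∀

  halve : ∀ {s t} → s + s ≡₃ t → s ≡₃ - t
  halve {s} {t} (congruent (divides q e)) = congruent (divides (s - q) (trans (arith₁ s t) (trans (cong (λ z → + 3 * s - z) e) (arith₂ s q))))
    where
    arith₁ : ∀ s t → s - (- t) ≡ + 3 * s - (s + s - t)
    arith₁ = ℤT.solve-∀
    arith₂ : ∀ s q → + 3 * s - q * + 3 ≡ (s - q) * + 3
    arith₂ = ℤT.solve-∀

  open F₃ using () renaming (setoid to F₃-setoid)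

  ∑-neg : ∀ (K : ℕ) (h : ℤ → ℤ) → ∑ (ints K) h ≡₃ ∑ (ints K) (λ x → h (- x))
  ∑-neg K h = ∑-reindex _≟_ (ints-unique K) (ints-unique K) -_ ℤP.neg-injective
    (λ x m → inj₂ (neg-∈ m , F₃.reflexive (cong h (ℤP.neg-involutive x))))
    (λ x m → inj₂ (- x , neg-∈ m , ℤP.neg-involutive x , F₃.refl))
    where
    neg-∈ : ∀ {x} → x ∈ ints K → - x ∈ ints K
    neg-∈ {x} m = ∈-ints (subst (ℕ._≤ K) (sym (ℤP.∣-i∣≡∣i∣ x)) (∈-ints⁻ m))

  -- Summing over x = α j + β and over x = − (α j + β) doubles the sum, and 2 ≡ −1 modulo 3.
  ∑-signed-progression : ∀ (α : ℕ) (β : ℤ) (K N : ℕ) (H : ℤ → ℤ) → K ℕ.+ ∣ β ∣ ℕ.≤ N → (∀ x → ¬ ∣ x ∣ ℕ.≤ K → H x ≡₃ + 0) → (∀ x → H (- x) ≡₃ H x) →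
    ∑ (upTo (suc (N ℕ.+ N))) (λ i → sgn (i ℕ.+ N) * H (+ suc α * (+ i - + N) + β)) ≡₃
    - ∑ (ints K) (λ x → weight (suc α) β x * H x)
  ∑-signed-progression α β K N H bound vanish even = halve (begin
    Σᵢ F₃.+ Σᵢ ≈⟨ F₃.+-cong to-ints (F₃.trans to-ints (∑-neg K (λ x → ω x * H x))) ⟩
    ∑ (ints K) (λ x → ω x * H x) F₃.+ ∑ (ints K) (λ x → ω (- x) * H (- x))
      ≈⟨ F₃.+-congˡ {∑ (ints K) (λ x → ω x * H x)} (∑-cong (ints K) (λ x → F₃.*-congˡ {ω (- x)} (even x))) ⟩
    ∑ (ints K) (λ x → ω x * H x) F₃.+ ∑ (ints K) (λ x → ω (- x) * H x)
      ≈⟨ F₃.sym (∑-+ (ints K) (λ x → ω x * H x) (λ x → ω (- x) * H x)) ⟩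
    ∑ (ints K) (λ x → ω x * H x + ω (- x) * H x)
      ≈⟨ ∑-cong (ints K) (λ x → F₃.sym (F₃.distribʳ (H x) (ω x) (ω (- x)))) ⟩
    ∑ (ints K) (λ x → weight (suc α) β x * H x) ∎)
    where
    open SetoidReasoning F₃-setoid
    ω : ℤ → ℤ
    ω = halfWeight (suc α) β
    f : ℕ → ℤ
    f i = + suc α * (+ i - + N) + β
    range = upTo (suc (N ℕ.+ N))
    Σᵢ = ∑ range (λ i → sgn (i ℕ.+ N) * H (f i))
    f-injective : ∀ {i i′} → f i ≡ f i′ → i ≡ i′
    f-injective {i} {i′} e = shift-injective N (ℤP.*-cancelˡ-≡ (+ suc α) _ _ (ℤGroup.∙-cancelʳ β _ _ e))
    value : ∀ i → ω (f i) ≡ sgn (i ℕ.+ N)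
    value i = trans (halfWeight-on α β (+ i - + N)) (σ-difference i N)
    index-bound : ∀ j → ∣ + suc α * j + β ∣ ℕ.≤ K → ∣ j ∣ ℕ.≤ N
    index-bound j p = ℕP.≤-trans (ℕP.m≤n*m ∣ j ∣ (suc α)) (ℕP.≤-trans
      (subst (ℕ._≤ ∣ x ∣ ℕ.+ ∣ β ∣) (trans (cong ∣_∣ (arith (+ suc α * j) β)) (ℤP.abs-* (+ suc α) j)) (ℤP.∣i-j∣≤∣i∣+∣j∣ x β))
      (ℕP.≤-trans (ℕP.+-monoˡ-≤ ∣ β ∣ p) bound))
      where
      x = + suc α * j + β
      arith : ∀ y b → y + b - b ≡ y
      arith = ℤT.solve-∀
    to-ints : Σᵢ ≡₃ ∑ (ints K) (λ x → ω x * H x)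
    to-ints = ∑-reindex _≟_ (UniqueP.upTo⁺ _) (ints-unique K) f f-injective to from
      where
      to : ∀ i → i ∈ range → sgn (i ℕ.+ N) * H (f i) ≡₃ + 0 ⊎
        (f i ∈ ints K × ω (f i) * H (f i) ≡₃ sgn (i ℕ.+ N) * H (f i))
      to i _ with ∣ f i ∣ ℕ.≤? K
      ... | yes p = inj₂ (∈-ints p , F₃.reflexive (cong (_* H (f i)) (value i)))
      ... | no p = inj₁ (F₃.trans (F₃.*-congˡ {sgn (i ℕ.+ N)} (vanish (f i) p)) (F₃.zeroʳ (sgn (i ℕ.+ N))))
      from : ∀ x → x ∈ ints K → ω x * H x ≡₃ + 0 ⊎
        ∃ λ i → i ∈ range × f i ≡ x × sgn (i ℕ.+ N) * H (f i) ≡₃ ω x * H x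
      from x m with halfWeight-support α β x
      ... | inj₁ z = inj₁ (F₃.reflexive (cong (_* H x) z))
      ... | inj₂ (j , refl) with centred N {j} (index-bound j (∈-ints⁻ m))
      ...   | i , i<n , refl = inj₂ (i , ∈-upTo⁺ i<n , refl , F₃.reflexive (cong (_* H (f i)) (sym (value i))))

  -- For the positive definite forms used here every solution of Q x y = K lies in the box of radius
  -- K, so the sum is over all representations of K.
  formSum : (ℤ → ℤ → ℤ) → (ℤ → ℤ → ℤ) → ℕ → ℤ
  formSum Ω Q K = ∑ (box K) (λ (x , y) → Ω x y when (Q x y ≟ + K))

  norm : ℕ → ℤ → ℤ → ℤ
  norm d x y = x * x + + d * (y * y)

  representations : ℕ → ℤ → ℕ → ℤ → ℕ → ℕ → ℤ
  representations α β α′ β′ d = formSum (λ x y → weight α β x * weight α′ β′ y) (norm d)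

  square-abs : ∀ x → x * x ≡ + (∣ x ∣ ℕ.* ∣ x ∣)
  square-abs (+ n)    = sym (ℤP.pos-* n n)
  square-abs -[1+ n ] = refl

  norm-abs : ∀ d x y → x * x + + d * (y * y) ≡ + (∣ x ∣ ℕ.* ∣ x ∣ ℕ.+ d ℕ.* (∣ y ∣ ℕ.* ∣ y ∣))
  norm-abs d x y = trans (cong₂ (λ u v → u + + d * v) (square-abs x) (square-abs y))
    (trans (cong (λ z → + (∣ x ∣ ℕ.* ∣ x ∣) + z) (sym (ℤP.pos-* d _))) (sym (ℤP.pos-+ (∣ x ∣ ℕ.* ∣ x ∣) _)))

  n≤n² : ∀ n → n ℕ.≤ n ℕ.* n
  n≤n² zero    = z≤n
  n≤n² (suc n) = ℕP.m≤m*n (suc n) (suc n)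

  norm-boundˣ : ∀ {d x y K} → x * x + + d * (y * y) ≡ + K → ∣ x ∣ ℕ.≤ K
  norm-boundˣ {d} {x} {y} e = subst (∣ x ∣ ℕ.≤_) (ℤP.+-injective (trans (sym (norm-abs d x y)) e))
    (ℕP.≤-trans (n≤n² ∣ x ∣) (ℕP.m≤m+n _ _))

  norm-boundʸ : ∀ {d x y K} → 0 ℕ.< d → x * x + + d * (y * y) ≡ + K → ∣ y ∣ ℕ.≤ K
  norm-boundʸ {d} {x} {y} d>0 e = subst (∣ y ∣ ℕ.≤_) (ℤP.+-injective (trans (sym (norm-abs d x y)) e))
    (ℕP.≤-trans (n≤n² ∣ y ∣) (ℕP.≤-trans (ℕP.m≤n*m _ d {{ℕ.>-nonZero d>0}}) (ℕP.m≤n+m _ (∣ x ∣ ℕ.* ∣ x ∣))))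

  -- A progression whose squares encode the exponents of a theta series.
  record Encodes (a c α : ℕ) (β s e d : ℤ) : Set where
    field encode : ∀ i m → s * + exponent a c i m + e ≡
                     d * ((+ suc α * (+ i - + m) + β) * (+ suc α * (+ i - + m) + β))

  open Encodes

  -- Adding the two encodings turns the condition that the exponents sum to n into x² + d y² = K.
  -- Passing from each progression to all integers costs a sign -1 modulo 3; there are two
  -- progressions, so the signs cancel.
  theta-representations : ∀ {a c a′ c′ α α′ β β′ s e e′ d} → .{{_ : ℕ.NonZero s}} → 0 ℕ.< d →
    Encodes a c α β (+ s) e (+ 1) → Encodes a′ c′ α′ β′ (+ s) e′ (+ d) →
    ∀ n K N → + K ≡ + s * + n + (e + e′) → K ℕ.+ ∣ β ∣ ℕ.≤ N → K ℕ.+ ∣ β′ ∣ ℕ.≤ N →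
    ∑ (upTo (suc (N ℕ.+ N))) (λ i → ∑ (upTo (suc (N ℕ.+ N))) (λ i′ →
      sgn (i ℕ.+ N) * sgn (i′ ℕ.+ N) when (exponent a c i N ℕ.+ exponent a′ c′ i′ N ℕ.≟ n)))
    ≡₃ representations (suc α) β (suc α′) β′ d K
  theta-representations {a} {c} {a′} {c′} {α} {α′} {β} {β′} {s} {e} {e′} {d} d>0 en en′ n K N K≡ bound bound′ = begin
    ∑ range (λ i → ∑ range (λ i′ → S i * S i′ when (exponent a c i N ℕ.+ exponent a′ c′ i′ N ℕ.≟ n)))
      ≈⟨ ∑-cong range (λ i → ∑-cong range (λ i′ → separate i i′)) ⟩
    ∑ range (λ i → ∑ range (λ i′ → S i * (S i′ * δ (x i) (y i′))))
      ≈⟨ ∑-cong range (λ i → ∑-*ˡ (S i) range (λ i′ → S i′ * δ (x i) (y i′))) ⟩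
    ∑ range (λ i → S i * ∑ range (λ i′ → S i′ * δ (x i) (y i′)))
      ≈⟨ ∑-cong range (λ i → F₃.*-congˡ {S i} (∑-signed-progression α′ β′ K N (δ (x i)) bound′ (vanishʸ (x i)) (evenʸ (x i)))) ⟩
    ∑ range (λ i → S i * G (x i))
      ≈⟨ ∑-signed-progression α β K N G bound vanishˣ evenˣ ⟩
    - ∑ (ints K) (λ x → w x * G x)
      ≈⟨ F₃.trans (F₃.sym (∑-neg-out (ints K) (λ x → w x * G x))) (∑-cong (ints K) inner) ⟩
    ∑ (ints K) (λ x → ∑ (ints K) (λ y → w x * w′ y when norm≟ x y))
      ≈⟨ F₃.sym (∑-× (ints K) (ints K) (λ (x , y) → w x * w′ y when norm≟ x y)) ⟩
    representations (suc α) β (suc α′) β′ d K ∎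
    where
    open SetoidReasoning F₃-setoid
    range = upTo (suc (N ℕ.+ N))
    S : ℕ → ℤ
    S i = sgn (i ℕ.+ N)
    x y : ℕ → ℤ
    x i = + suc α * (+ i - + N) + β
    y i = + suc α′ * (+ i - + N) + β′
    w w′ : ℤ → ℤ
    w = weight (suc α) β
    w′ = weight (suc α′) β′
    norm≟ : ∀ x y → Dec (x * x + + d * (y * y) ≡ + K)
    norm≟ x y = x * x + + d * (y * y) ≟ + K
    δ : ℤ → ℤ → ℤ
    δ x y = + 1 when norm≟ x y
    G : ℤ → ℤ
    G x = - ∑ (ints K) (λ y → w′ y * δ x y)

    *-when : ∀ {P : Set} u (p : Dec P) → u * (+ 1 when p) ≡₃ (u when p)
    *-when u (yes _) = F₃.*-identityʳ u
    *-when u (no _)  = F₃.zeroʳ u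

    norm-exponent : ∀ i i′ → + s * (+ exponent a c i N + + exponent a′ c′ i′ N) + (e + e′) ≡
      x i * x i + + d * (y i′ * y i′)
    norm-exponent i i′ = trans (arith (+ s) (+ exponent a c i N) (+ exponent a′ c′ i′ N) e e′)
      (cong₂ _+_ (trans (encode en i N) (ℤP.*-identityˡ _)) (encode en′ i′ N))
      where
      arith : ∀ s u v e e′ → s * (u + v) + (e + e′) ≡ (s * u + e) + (s * v + e′)
      arith = ℤT.solve-∀

    separate : ∀ i i′ → (S i * S i′ when (exponent a c i N ℕ.+ exponent a′ c′ i′ N ℕ.≟ n)) ≡₃ S i * (S i′ * δ (x i) (y i′))
    separate i i′ = F₃.trans
      (when-cong (exponent a c i N ℕ.+ exponent a′ c′ i′ N ℕ.≟ n) (norm≟ (x i) (y i′)) forth back (λ _ → F₃.refl))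
      (F₃.sym (F₃.trans (F₃.reflexive (sym (ℤP.*-assoc (S i) (S i′) (δ (x i) (y i′))))) (*-when (S i * S i′) (norm≟ (x i) (y i′)))))
      where
      forth : exponent a c i N ℕ.+ exponent a′ c′ i′ N ≡ n → x i * x i + + d * (y i′ * y i′) ≡ + K
      forth refl = trans (sym (norm-exponent i i′)) (sym K≡)
      back : x i * x i + + d * (y i′ * y i′) ≡ + K → exponent a c i N ℕ.+ exponent a′ c′ i′ N ≡ n
      back eq = ℤP.+-injective (ℤP.*-cancelˡ-≡ (+ s) (+ (exponent a c i N ℕ.+ exponent a′ c′ i′ N)) (+ n)
        (ℤGroup.∙-cancelʳ (e + e′) _ _ (trans (norm-exponent i i′) (trans eq K≡))))

    neg-square : ∀ x → - x * - x ≡ x * x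
    neg-square = ℤT.solve-∀

    vanishʸ : ∀ x y → ¬ ∣ y ∣ ℕ.≤ K → δ x y ≡₃ + 0
    vanishʸ x y p = when-no (norm≟ x y) (λ eq → p (norm-boundʸ {d} {x} {y} d>0 eq))
    evenʸ : ∀ x y → δ x (- y) ≡₃ δ x y
    evenʸ x y = F₃.reflexive (cong (λ z → + 1 when (x * x + + d * z ≟ + K)) (neg-square y))
    vanishˣ : ∀ x → ¬ ∣ x ∣ ℕ.≤ K → G x ≡₃ + 0
    vanishˣ x p = F₃.-‿cong (∑-zero (ints K) _ (λ y _ → F₃.trans
      (F₃.*-congˡ {w′ y} (when-no (norm≟ x y) (λ eq → p (norm-boundˣ {d} {x} {y} eq)))) (F₃.zeroʳ (w′ y))))
    evenˣ : ∀ x → G (- x) ≡₃ G x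
    evenˣ x = F₃.reflexive (cong (λ z → - ∑ (ints K) (λ y → w′ y * (+ 1 when (z + + d * (y * y) ≟ + K)))) (neg-square x))

    ∑-neg-out : ∀ {A : Set} (xs : List A) h → ∑ xs (λ x → - h x) ≡₃ - ∑ xs h
    ∑-neg-out xs h = F₃.trans (∑-cong xs (λ x → F₃.reflexive (sym (ℤP.-1*i≡-i (h x)))))
      (F₃.trans (∑-*ˡ (- + 1) xs h) (F₃.reflexive (ℤP.-1*i≡-i _)))

    inner : ∀ x → - (w x * G x) ≡₃ ∑ (ints K) (λ y → w x * w′ y when norm≟ x y)
    inner x = F₃.trans (F₃.reflexive (arith (w x) (∑ (ints K) (λ y → w′ y * δ x y))))
      (F₃.trans (F₃.sym (∑-*ˡ (w x) (ints K) (λ y → w′ y * δ x y)))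
        (∑-cong (ints K) (λ y → F₃.trans (F₃.reflexive (sym (ℤP.*-assoc (w x) (w′ y) (δ x y)))) (*-when (w x * w′ y) (norm≟ x y)))))
      where
      arith : ∀ u v → - (u * - v) ≡ u * v
      arith = ℤT.solve-∀

-- The exponents are v (3 j² - j) / 2, and 24 times that plus v is v (6 j - 1)²; the completed
-- square has a further factor v, which is cancelled.
encodes-euler : ∀ v → .{{_ : ℕ.NonZero v}} → Encodes v (v ℕ.+ v) 5 (ℤ.- + 1) (+ 24) (+ v) (+ v)
encodes-euler v .Encodes.encode i m = ℤP.*-cancelˡ-≡ (+ v) _ _
  (≡.trans (left (+ v) (+ exponent v (v ℕ.+ v) i m))
    (≡.trans (≡.subst (λ z → + 8 ℤ.* (+ v ℤ.+ z) ℤ.* + exponent v (v ℕ.+ v) i m ℤ.+ (+ v ℤ.- z) ℤ.* (+ v ℤ.- z) ≡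
        (+ 2 ℤ.* (+ v ℤ.+ z) ℤ.* (+ i ℤ.- + m) ℤ.+ (+ v ℤ.- z)) ℤ.* (+ 2 ℤ.* (+ v ℤ.+ z) ℤ.* (+ i ℤ.- + m) ℤ.+ (+ v ℤ.- z)))
        (ℤP.pos-+ v v) (exponent-square v (v ℕ.+ v) i m))
      (right (+ v) (+ i ℤ.- + m))))
  where
  left : ∀ v e → v ℤ.* (+ 24 ℤ.* e ℤ.+ v) ≡ + 8 ℤ.* (v ℤ.+ (v ℤ.+ v)) ℤ.* e ℤ.+ (v ℤ.- (v ℤ.+ v)) ℤ.* (v ℤ.- (v ℤ.+ v))
  left = ℤT.solve-∀
  right : ∀ v j → (+ 2 ℤ.* (v ℤ.+ (v ℤ.+ v)) ℤ.* j ℤ.+ (v ℤ.- (v ℤ.+ v))) ℤ.* (+ 2 ℤ.* (v ℤ.+ (v ℤ.+ v)) ℤ.* j ℤ.+ (v ℤ.- (v ℤ.+ v)))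
    ≡ v ℤ.* (v ℤ.* ((+ 6 ℤ.* j ℤ.+ ℤ.- + 1) ℤ.* (+ 6 ℤ.* j ℤ.+ ℤ.- + 1)))
  right = ℤT.solve-∀

encodes-1-4 : Encodes 1 4 9 (ℤ.- + 3) (+ 40) (+ 9) (+ 1)
encodes-1-4 .Encodes.encode i m = ≡.trans (exponent-square 1 4 i m) (≡.sym (ℤP.*-identityˡ _))

encodes-2-3 : Encodes 2 3 9 (ℤ.- + 1) (+ 40) (+ 1) (+ 1)
encodes-2-3 .Encodes.encode i m = ≡.trans (exponent-square 2 3 i m) (≡.sym (ℤP.*-identityˡ _))

encodes-1-3 : Encodes 1 3 3 (ℤ.- + 1) (+ 8) (+ 1) (+ 1)
encodes-1-3 .Encodes.encode i m = ℤP.*-cancelˡ-≡ (+ 4) _ _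
  (≡.trans (left (+ exponent 1 3 i m)) (≡.trans (exponent-square 1 3 i m) (right (+ i ℤ.- + m))))
  where
  left : ∀ e → + 4 ℤ.* (+ 8 ℤ.* e ℤ.+ + 1) ≡ + 32 ℤ.* e ℤ.+ + 4
  left = ℤT.solve-∀
  right : ∀ j → (+ 8 ℤ.* j ℤ.+ ℤ.- + 2) ℤ.* (+ 8 ℤ.* j ℤ.+ ℤ.- + 2) ≡ + 4 ℤ.* (+ 1 ℤ.* ((+ 4 ℤ.* j ℤ.+ ℤ.- + 1) ℤ.* (+ 4 ℤ.* j ℤ.+ ℤ.- + 1)))
  right = ℤT.solve-∀

encodes-2-2 : Encodes 2 2 3 (+ 0) (+ 8) (+ 0) (+ 1)
encodes-2-2 .Encodes.encode i m = ℤP.*-cancelˡ-≡ (+ 4) _ _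
  (≡.trans (left (+ exponent 2 2 i m)) (≡.trans (exponent-square 2 2 i m) (right (+ i ℤ.- + m))))
  where
  left : ∀ e → + 4 ℤ.* (+ 8 ℤ.* e ℤ.+ + 0) ≡ + 32 ℤ.* e ℤ.+ + 0
  left = ℤT.solve-∀
  right : ∀ j → (+ 8 ℤ.* j ℤ.+ + 0) ℤ.* (+ 8 ℤ.* j ℤ.+ + 0) ≡ + 4 ℤ.* (+ 1 ℤ.* ((+ 4 ℤ.* j ℤ.+ + 0) ℤ.* (+ 4 ℤ.* j ℤ.+ + 0)))
  right = ℤT.solve-∀

B-representations : ∀ {v a c a′ c′ α α′ β β′ s e e′ d} → .{{_ : ℕ.NonZero s}} → 0 ℕ.< v → 0 ℕ.< d →
  (a>0 : 0 ℕ.< a) (c>0 : 0 ℕ.< c) (a′>0 : 0 ℕ.< a′) (c′>0 : 0 ℕ.< c′) →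
  (∀ T → let open ThetaProducts (ℤ/ 3) T; open CommutativeRing seriesRing using (_≈_; _*_) in
    theta a c a>0 c>0 * theta a′ c′ a′>0 c′>0 ≈ poch 1 N * poch v N) →
  Encodes a c α β (+ s) e (+ 1) → Encodes a′ c′ α′ β′ (+ s) e′ (+ d) →
  ∀ n K → + K ≡ + s ℤ.* + n ℤ.+ (e ℤ.+ e′) →
  + B 3 v n ≡₃ representations (suc α) β (suc α′) β′ d K
B-representations {v} {a} {c} {a′} {c′} {α} {α′} {β} {β′} v>0 d>0 a>0 c>0 a′>0 c′>0 factor en en′ n K K≡ =
  F₃.trans (PartitionSeries.bipartitions-poch T v v>0 n n≤T)
    (F₃.trans (F₃.sym (factor T n n≤T))
      (F₃.trans (ThetaProducts.theta-*-coefficient (ℤ/ 3) T a c a>0 c>0 a′ c′ a′>0 c′>0 n n≤T)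
        (theta-representations {a} {c} {a′} {c′} d>0 en en′ n K (T ℕ.+ T) K≡ bound bound′)))
  where
  -- The degree must reach n, and 2 T must exceed K + |β| and K + |β′| so that the truncated theta
  -- sums meet all representations of K.
  T = n ℕ.+ (K ℕ.+ (∣ β ∣ ℕ.+ ∣ β′ ∣))
  n≤T : n ℕ.≤ T
  n≤T = ℕP.m≤m+n n _
  half : ∀ {m} → m ℕ.≤ K ℕ.+ (∣ β ∣ ℕ.+ ∣ β′ ∣) → m ℕ.≤ T ℕ.+ T
  half p = ℕP.≤-trans p (ℕP.≤-trans (ℕP.m≤n+m _ n) (ℕP.m≤m+n T T))
  bound : K ℕ.+ ∣ β ∣ ℕ.≤ T ℕ.+ T
  bound = half (ℕP.+-monoʳ-≤ K (ℕP.m≤m+n ∣ β ∣ _))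
  bound′ : K ℕ.+ ∣ β′ ∣ ℕ.≤ T ℕ.+ T
  bound′ = half (ℕP.+-monoʳ-≤ K (ℕP.m≤n+m ∣ β′ ∣ ∣ β ∣))

private
  pos : ∀ {k} → 0 ℕ.< suc k
  pos = s≤s z≤n

B-euler : ∀ v n → + B 3 (suc v) n ≡₃ representations 6 (ℤ.- + 1) 6 (ℤ.- + 1) (suc v) (24 ℕ.* n ℕ.+ (1 ℕ.+ suc v))
B-euler v n = B-representations {suc v} pos pos pos pos pos pos
  (λ T → let open ThetaProducts (ℤ/ 3) T in
    CommutativeRing.*-cong seriesRing (theta-euler 1 pos pos) (theta-euler (suc v) pos pos))
  (encodes-euler 1) (encodes-euler (suc v)) n _ (cast 24 (1 ℕ.+ suc v))
  where
  cast : ∀ s e → + (s ℕ.* n ℕ.+ e) ≡ + s ℤ.* + n ℤ.+ + e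
  cast s e = ≡.trans (ℤP.pos-+ (s ℕ.* n) e) (≡.cong (ℤ._+ + e) (ℤP.pos-* s n))

B-quintic : ∀ n → + B 3 5 n ≡₃ representations 10 (ℤ.- + 3) 10 (ℤ.- + 1) 1 (40 ℕ.* n ℕ.+ 10)
B-quintic n = B-representations {5} pos pos pos pos pos pos (λ T → ThetaProducts.theta-quintic (ℤ/ 3) T)
  encodes-1-4 encodes-2-3 n _ (≡.trans (ℤP.pos-+ (40 ℕ.* n) 10) (≡.cong (ℤ._+ + 10) (ℤP.pos-* 40 n)))

B-quartic : ∀ n → + B 3 2 n ≡₃ representations 4 (ℤ.- + 1) 4 (+ 0) 1 (8 ℕ.* n ℕ.+ 1)
B-quartic n = B-representations {2} pos pos pos pos pos pos (λ T → ThetaProducts.theta-quartic (ℤ/ 3) T)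
  encodes-1-3 encodes-2-2 n _ (≡.trans (ℤP.pos-+ (8 ℕ.* n) 1) (≡.cong (ℤ._+ + 1) (ℤP.pos-* 8 n)))

-- Transformations of sums over representations, and periodicity of the weights.

module _ where
  open import Data.Integer using (_+_; _*_; _-_; -_; _≟_)
  open import Relation.Binary.PropositionalEquality using (refl; sym; trans; cong; cong₂; subst; subst₂)

  Bounded : (ℤ → ℤ → ℤ) → Set
  Bounded Q = ∀ x y K → Q x y ≡ + K → ∣ x ∣ ℕ.≤ K × ∣ y ∣ ℕ.≤ K

  norm-bounded : ∀ d → 0 ℕ.< d → Bounded (norm d)
  norm-bounded d d>0 x y K e = norm-boundˣ {d} {x} {y} e , norm-boundʸ {d} {x} {y} d>0 e

  formSum-cong : ∀ {Ω Ω′} Q K → (∀ x y → Q x y ≡ + K → Ω x y ≡₃ Ω′ x y) → formSum Ω Q K ≡₃ formSum Ω′ Q K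
  formSum-cong Q K e = ∑-cong (box K) (λ (x , y) → when-cong (Q x y ≟ + K) (Q x y ≟ + K) (λ p → p) (λ p → p) (e x y))

  formSum-+ : ∀ Ω Ω′ Q K → formSum (λ x y → Ω x y + Ω′ x y) Q K ≡₃ formSum Ω Q K + formSum Ω′ Q K
  formSum-+ Ω Ω′ Q K = F₃.trans (∑-cong (box K) (λ (x , y) → split (Ω x y) (Ω′ x y) (Q x y ≟ + K)))
    (∑-+ (box K) (λ (x , y) → Ω x y when (Q x y ≟ + K)) (λ (x , y) → Ω′ x y when (Q x y ≟ + K)))
    where
    split : ∀ {P : Set} u v (p : Dec P) → (u + v when p) ≡₃ (u when p) + (v when p)
    split u v (yes _) = F₃.refl
    split u v (no _)  = F₃.refl

  formSum-*ˡ : ∀ s Ω Q K → formSum (λ x y → s * Ω x y) Q K ≡₃ s * formSum Ω Q K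
  formSum-*ˡ s Ω Q K = F₃.trans (∑-cong (box K) (λ (x , y) → factor (Ω x y) (Q x y ≟ + K)))
    (∑-*ˡ s (box K) (λ (x , y) → Ω x y when (Q x y ≟ + K)))
    where
    factor : ∀ {P : Set} u (p : Dec P) → (s * u when p) ≡₃ s * (u when p)
    factor u (yes _) = F₃.refl
    factor u (no _)  = F₃.sym (F₃.zeroʳ s)

  formSum-0 : ∀ Ω Q K → (∀ x y → Q x y ≡ + K → Ω x y ≡₃ + 0) → formSum Ω Q K ≡₃ + 0
  formSum-0 Ω Q K e = ∑-zero (box K) _ (λ (x , y) _ → vanish x y (Q x y ≟ + K))
    where
    vanish : ∀ x y (p : Dec (Q x y ≡ + K)) → (Ω x y when p) ≡₃ + 0
    vanish x y (yes p) = e x y p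
    vanish x y (no _)  = F₃.refl

  -- Boundedness of both forms takes care of the boxes, so only the arithmetic is left: f preserves
  -- solutions and weights, and every solution of nonzero weight in the target has a preimage.
  formSum-reindex : ∀ {Ω Ω′ Q Q′ K K′} → Bounded Q → Bounded Q′ → (f : ℤ × ℤ → ℤ × ℤ) →
    (∀ {z z′} → f z ≡ f z′ → z ≡ z′) →
    (∀ x y → Q x y ≡ + K → Q′ (proj₁ (f (x , y))) (proj₂ (f (x , y))) ≡ + K′) →
    (∀ x y → Q x y ≡ + K → Ω′ (proj₁ (f (x , y))) (proj₂ (f (x , y))) ≡₃ Ω x y) →
    (∀ x y → Q′ x y ≡ + K′ → Ω′ x y ≡₃ + 0 ⊎ ∃ λ z → f z ≡ (x , y) × Q (proj₁ z) (proj₂ z) ≡ + K) →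
    formSum Ω Q K ≡₃ formSum Ω′ Q′ K′
  formSum-reindex {Ω} {Ω′} {Q} {Q′} {K} {K′} bQ bQ′ f inj forth value back =
    ∑-reindex (≡-dec _≟_ _≟_) (box-unique K) (box-unique K′) f inj to from
    where
    g g′ : ℤ × ℤ → ℤ
    g (x , y) = Ω x y when (Q x y ≟ + K)
    g′ (x , y) = Ω′ x y when (Q′ x y ≟ + K′)
    match : ∀ x y → Q x y ≡ + K → g′ (f (x , y)) ≡₃ g (x , y)
    match x y e = F₃.trans (when-yes (Q′ _ _ ≟ + K′) (forth x y e))
      (F₃.trans (value x y e) (F₃.sym (when-yes (Q x y ≟ + K) e)))
    to : ∀ z → z ∈ box K → g z ≡₃ + 0 ⊎ (f z ∈ box K′ × g′ (f z) ≡₃ g z)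
    to (x , y) _ = go (Q x y ≟ + K)
      where
      go : Dec (Q x y ≡ + K) → g (x , y) ≡₃ + 0 ⊎ (f (x , y) ∈ box K′ × g′ (f (x , y)) ≡₃ g (x , y))
      go (no ¬e) = inj₁ (when-no (Q x y ≟ + K) ¬e)
      go (yes e) with bQ′ _ _ K′ (forth x y e)
      ... | p , q = inj₂ (∈-box p q , match x y e)
    from : ∀ z → z ∈ box K′ → g′ z ≡₃ + 0 ⊎ ∃ λ z₀ → z₀ ∈ box K × f z₀ ≡ z × g z₀ ≡₃ g′ z
    from (x , y) _ = go (Q′ x y ≟ + K′)
      where
      go : Dec (Q′ x y ≡ + K′) → g′ (x , y) ≡₃ + 0 ⊎ ∃ λ z₀ → z₀ ∈ box K × f z₀ ≡ (x , y) × g z₀ ≡₃ g′ (x , y)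
      go (no ¬e) = inj₁ (when-no (Q′ x y ≟ + K′) ¬e)
      go (yes e) with back x y e
      ... | inj₁ z = inj₁ (F₃.trans (when-yes (Q′ x y ≟ + K′) e) z)
      ... | inj₂ ((x₀ , y₀) , refl , e₀) with bQ x₀ y₀ K e₀
      ...   | p , q = inj₂ ((x₀ , y₀) , ∈-box p q , refl , F₃.sym (match x₀ y₀ e₀))

  -- Weights periodic modulo m

  σ-+2 : ∀ j → σ (j + + 2) ≡ σ j
  σ-+2 j = trans (cong σ (arith j)) (trans (σ-suc (j + + 1))
    (trans (cong -_ (σ-suc j)) (ℤP.neg-involutive (σ j))))
    where
    arith : ∀ j → j + + 2 ≡ j + + 1 + + 1
    arith = ℤT.solve-∀

  σ-+2n : ∀ j n → σ (j + + 2 * + n) ≡ σ j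
  σ-+2n j zero    = cong σ (ℤP.+-identityʳ j)
  σ-+2n j (suc n) = trans (cong σ (arith j (+ n))) (trans (σ-+2 (j + + 2 * + n)) (σ-+2n j n))
    where
    arith : ∀ j n → j + + 2 * (+ 1 + n) ≡ j + + 2 * n + + 2
    arith = ℤT.solve-∀

  σ-periodic : ∀ j l → σ (j + + 2 * l) ≡ σ j
  σ-periodic j (+ n)    = σ-+2n j n
  σ-periodic j -[1+ n ] = sym (trans (cong σ (arith j (+ suc n))) (σ-+2n (j + + 2 * -[1+ n ]) (suc n)))
    where
    arith : ∀ j n → j ≡ j + + 2 * (- n) + + 2 * n
    arith = ℤT.solve-∀

  Periodic : ℕ → (ℤ → ℤ) → Set
  Periodic m w = ∀ x l → w (x + + m * l) ≡ w x

  -- A shift by the modulus changes the sign (-1)^j, so the period is twice the modulus.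
  halfWeight-periodic : ∀ α β → Periodic (suc α ℕ.+ suc α) (halfWeight (suc α) β)
  halfWeight-periodic α β x l = cases (halfWeight-support α β x) (halfWeight-support α β (x + + (suc α ℕ.+ suc α) * l))
    where
    x′ = x + + (suc α ℕ.+ suc α) * l
    cases : (halfWeight (suc α) β x ≡ + 0 ⊎ ∃ λ j → x ≡ + suc α * j + β) →
      (halfWeight (suc α) β x′ ≡ + 0 ⊎ ∃ λ j → x′ ≡ + suc α * j + β) → halfWeight (suc α) β x′ ≡ halfWeight (suc α) β x
    cases (inj₁ z) (inj₁ z′) = trans z′ (sym z)
    cases (inj₂ (j , e)) _ = trans (cong (halfWeight (suc α) β) (trans (cong (_+ + (suc α ℕ.+ suc α) * l) e) (arith (+ suc α) j β l)))
      (trans (halfWeight-on α β (j + + 2 * l)) (trans (σ-periodic j l)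
        (trans (sym (halfWeight-on α β j)) (cong (halfWeight (suc α) β) (sym e)))))
      where
      arith : ∀ a j b l → a * j + b + (a + a) * l ≡ a * (j + + 2 * l) + b
      arith = ℤT.solve-∀
    cases (inj₁ _) (inj₂ (j , e)) = trans (cong (halfWeight (suc α) β) e) (trans (halfWeight-on α β j)
      (trans (sym (σ-periodic j (- l))) (trans (sym (halfWeight-on α β (j + + 2 * (- l))))
        (cong (halfWeight (suc α) β) (sym (trans (back x (+ suc α) l) (trans (cong (λ z → z - (+ suc α + + suc α) * l) e) (arith (+ suc α) j β l))))))))
      where
      back : ∀ x a l → x ≡ x + (a + a) * l - (a + a) * l
      back = ℤT.solve-∀
      arith : ∀ a j b l → a * j + b - (a + a) * l ≡ a * (j + + 2 * (- l)) + b
      arith = ℤT.solve-∀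

  weight-periodic : ∀ α β → Periodic (suc α ℕ.+ suc α) (weight (suc α) β)
  weight-periodic α β x l = cong₂ _+_ (halfWeight-periodic α β x l)
    (trans (cong (halfWeight (suc α) β) (arith x (+ (suc α ℕ.+ suc α)) l)) (halfWeight-periodic α β (- x) (- l)))
    where
    arith : ∀ x m l → - (x + m * l) ≡ - x + m * (- l)
    arith = ℤT.solve-∀

  residue : ∀ m → .{{_ : ℕ.NonZero m}} → ∀ x → ∃ λ (i : Fin m) → ∃ λ l → x ≡ + toℕ i + + m * l
  residue m x = fromℕ< i<m , x ℤDM./ℕ m ,
    trans (ℤDM.a≡a%ℕn+[a/ℕn]*n x m) (cong₂ _+_ (cong +_ (sym (FinP.toℕ-fromℕ< i<m))) (ℤP.*-comm (x ℤDM./ℕ m) (+ m)))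
    where
    i<m = ℤDM.n%ℕd<d x m

  -- By periodicity, an identity between weights at (p x, p y) and at (x, y) depends only on p, x, y
  -- modulo m. What remains is a finite table for r = p mod m, settled by computation.
  scale-check : ∀ {m r p} → .{{_ : ℕ.NonZero m}} → p ℕ.% m ≡ r → ∀ {f g h k} s →
    Periodic m f → Periodic m g → Periodic m h → Periodic m k →
    (∀ (i j : Fin m) → f (+ (r ℕ.* toℕ i)) * g (+ (r ℕ.* toℕ j)) ≡ s * (h (+ toℕ i) * k (+ toℕ j))) →
    ∀ x y → f (+ p * x) * g (+ p * y) ≡ s * (h x * k y)
  scale-check {m} {r} {p} refl {f} {g} {h} {k} s pf pg ph pk check x y with residue m x | residue m y
  ... | i , l , refl | j , l′ , refl = trans (cong₂ _*_ (shift f pf i l) (shift g pg j l′))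
    (trans (check i j) (cong (s *_) (sym (cong₂ _*_ (ph (+ toℕ i) l) (pk (+ toℕ j) l′)))))
    where
    t = p ℕ./ m
    shift : ∀ w → Periodic m w → ∀ (i : Fin m) l → w (+ p * (+ toℕ i + + m * l)) ≡ w (+ (r ℕ.* toℕ i))
    shift w pw i l = trans (cong w (trans
        (cong (λ z → z * (+ toℕ i + + m * l))
          (trans (cong +_ (ℕDM.m≡m%n+[m/n]*n p m)) (trans (ℤP.pos-+ r (t ℕ.* m)) (cong (λ z → + r + z) (ℤP.pos-* t m)))))
        (trans (arith (+ r) (+ t) (+ m) (+ toℕ i) l) (cong (λ z → z + + m * rest) (sym (ℤP.pos-* r (toℕ i)))))))
      (pw (+ (r ℕ.* toℕ i)) rest)
      where
      rest = + r * l + + t * (+ toℕ i + + m * l)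
      arith : ∀ r t m i l → (r + t * m) * (i + m * l) ≡ r * i + m * (r * l + t * (i + m * l))
      arith = ℤT.solve-∀

  -- The Dirichlet character (12 / ·): 1 at ±1, -1 at ±5 modulo 12, and 0 elsewhere.
  χ₁₂ : ℤ → ℤ
  χ₁₂ = weight 6 (- + 1)

  χ₁₂-periodic : Periodic 12 χ₁₂
  χ₁₂-periodic = weight-periodic 5 (- + 1)

  -- Multiplicativity would give the factor χ₁₂(p)², which is 1 for p prime to 12. The table runs
  -- over all residues of p and discards those divisible by 2 or 3.
  χ₁₂-scale : ∀ p → p ℕ.% 2 ≢ 0 → p ℕ.% 3 ≢ 0 → ∀ x y → χ₁₂ (+ p * x) * χ₁₂ (+ p * y) ≡ + 1 * (χ₁₂ x * χ₁₂ y)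
  χ₁₂-scale p p≢2 p≢3 = scale-check {12} {p ℕ.% 12} {p} refl {χ₁₂} {χ₁₂} {χ₁₂} {χ₁₂} (+ 1)
    χ₁₂-periodic χ₁₂-periodic χ₁₂-periodic χ₁₂-periodic (entry (table (fromℕ< r<12)))
    where
    r = p ℕ.% 12
    r<12 = ℕDM.m%n<n p 12
    Good : ℕ → Set
    Good r = ∀ (i j : Fin 12) → χ₁₂ (+ (r ℕ.* toℕ i)) * χ₁₂ (+ (r ℕ.* toℕ j)) ≡ + 1 * (χ₁₂ (+ toℕ i) * χ₁₂ (+ toℕ j))
    good? : ∀ r → Dec (Good r)
    good? r = FinP.all? {12} λ i → FinP.all? {12} λ j → χ₁₂ (+ (r ℕ.* toℕ i)) * χ₁₂ (+ (r ℕ.* toℕ j)) ≟ + 1 * (χ₁₂ (+ toℕ i) * χ₁₂ (+ toℕ j))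
    table : ∀ (r : Fin 12) → (toℕ r ℕ.% 2 ≡ 0 ⊎ toℕ r ℕ.% 3 ≡ 0) ⊎ Good (toℕ r)
    table = from-yes (FinP.all? {12} λ r → ((toℕ r ℕ.% 2 ℕ.≟ 0) ⊎-dec (toℕ r ℕ.% 3 ℕ.≟ 0)) ⊎-dec good? (toℕ r))
    entry : (toℕ (fromℕ< r<12) ℕ.% 2 ≡ 0 ⊎ toℕ (fromℕ< r<12) ℕ.% 3 ≡ 0) ⊎ Good (toℕ (fromℕ< r<12)) → Good r
    entry rewrite FinP.toℕ-fromℕ< r<12 = λ where
      (inj₁ (inj₁ e)) → ⊥-elim (p≢2 (trans (sym (ℕDM.m∣n⇒o%n%m≡o%m 2 12 p (ℕD.divides 6 refl))) e))
      (inj₁ (inj₂ e)) → ⊥-elim (p≢3 (trans (sym (ℕDM.m∣n⇒o%n%m≡o%m 3 12 p (ℕD.divides 4 refl))) e))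
      (inj₂ g) → g

  -- Primes, Thue's lemma and the Legendre symbol.

  prime>0 : ∀ {p} → Prime p → 0 ℕ.< p
  prime>0 pr = ℕ.>-nonZero⁻¹ _ {{prime⇒nonZero pr}}

  prime-∣-* : ∀ {p} → Prime p → ∀ x y → + p ∣ℤ x * y → + p ∣ℤ x ⊎ + p ∣ℤ y
  prime-∣-* pr x y d with euclidsLemma ∣ x ∣ ∣ y ∣ pr (subst (_ ℕD.∣_) (ℤP.abs-* x y) (ℤS.∣⇒∣ᵤ d))
  ... | inj₁ d′ = inj₁ (ℤS.∣ᵤ⇒∣ d′)
  ... | inj₂ d′ = inj₂ (ℤS.∣ᵤ⇒∣ d′)

  prime-∣-square : ∀ {p} → Prime p → ∀ x → + p ∣ℤ x * x → + p ∣ℤ x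
  prime-∣-square pr x d = reduce (prime-∣-* pr x x d)

  prime-coprime : ∀ {p n} → Prime p → ¬ p ℕD.∣ n → Coprime p n
  prime-coprime pr ¬d (i∣p , i∣n) with prime⇒irreducible pr i∣p
  ... | inj₁ e = e
  ... | inj₂ refl = ⊥-elim (¬d i∣n)

  -- A Bézout coefficient inverts y up to sign, so its square is an exact inverse of y².
  square-inverse : ∀ {p} → Prime p → ∀ y → ¬ + p ∣ℤ y → ∃ λ u → + p ∣ℤ (u * u) * (y * y) - + 1
  square-inverse {p} pr y ¬d with coprime-Bézout (prime-coprime {n = ∣ y ∣} pr (λ d → ¬d (ℤS.∣ᵤ⇒∣ d)))
  ... | Bézout.+- a b e = + b , subst (λ z → + p ∣ℤ (+ b * + b) * z - + 1) (sym (trans (square-abs y) (ℤP.pos-* ∣ y ∣ ∣ y ∣)))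
    (divides ((+ b * + ∣ y ∣ - + 1) * + a) (trans (arith (+ b) (+ ∣ y ∣)) (trans (cong ((+ b * + ∣ y ∣ - + 1) *_) cast) (sym (ℤP.*-assoc (+ b * + ∣ y ∣ - + 1) (+ a) (+ p))))))
    where
    cast : + 1 + + b * + ∣ y ∣ ≡ + a * + p
    cast = trans (cong (λ z → + 1 + z) (sym (ℤP.pos-* b ∣ y ∣))) (trans (cong +_ e) (ℤP.pos-* a p))
    arith : ∀ b y → (b * b) * (y * y) - + 1 ≡ (b * y - + 1) * (+ 1 + b * y)
    arith = ℤT.solve-∀
  ... | Bézout.-+ a b e = + b , subst (λ z → + p ∣ℤ (+ b * + b) * z - + 1) (sym (trans (square-abs y) (ℤP.pos-* ∣ y ∣ ∣ y ∣)))
    (divides ((+ b * + ∣ y ∣ + + 1) * + a) (trans (arith (+ b) (+ ∣ y ∣)) (trans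
      (cong (λ z → (+ b * + ∣ y ∣ + + 1) * (z - + 1)) (sym cast)) (arith₂ (+ b * + ∣ y ∣ + + 1) (+ a) (+ p)))))
    where
    cast : + 1 + + a * + p ≡ + b * + ∣ y ∣
    cast = trans (cong (λ z → + 1 + z) (sym (ℤP.pos-* a p))) (trans (cong +_ e) (ℤP.pos-* b ∣ y ∣))
    arith : ∀ b y → (b * b) * (y * y) - + 1 ≡ (b * y + + 1) * (b * y - + 1)
    arith = ℤT.solve-∀
    arith₂ : ∀ w a p → w * (+ 1 + a * p - + 1) ≡ w * a * p
    arith₂ = ℤT.solve-∀

  Anisotropic : ℕ → ℕ → Set
  Anisotropic d p = ∀ x y → + p ∣ℤ norm d x y → + p ∣ℤ x × + p ∣ℤ y

  -- If p ∤ y, choose u with u² y² ≡ 1; then (u x)² ≡ -d, against the hypothesis. Hence p ∣ y, and p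
  -- ∣ x² follows.
  nonresidue⇒anisotropic : ∀ {d p} → Prime p → (∀ z → ¬ + p ∣ℤ z * z + + d) → Anisotropic d p
  nonresidue⇒anisotropic {d} {p} pr nr x y dn with + p ∣ℤ? y
  ... | no ¬y with square-inverse pr y ¬y
  ...   | u , inv = ⊥-elim (nr (u * x) (subst (+ p ∣ℤ_) (arith (+ d) x y u)
            (ℤS.∣m∣n⇒∣m+n (ℤS.∣n⇒∣m*n (u * u) dn) (ℤS.∣m⇒∣-m (ℤS.∣n⇒∣m*n (+ d) inv)))))
    where
    arith : ∀ d x y u → u * u * (x * x + d * (y * y)) + - (d * (u * u * (y * y) - + 1)) ≡ u * x * (u * x) + d
    arith = ℤT.solve-∀
  nonresidue⇒anisotropic {d} {p} pr nr x y dn | yes dy = prime-∣-square pr x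
    (subst (+ p ∣ℤ_) (arith (x * x) (+ d) y) (ℤS.∣m∣n⇒∣m+n dn (ℤS.∣m⇒∣-m (ℤS.∣n⇒∣m*n (+ d * y) dy)))) , dy
    where
    arith : ∀ x² d y → x² + d * (y * y) + - (d * y * y) ≡ x²
    arith = ℤT.solve-∀

  isqrt : ∀ n → ∃ λ s → s ℕ.* s ℕ.≤ n × n ℕ.< suc s ℕ.* suc s
  isqrt zero = 0 , z≤n , s≤s z≤n
  isqrt (suc n) with isqrt n
  ... | s , s²≤n , n<s⁺² with suc n ℕ.<? suc s ℕ.* suc s
  ...   | yes p = s , ℕP.m≤n⇒m≤1+n s²≤n , p
  ...   | no ¬p = suc s , ℕP.≮⇒≥ ¬p , ℕP.≤-<-trans n<s⁺² (ℕP.*-mono-< (ℕP.n<1+n (suc s)) (ℕP.n<1+n (suc s)))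

  prime≢square : ∀ {p} → Prime p → ∀ s → s ℕ.* s ≢ p
  prime≢square pr s refl with prime⇒irreducible pr {s} (ℕD.m∣m*n s)
  ... | inj₁ refl = ¬prime[1] pr
  ... | inj₂ e = ¬prime[1] (subst Prime (trans (sym e) s≡1) pr)
    where
    instance
      s≢0 : ℕ.NonZero s
      s≢0 = ℕP.m*n≢0⇒m≢0 s {{prime⇒nonZero pr}}
    s≡1 : s ≡ 1
    s≡1 = ℕP.*-cancelˡ-≡ s 1 s (trans (sym e) (sym (ℕP.*-identityʳ s)))

  -- Pigeonhole on the residues of a + z b with 0 ≤ a, b ≤ √p.
  thue : ∀ {p} → Prime p → ∀ d → 0 ℕ.< d → ∀ z → + p ∣ℤ z * z + + d →
    ∃ λ x → ∃ λ y → ∃ λ k → x ℕ.* x ℕ.+ d ℕ.* (y ℕ.* y) ≡ k ℕ.* p × 0 ℕ.< k × k ℕ.≤ d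
  thue {p} pr d d>0 z pz with isqrt p
  ... | s , s²≤p , p<s⁺² with FinP.pigeonhole p<s⁺² hash
    where
    instance
      p≢0 : ℕ.NonZero p
      p≢0 = prime⇒nonZero pr
    hash : Fin (suc s ℕ.* suc s) → Fin p
    hash i = fromℕ< (ℤDM.n%ℕd<d (+ toℕ (proj₁ (Fin.remQuot {suc s} (suc s) i)) + z * + toℕ (proj₂ (Fin.remQuot {suc s} (suc s) i))) p)
  ...   | i , j , i<j , hash≡ = ∣ x ∣ , ∣ y ∣ , ℕD.quotient p∣N , ℕD._∣_.equality p∣N , k>0 , k≤d
    where
    instance
      p≢0 : ℕ.NonZero p
      p≢0 = prime⇒nonZero pr
    coords : Fin (suc s ℕ.* suc s) → Fin (suc s) × Fin (suc s)
    coords = Fin.remQuot {suc s} (suc s)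
    a b : Fin (suc s ℕ.* suc s) → ℤ
    a i = + toℕ (proj₁ (coords i))
    b i = + toℕ (proj₂ (coords i))
    h : Fin (suc s ℕ.* suc s) → ℤ
    h i = a i + z * b i
    x y : ℤ
    x = a i - a j
    y = b i - b j
    h% : h i %ℕ p ≡ h j %ℕ p
    h% = trans (sym (FinP.toℕ-fromℕ< _)) (trans (cong toℕ hash≡) (FinP.toℕ-fromℕ< _))
    p∣x+zy : + p ∣ℤ x + z * y
    p∣x+zy = divides (h i ℤDM./ℕ p - h j ℤDM./ℕ p) (trans (arith (a i) (a j) (b i) (b j) z)
      (trans (cong₂ _-_ (ℤDM.a≡a%ℕn+[a/ℕn]*n (h i) p) (ℤDM.a≡a%ℕn+[a/ℕn]*n (h j) p))
        (trans (cong (λ r → (+ r + h i ℤDM./ℕ p * + p) - (+ (h j %ℕ p) + h j ℤDM./ℕ p * + p)) h%)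
          (arith₂ (+ (h j %ℕ p)) (h i ℤDM./ℕ p) (h j ℤDM./ℕ p) (+ p)))))
      where
      arith : ∀ a a′ b b′ z → (a - a′) + z * (b - b′) ≡ (a + z * b) - (a′ + z * b′)
      arith = ℤT.solve-∀
      arith₂ : ∀ r m n p → (r + m * p) - (r + n * p) ≡ (m - n) * p
      arith₂ = ℤT.solve-∀
    p∣norm : + p ∣ℤ norm d x y
    p∣norm = subst (+ p ∣ℤ_) (arith x y z (+ d)) (ℤS.∣m∣n⇒∣m+n (ℤS.∣m⇒∣m*n (x - z * y) p∣x+zy) (ℤS.∣m⇒∣m*n (y * y) pz))
      where
      arith : ∀ x y z d → (x + z * y) * (x - z * y) + (z * z + d) * (y * y) ≡ x * x + d * (y * y)
      arith = ℤT.solve-∀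
    Nm : ℕ
    Nm = ∣ x ∣ ℕ.* ∣ x ∣ ℕ.+ d ℕ.* (∣ y ∣ ℕ.* ∣ y ∣)
    p∣N : p ℕD.∣ Nm
    p∣N = ℤS.∣⇒∣ᵤ (subst (+ p ∣ℤ_) (norm-abs d x y) p∣norm)
    difference-bound : ∀ (m n : Fin (suc s)) → ∣ + toℕ m - + toℕ n ∣ ℕ.≤ s
    difference-bound m n = subst (λ w → ∣ w ∣ ℕ.≤ s) (sym (ℤP.m-n≡m⊖n (toℕ m) (toℕ n)))
      (ℕP.≤-trans (ℤP.∣m⊝n∣≤m⊔n (toℕ m) (toℕ n)) (ℕP.⊔-lub (FinP.toℕ≤pred[n] m) (FinP.toℕ≤pred[n] n)))
    s²<p : s ℕ.* s ℕ.< p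
    s²<p = ℕP.≤∧≢⇒< s²≤p (prime≢square pr s)
    -- A prime is not a square, so s² < p strictly, and x² + d y² ≤ (1 + d) s² < (1 + d) p.
    k≤d : ℕD.quotient p∣N ℕ.≤ d
    k≤d = ℕP.≤-pred (ℕP.*-cancelʳ-< p _ (suc d) (subst (ℕ._< suc d ℕ.* p) (ℕD._∣_.equality p∣N)
      (ℕP.≤-<-trans (ℕP.+-mono-≤ (ℕP.*-mono-≤ xb xb) (ℕP.*-monoʳ-≤ d (ℕP.*-mono-≤ yb yb))) (ℕP.*-monoʳ-< (suc d) s²<p))))
      where
      xb : ∣ x ∣ ℕ.≤ s
      xb = difference-bound (proj₁ (coords i)) (proj₁ (coords j))
      yb : ∣ y ∣ ℕ.≤ s
      yb = difference-bound (proj₂ (coords i)) (proj₂ (coords j))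
    -- For k = 0 both coordinates of the difference vanish, as d > 0, and the two colliding indices
    -- i < j would be equal.
    k>0 : 0 ℕ.< ℕD.quotient p∣N
    k>0 = ℕP.n≢0⇒n>0 (λ k≡0 → contradiction (trans (ℕD._∣_.equality p∣N) (cong (ℕ._* p) k≡0)))
      where
      contradiction : Nm ≡ 0 → ⊥
      contradiction N≡0 = ℕP.<⇒≢ i<j (cong toℕ (trans (sym (FinP.combine-remQuot {suc s} (suc s) i))
        (trans (cong₂ Fin.combine a≡ b≡) (FinP.combine-remQuot {suc s} (suc s) j))))
        where
        square-zero : ∀ {n} → n ℕ.* n ≡ 0 → n ≡ 0
        square-zero {zero} _ = refl
        coordinate≡ : ∀ (m n : Fin (suc s)) → ∣ + toℕ m - + toℕ n ∣ ℕ.* ∣ + toℕ m - + toℕ n ∣ ≡ 0 → m ≡ n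
        coordinate≡ m n e = FinP.toℕ-injective (ℤP.+-injective (ℤP.i-j≡0⇒i≡j (+ toℕ m) (+ toℕ n) (ℤP.∣i∣≡0⇒i≡0 (square-zero e))))
        a≡ : proj₁ (coords i) ≡ proj₁ (coords j)
        a≡ = coordinate≡ _ _ (ℕP.m+n≡0⇒m≡0 _ N≡0)
        b≡ : proj₂ (coords i) ≡ proj₂ (coords j)
        b≡ = coordinate≡ _ _ (ℕP.m*n≡0⇒m≡0 _ d {{ℕ.>-nonZero d>0}} (trans (ℕP.*-comm _ d) (ℕP.m+n≡0⇒n≡0 (∣ x ∣ ℕ.* ∣ x ∣) N≡0)))

  any-true : ∀ {A : Set} (f : A → Bool) xs → any f xs ≡ true → ∃ λ x → f x ≡ true
  any-true f (x ∷ xs) e with f x in fx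
  ... | true = x , fx
  ... | false = any-true f xs e

  any-false : ∀ {A : Set} (f : A → Bool) xs → any f xs ≡ false → ∀ {x} → x ∈ xs → f x ≡ false
  any-false f (x ∷ xs) e m with f x in fx
  any-false f (x ∷ xs) e (here refl) | false = fx
  any-false f (x ∷ xs) e (there m)     | false = any-false f xs e m

  ≡ᵇ-true : ∀ m n → (m ≡ᵇ n) ≡ true → m ≡ n
  ≡ᵇ-true m n e = ℕP.≡ᵇ⇒≡ m n (subst IsTrue (sym e) _)

  ≡ᵇ-false : ∀ m n → (m ≡ᵇ n) ≡ false → m ≢ n
  ≡ᵇ-false m n e m≡n = subst IsTrue e (ℕP.≡⇒≡ᵇ m n m≡n)

  %ℕ⇒∣ : ∀ p → .{{_ : ℕ.NonZero p}} → ∀ a b → a %ℕ p ≡ b %ℕ p → + p ∣ℤ a - b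
  %ℕ⇒∣ p a b e = divides (a ℤDM./ℕ p - b ℤDM./ℕ p) (trans
    (cong₂ _-_ (ℤDM.a≡a%ℕn+[a/ℕn]*n a p) (ℤDM.a≡a%ℕn+[a/ℕn]*n b p))
    (trans (cong (λ r → (+ r + a ℤDM./ℕ p * + p) - (+ (b %ℕ p) + b ℤDM./ℕ p * + p)) e)
      (arith (+ (b %ℕ p)) (a ℤDM./ℕ p) (b ℤDM./ℕ p) (+ p))))
    where
    arith : ∀ r m n p → (r + m * p) - (r + n * p) ≡ (m - n) * p
    arith = ℤT.solve-∀

  ∣⇒%ℕ : ∀ p → .{{_ : ℕ.NonZero p}} → ∀ a b → + p ∣ℤ a - b → a %ℕ p ≡ b %ℕ p
  ∣⇒%ℕ p a b d = small (ℤDM.n%ℕd<d a p) (ℤDM.n%ℕd<d b p) (subst (+ p ∣ℤ_)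
      (trans (cong₂ (λ u v → u - v - (a ℤDM./ℕ p - b ℤDM./ℕ p) * + p) (ℤDM.a≡a%ℕn+[a/ℕn]*n a p) (ℤDM.a≡a%ℕn+[a/ℕn]*n b p))
        (arith (+ (a %ℕ p)) (+ (b %ℕ p)) (a ℤDM./ℕ p) (b ℤDM./ℕ p) (+ p)))
      (ℤS.∣m∣n⇒∣m+n d (ℤS.∣m⇒∣-m (ℤS.∣n⇒∣m*n (a ℤDM./ℕ p - b ℤDM./ℕ p) (ℤS.∣-refl {+ p})))))
    where
    arith : ∀ r r′ m n p → (r + m * p) - (r′ + n * p) - (m - n) * p ≡ r - r′
    arith = ℤT.solve-∀
    cancel : ∀ x y → x + y - x ≡ y
    cancel = ℤT.solve-∀
    zero-multiple : ∀ {o} → o ℕ.< p → p ℕD.∣ o → o ≡ 0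
    zero-multiple {zero}  _   _ = refl
    zero-multiple {suc o} o<p q = ⊥-elim (ℕD.>⇒∤ o<p q)
    offset : ∀ {r o} → r ℕ.+ o ℕ.< p → + p ∣ℤ + (r ℕ.+ o) - + r → r ≡ r ℕ.+ o
    offset {r} {o} lt q = sym (trans (cong (r ℕ.+_) (zero-multiple (ℕP.≤-<-trans (ℕP.m≤n+m o r) lt)
      (ℤS.∣⇒∣ᵤ (subst (+ p ∣ℤ_) (trans (cong (_- + r) (ℤP.pos-+ r o)) (cancel (+ r) (+ o))) q)))) (ℕP.+-identityʳ r))
    small : ∀ {r r′} → r ℕ.< p → r′ ℕ.< p → + p ∣ℤ + r - + r′ → r ≡ r′
    small {r} {r′} r<p r′<p q with ℕP.≤-total r r′
    ... | inj₂ le with ℕP.m≤n⇒∃[o]m+o≡n le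
    ...   | o , refl = sym (offset r<p q)
    small {r} {r′} r<p r′<p q | inj₁ le with ℕP.m≤n⇒∃[o]m+o≡n le
    ...   | o , refl = offset r′<p (subst (+ p ∣ℤ_) (flip (+ r) (+ (r ℕ.+ o))) (ℤS.∣m⇒∣-m q))
      where
      flip : ∀ x y → - (x - y) ≡ y - x
      flip = ℤT.solve-∀

  -- Extracts a dichotomy from the Boolean search: p > 2 keeps away the Kronecker clause, and p ∤ d
  -- the value 0.
  legendre-cases : ∀ {p} → 2 ℕ.< p → ∀ d → ¬ p ℕD.∣ d →
    (legendre (- + d) p ≡ + 1 × ∃ λ z → + p ∣ℤ z * z + + d) ⊎
    (legendre (- + d) p ≡ -[1+ 0 ] × ∀ z → ¬ + p ∣ℤ z * z + + d)
  legendre-cases {suc zero} (s≤s ()) d p∤d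
  legendre-cases {suc (suc zero)} (s≤s (s≤s ())) d p∤d
  legendre-cases {suc (suc (suc q))} _ d p∤d with ((- + d) %ℕ suc (suc (suc q))) ≡ᵇ 0 in e₀
  ... | true = ⊥-elim (p∤d (ℤS.∣⇒∣ᵤ (subst (+ p ∣ℤ_) (arith (+ d)) (ℤS.∣m⇒∣-m (%ℕ⇒∣ p (- + d) (+ 0) (≡ᵇ-true _ _ e₀))))))
    where
    p = suc (suc (suc q))
    arith : ∀ d → - (- d - + 0) ≡ d
    arith = ℤT.solve-∀
  ... | false with any (λ x → ((x ℕ.* x) ℕ.% suc (suc (suc q))) ≡ᵇ ((- + d) %ℕ suc (suc (suc q)))) (upTo (suc (suc (suc q)))) in e₁
  ...   | true = inj₁ (refl , root (any-true _ (upTo p) e₁))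
    where
    p = suc (suc (suc q))
    root : (∃ λ x → ((x ℕ.* x) ℕ.% p ≡ᵇ (- + d) %ℕ p) ≡ true) → ∃ λ z → + p ∣ℤ z * z + + d
    root (x , e) = + x , subst (+ p ∣ℤ_) (trans (cong (_- (- + d)) (ℤP.pos-* x x)) (cong (λ w → + x * + x + w) (ℤP.neg-involutive (+ d))))
      (%ℕ⇒∣ p (+ (x ℕ.* x)) (- + d) (≡ᵇ-true _ _ e))
  ...   | false = inj₂ (refl , λ z dz → no-root z (residue p z) dz)
    where
    p = suc (suc (suc q))
    -- The search runs only over 0 ≤ x < p, so z is first replaced by its residue.
    no-root : ∀ z → (∃ λ (i : Fin p) → ∃ λ l → z ≡ + toℕ i + + p * l) → ¬ + p ∣ℤ z * z + + d
    no-root _ (i , l , refl) dz = ≡ᵇ-false ((toℕ i ℕ.* toℕ i) ℕ.% p) ((- + d) %ℕ p)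
      (any-false (λ x → ((x ℕ.* x) ℕ.% p) ≡ᵇ ((- + d) %ℕ p)) (upTo p) e₁ (∈-upTo⁺ (FinP.toℕ<n i)))
      (∣⇒%ℕ p (+ (toℕ i ℕ.* toℕ i)) (- + d) (subst (+ p ∣ℤ_)
        (trans (arith (+ toℕ i) l (+ p) (+ d)) (cong (_- (- + d)) (sym (ℤP.pos-* (toℕ i) (toℕ i)))))
        (ℤS.∣m∣n⇒∣m+n dz (ℤS.∣m⇒∣-m (ℤS.∣m⇒∣m*n (+ 2 * + toℕ i * l + + p * l * l) (ℤS.∣-refl {+ p}))))))
      where
      arith : ∀ i l p d → (i + p * l) * (i + p * l) + d + - (p * (+ 2 * i * l + p * l * l)) ≡ i * i - (- d)
      arith = ℤT.solve-∀

  -- β ↦ p β is a bijection from norm K onto the elements of norm p² K divisible by p; the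
  -- hypothesis says that all others have weight zero.
  formSum-dilate : ∀ {p d} → Prime p → 0 ℕ.< d → ∀ Ω K →
    (∀ x y → norm d x y ≡ + (p ℕ.* p ℕ.* K) → Ω x y ≡₃ + 0 ⊎ (+ p ∣ℤ x × + p ∣ℤ y)) →
    formSum (λ x y → Ω (+ p * x) (+ p * y)) (norm d) K ≡₃ formSum Ω (norm d) (p ℕ.* p ℕ.* K)
  formSum-dilate {p} {d} pr d>0 Ω K support = formSum-reindex (norm-bounded d d>0) (norm-bounded d d>0) f inj forth (λ _ _ _ → F₃.refl) back
    where
    instance
      p≢0 : ℕ.NonZero p
      p≢0 = prime⇒nonZero pr
      p²≢0 : ℕ.NonZero (p ℕ.* p)
      p²≢0 = ℕP.m*n≢0 p p
    f : ℤ × ℤ → ℤ × ℤ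
    f (x , y) = + p * x , + p * y
    inj : ∀ {z z′} → f z ≡ f z′ → z ≡ z′
    inj {x , y} {x′ , y′} e = cong₂ _,_ (ℤP.*-cancelˡ-≡ (+ p) x x′ (,-injectiveˡ e)) (ℤP.*-cancelˡ-≡ (+ p) y y′ (,-injectiveʳ e))
    norm-scale : ∀ x y → norm d (+ p * x) (+ p * y) ≡ + (p ℕ.* p) * norm d x y
    norm-scale x y = trans (arith (+ p) x y (+ d)) (cong (_* norm d x y) (sym (ℤP.pos-* p p)))
      where
      arith : ∀ p x y d → p * x * (p * x) + d * (p * y * (p * y)) ≡ p * p * (x * x + d * (y * y))
      arith = ℤT.solve-∀
    forth : ∀ x y → norm d x y ≡ + K → norm d (+ p * x) (+ p * y) ≡ + (p ℕ.* p ℕ.* K)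
    forth x y e = trans (norm-scale x y) (trans (cong (+ (p ℕ.* p) *_) e) (sym (ℤP.pos-* (p ℕ.* p) K)))
    back : ∀ x y → norm d x y ≡ + (p ℕ.* p ℕ.* K) → Ω x y ≡₃ + 0 ⊎ ∃ λ z → f z ≡ (x , y) × norm d (proj₁ z) (proj₂ z) ≡ + K
    back x y e with support x y e
    ... | inj₁ z = inj₁ z
    ... | inj₂ (divides a refl , divides b refl) = inj₂ ((a , b) , cong₂ _,_ (ℤP.*-comm (+ p) a) (ℤP.*-comm (+ p) b) ,
      ℤP.*-cancelˡ-≡ (+ (p ℕ.* p)) (norm d a b) (+ K) (trans (sym (norm-scale a b))
        (trans (cong₂ (norm d) (ℤP.*-comm (+ p) a) (ℤP.*-comm (+ p) b)) (trans e (ℤP.pos-* (p ℕ.* p) K)))))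

  -- The symmetry of x² + y² allows two different weights to trade places.
  formSum-flip : ∀ Ω K → formSum Ω (norm 1) K ≡₃ formSum (λ x y → Ω y x) (norm 1) K
  formSum-flip Ω K = formSum-reindex {Ω} {λ x y → Ω y x} {norm 1} {norm 1} {K} {K} (norm-bounded 1 (s≤s z≤n)) (norm-bounded 1 (s≤s z≤n)) flip flip-injective
    (λ x y e → trans (comm y x) e) (λ _ _ _ → F₃.refl)
    (λ x y e → inj₂ ((y , x) , refl , trans (comm y x) e))
    where
    flip : ℤ × ℤ → ℤ × ℤ
    flip (x , y) = y , x
    flip-injective : ∀ {z z′} → flip z ≡ flip z′ → z ≡ z′
    flip-injective {x , y} {x′ , y′} e = cong₂ _,_ (,-injectiveʳ e) (,-injectiveˡ e)
    comm : ∀ x y → norm 1 x y ≡ norm 1 y x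
    comm x y = arith (x * x) (y * y)
      where
      arith : ∀ x y → x + + 1 * y ≡ y + + 1 * x
      arith = ℤT.solve-∀

  anisotropic-dilate : ∀ {p d} → Prime p → 0 ℕ.< d → Anisotropic d p → ∀ Ω K →
    formSum Ω (norm d) (p ℕ.* p ℕ.* K) ≡₃ formSum (λ x y → Ω (+ p * x) (+ p * y)) (norm d) K
  anisotropic-dilate {p} {d} pr d>0 an Ω K = F₃.sym (formSum-dilate pr d>0 Ω K λ x y e → inj₂ (an x y
    (divides (+ (p ℕ.* K)) (trans e (trans (cong +_ (arith p K)) (ℤP.pos-* (p ℕ.* K) p))))))
    where
    arith : ∀ p K → p ℕ.* p ℕ.* K ≡ p ℕ.* K ℕ.* p
    arith = ℕS.solve-∀

  -- Residues of values of x² + d y²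

  normℕ : ℕ → ℕ → ℕ → ℕ
  normℕ d x y = x ℕ.* x ℕ.+ d ℕ.* (y ℕ.* y)

  normℕ-mod : ∀ m → .{{_ : ℕ.NonZero m}} → ∀ d x y → normℕ d (x ℕ.% m) (y ℕ.% m) ℕ.% m ≡ normℕ d x y ℕ.% m
  normℕ-mod m d x y = sym (trans
    (cong₂ (λ u v → normℕ d u v ℕ.% m) (ℕDM.m≡m%n+[m/n]*n x m) (ℕDM.m≡m%n+[m/n]*n y m))
    (trans (cong (ℕ._% m) (arith d (x ℕ.% m) (y ℕ.% m) (x ℕ./ m) (y ℕ./ m) m)) (ℕDM.[m+kn]%n≡m%n (normℕ d (x ℕ.% m) (y ℕ.% m))
      (2 ℕ.* (x ℕ.% m) ℕ.* (x ℕ./ m) ℕ.+ x ℕ./ m ℕ.* (x ℕ./ m) ℕ.* m ℕ.+ d ℕ.* (2 ℕ.* (y ℕ.% m) ℕ.* (y ℕ./ m) ℕ.+ y ℕ./ m ℕ.* (y ℕ./ m) ℕ.* m)) m)))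
    where
    arith : ∀ d i j a b m → (i ℕ.+ a ℕ.* m) ℕ.* (i ℕ.+ a ℕ.* m) ℕ.+ d ℕ.* ((j ℕ.+ b ℕ.* m) ℕ.* (j ℕ.+ b ℕ.* m)) ≡
      i ℕ.* i ℕ.+ d ℕ.* (j ℕ.* j) ℕ.+ (2 ℕ.* i ℕ.* a ℕ.+ a ℕ.* a ℕ.* m ℕ.+ d ℕ.* (2 ℕ.* j ℕ.* b ℕ.+ b ℕ.* b ℕ.* m)) ℕ.* m
    arith = ℕS.solve-∀

  Omits : ℕ → (m c : ℕ) → .{{_ : ℕ.NonZero m}} → Set
  Omits d m c = ∀ (i j : Fin m) → ¬ normℕ d (toℕ i) (toℕ j) ℕ.% m ≡ c

  omits? : ∀ d m c → .{{_ : ℕ.NonZero m}} → Dec (Omits d m c)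
  omits? d m c = FinP.all? {m} λ i → FinP.all? {m} λ j → ¬? (normℕ d (toℕ i) (toℕ j) ℕ.% m ℕ.≟ c)

  omitted : ∀ d m c → .{{_ : ℕ.NonZero m}} → Omits d m c → ∀ x y → ¬ normℕ d x y ℕ.% m ≡ c
  omitted d m c om x y e = om (fromℕ< x<m) (fromℕ< y<m) (trans
    (cong₂ (λ u v → normℕ d u v ℕ.% m) (FinP.toℕ-fromℕ< x<m) (FinP.toℕ-fromℕ< y<m)) (trans (normℕ-mod m d x y) e))
    where
    x<m = ℕDM.m%n<n x m
    y<m = ℕDM.m%n<n y m

  multiple-mod : ∀ k m → .{{_ : ℕ.NonZero m}} → .{{_ : ℕ.NonZero (k ℕ.* m)}} → ∀ {p r} → p ℕ.% m ≡ r → (k ℕ.* p) ℕ.% (k ℕ.* m) ≡ (k ℕ.* r) ℕ.% (k ℕ.* m)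
  multiple-mod k m {p} refl = trans (cong (λ z → (k ℕ.* z) ℕ.% (k ℕ.* m)) (ℕDM.m≡m%n+[m/n]*n p m))
    (trans (cong (ℕ._% (k ℕ.* m)) (arith k (p ℕ.% m) (p ℕ./ m) m)) (ℕDM.[m+kn]%n≡m%n (k ℕ.* (p ℕ.% m)) (p ℕ./ m) (k ℕ.* m)))
    where
    arith : ∀ k r t m → k ℕ.* (r ℕ.+ t ℕ.* m) ≡ k ℕ.* r ℕ.+ t ℕ.* (k ℕ.* m)
    arith = ℕS.solve-∀

  -- The residue of p modulo m determines k p modulo k m, and it is this finer modulus at which x² +
  -- d y² misses the value.
  not-represented : ∀ d k m r → .{{_ : ℕ.NonZero m}} → .{{_ : ℕ.NonZero (k ℕ.* m)}} → Omits d (k ℕ.* m) ((k ℕ.* r) ℕ.% (k ℕ.* m)) →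
    ∀ {p x y} → p ℕ.% m ≡ r → normℕ d x y ≡ k ℕ.* p → ⊥
  not-represented d k m r om {p} {x} {y} p% e = omitted d (k ℕ.* m) ((k ℕ.* r) ℕ.% (k ℕ.* m)) om x y
    (trans (cong (ℕ._% (k ℕ.* m)) e) (multiple-mod k m p%))

  prime-%≡0 : ∀ {p} → Prime p → ∀ m → .{{_ : ℕ.NonZero m}} → m ≢ 1 → p ℕ.% m ≡ 0 → p ≡ m
  prime-%≡0 pr m m≢1 e with prime⇒irreducible pr (ℕD.m%n≡0⇒n∣m _ m e)
  ... | inj₁ m≡1 = ⊥-elim (m≢1 m≡1)
  ... | inj₂ m≡p = sym m≡p

  -- If -1 were a square modulo p, Thue's lemma with d = 1 would give x² + y² = p, impossible modulo
  -- 4.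
  anisotropic-1 : ∀ {p} → Prime p → p ℕ.% 4 ≡ 3 → Anisotropic 1 p
  anisotropic-1 {p} pr p%4 = nonresidue⇒anisotropic pr λ z dz → impossible (thue pr 1 (s≤s z≤n) z dz)
    where
    impossible : ¬ ∃ λ x → ∃ λ y → ∃ λ k → normℕ 1 x y ≡ k ℕ.* p × 0 ℕ.< k × k ℕ.≤ 1
    impossible (x , y , 1 , e , _ , _) = not-represented 1 1 4 3 (from-yes (omits? 1 4 3)) {p} {x} {y} p%4 e
    impossible (x , y , suc (suc k) , e , _ , s≤s ())

  -- Genus theory by hand for x² + 5 y² = k p: k = 1, 4, 5 contradict p ≡ 3 (mod 4), while k = 2 and
  -- 3 exclude p ≡ ±1 (mod 5). Together with p ≡ 3 (mod 4) this leaves 3 and 7 modulo 20.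
  residue-5 : ∀ {p} → Prime p → p ℕ.% 4 ≡ 3 → ∀ z → + p ∣ℤ z * z + + 5 → p ℕ.% 20 ≡ 3 ⊎ p ℕ.% 20 ≡ 7
  residue-5 {p} pr p%4 z dz = combine (thue pr 5 (s≤s z≤n) z dz)
    where
    p%5≢0 : p ℕ.% 5 ≢ 0
    p%5≢0 e = 1≢3 (subst (λ n → n ℕ.% 4 ≡ 3) (prime-%≡0 pr 5 (λ ()) e) p%4)
      where
      1≢3 : ¬ 1 ≡ 3
      1≢3 ()
    table : ∀ (r : Fin 20) → toℕ r ℕ.% 4 ≡ 3 → toℕ r ℕ.% 5 ≢ 0 → toℕ r ℕ.% 5 ≢ 1 → toℕ r ℕ.% 5 ≢ 4 → toℕ r ≡ 3 ⊎ toℕ r ≡ 7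
    table = from-yes (FinP.all? {20} λ r → (toℕ r ℕ.% 4 ℕ.≟ 3) →-dec (¬? (toℕ r ℕ.% 5 ℕ.≟ 0) →-dec
      (¬? (toℕ r ℕ.% 5 ℕ.≟ 1) →-dec (¬? (toℕ r ℕ.% 5 ℕ.≟ 4) →-dec ((toℕ r ℕ.≟ 3) ⊎-dec (toℕ r ℕ.≟ 7))))))
    conclude : p ℕ.% 5 ≢ 1 → p ℕ.% 5 ≢ 4 → p ℕ.% 20 ≡ 3 ⊎ p ℕ.% 20 ≡ 7
    conclude ≢1 ≢4 = subst (λ r → r ≡ 3 ⊎ r ≡ 7) r≡ (table (fromℕ< r<20)
        (trans (cong (ℕ._% 4) r≡) (trans (ℕDM.m∣n⇒o%n%m≡o%m 4 20 p (ℕD.divides 5 refl)) p%4))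
        (λ e → p%5≢0 (trans (sym r%5) e)) (λ e → ≢1 (trans (sym r%5) e)) (λ e → ≢4 (trans (sym r%5) e)))
      where
      r<20 = ℕDM.m%n<n p 20
      r≡ : toℕ (fromℕ< r<20) ≡ p ℕ.% 20
      r≡ = FinP.toℕ-fromℕ< r<20
      r%5 : toℕ (fromℕ< r<20) ℕ.% 5 ≡ p ℕ.% 5
      r%5 = trans (cong (ℕ._% 5) r≡) (ℕDM.m∣n⇒o%n%m≡o%m 5 20 p (ℕD.divides 4 refl))
    combine : (∃ λ x → ∃ λ y → ∃ λ k → normℕ 5 x y ≡ k ℕ.* p × 0 ℕ.< k × k ℕ.≤ 5) → p ℕ.% 20 ≡ 3 ⊎ p ℕ.% 20 ≡ 7
    combine (x , y , 1 , e , _) = ⊥-elim (not-represented 5 1 4 3 (from-yes (omits? 5 4 3)) {p} {x} {y} p%4 e)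
    combine (x , y , 2 , e , _) = conclude
      (λ p%5 → not-represented 5 2 5 1 (from-yes (omits? 5 10 2)) {p} {x} {y} p%5 e)
      (λ p%5 → not-represented 5 2 5 4 (from-yes (omits? 5 10 8)) {p} {x} {y} p%5 e)
    combine (x , y , 3 , e , _) = conclude
      (λ p%5 → not-represented 5 3 5 1 (from-yes (omits? 5 15 3)) {p} {x} {y} p%5 e)
      (λ p%5 → not-represented 5 3 5 4 (from-yes (omits? 5 15 12)) {p} {x} {y} p%5 e)
    combine (x , y , 4 , e , _) = ⊥-elim (not-represented 5 4 4 3 (from-yes (omits? 5 16 12)) {p} {x} {y} p%4 e)
    combine (x , y , 5 , e , _) = ⊥-elim (not-represented 5 5 4 3 (from-yes (omits? 5 20 15)) {p} {x} {y} p%4 e)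
    combine (x , y , suc (suc (suc (suc (suc (suc _))))) , e , _ , s≤s (s≤s (s≤s (s≤s (s≤s ())))))

  -- Thue's lemma leaves x² + 2 y² = p or 2 p, and neither is possible modulo 8 or 16 respectively.
  residue-2 : ∀ {p} → Prime p → p ℕ.% 8 ≡ 5 ⊎ p ℕ.% 8 ≡ 7 → ∀ z → ¬ + p ∣ℤ z * z + + 2
  residue-2 {p} pr p%8 z dz = impossible (thue pr 2 (s≤s z≤n) z dz) p%8
    where
    impossible : (∃ λ x → ∃ λ y → ∃ λ k → normℕ 2 x y ≡ k ℕ.* p × 0 ℕ.< k × k ℕ.≤ 2) → ¬ (p ℕ.% 8 ≡ 5 ⊎ p ℕ.% 8 ≡ 7)
    impossible (x , y , 1 , e , _) (inj₁ p%8) = not-represented 2 1 8 5 (from-yes (omits? 2 8 5)) {p} {x} {y} p%8 e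
    impossible (x , y , 1 , e , _) (inj₂ p%8) = not-represented 2 1 8 7 (from-yes (omits? 2 8 7)) {p} {x} {y} p%8 e
    impossible (x , y , 2 , e , _) (inj₁ p%8) = not-represented 2 2 8 5 (from-yes (omits? 2 16 10)) {p} {x} {y} p%8 e
    impossible (x , y , 2 , e , _) (inj₂ p%8) = not-represented 2 2 8 7 (from-yes (omits? 2 16 14)) {p} {x} {y} p%8 e
    impossible (x , y , suc (suc (suc k)) , e , _ , s≤s (s≤s ())) _

  -- Of x² + 7 y² = k p with k ≤ 7, congruences exclude k = 2 and 6 (p odd), 3 (p ≡ 2 modulo 3) and
  -- 5 (p ≠ 5). The cases k = 4 and k = 7 descend to k = 1: both coordinates are even, or 7 ∣ x.
  represented-7 : ∀ {p} → Prime p → p ≢ 2 → p ≢ 5 → p ℕ.% 3 ≡ 2 → ∀ z → + p ∣ℤ z * z + + 7 → ∃ λ u → ∃ λ v → normℕ 7 u v ≡ p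
  represented-7 {p} pr p≢2 p≢5 p%3 z dz = find (thue pr 7 (s≤s z≤n) z dz)
    where
    p%2 : p ℕ.% 2 ≡ 1
    p%2 with p ℕ.% 2 in e | ℕDM.m%n<n p 2
    ... | 0 | _ = ⊥-elim (p≢2 (prime-%≡0 pr 2 (λ ()) e))
    ... | 1 | _ = refl
    ... | suc (suc _) | s≤s (s≤s ())
    even-halves : ∀ n → n ℕ.% 8 ℕ.% 2 ≡ 0 → 2 ℕD.∣ n
    even-halves n e = ℕD.m%n≡0⇒n∣m n 2 (trans (sym (ℕDM.m∣n⇒o%n%m≡o%m 2 8 n (ℕD.divides 4 refl))) e)
    -- For x, y both odd x² + 7 y² is 0 modulo 8, for opposite parities it is odd; but 4 p ≡ 4 (mod
    -- 8).
    table : ∀ (i j : Fin 8) → normℕ 7 (toℕ i) (toℕ j) ℕ.% 8 ≡ 4 → toℕ i ℕ.% 2 ≡ 0 × toℕ j ℕ.% 2 ≡ 0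
    table = from-yes (FinP.all? {8} λ i → FinP.all? {8} λ j → (normℕ 7 (toℕ i) (toℕ j) ℕ.% 8 ℕ.≟ 4) →-dec
      ((toℕ i ℕ.% 2 ℕ.≟ 0) ×-dec (toℕ j ℕ.% 2 ℕ.≟ 0)))
    both-even : ∀ x y → normℕ 7 x y ≡ 4 ℕ.* p → 2 ℕD.∣ x × 2 ℕD.∣ y
    both-even x y e = evens (table (fromℕ< x<8) (fromℕ< y<8) (trans
        (cong₂ (λ u v → normℕ 7 u v ℕ.% 8) (FinP.toℕ-fromℕ< x<8) (FinP.toℕ-fromℕ< y<8))
        (trans (normℕ-mod 8 7 x y) (trans (cong (λ n → n ℕ.% 8) {normℕ 7 x y} {4 ℕ.* p} e) (multiple-mod 4 2 {p} {1} p%2)))))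
      where
      x<8 = ℕDM.m%n<n x 8
      y<8 = ℕDM.m%n<n y 8
      evens : toℕ (fromℕ< x<8) ℕ.% 2 ≡ 0 × toℕ (fromℕ< y<8) ℕ.% 2 ≡ 0 → 2 ℕD.∣ x × 2 ℕD.∣ y
      evens (ex , ey) = even-halves x (subst (λ n → n ℕ.% 2 ≡ 0) (FinP.toℕ-fromℕ< x<8) ex) ,
                        even-halves y (subst (λ n → n ℕ.% 2 ≡ 0) (FinP.toℕ-fromℕ< y<8) ey)
    p%5 : ∀ r → p ℕ.% 5 ≡ r → r ℕ.< 5 → ∀ x y → ¬ normℕ 7 x y ≡ 5 ℕ.* p
    p%5 0 e _ x y = λ _ → p≢5 (prime-%≡0 pr 5 (λ ()) e)
    p%5 1 e _ x y = not-represented 7 5 5 1 (from-yes (omits? 7 25 5)) {p} {x} {y} e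
    p%5 2 e _ x y = not-represented 7 5 5 2 (from-yes (omits? 7 25 10)) {p} {x} {y} e
    p%5 3 e _ x y = not-represented 7 5 5 3 (from-yes (omits? 7 25 15)) {p} {x} {y} e
    p%5 4 e _ x y = not-represented 7 5 5 4 (from-yes (omits? 7 25 20)) {p} {x} {y} e
    p%5 (suc (suc (suc (suc (suc _))))) _ (s≤s (s≤s (s≤s (s≤s (s≤s ())))))
    halve-both : ∀ {x y} → 2 ℕD.∣ x × 2 ℕD.∣ y → normℕ 7 x y ≡ 4 ℕ.* p → ∃ λ u → ∃ λ v → normℕ 7 u v ≡ p
    halve-both (ℕD.divides a refl , ℕD.divides b refl) e = a , b , ℕP.*-cancelˡ-≡ (normℕ 7 a b) p 4 (trans (arith a b) e)
      where
      arith : ∀ a b → 4 ℕ.* (a ℕ.* a ℕ.+ 7 ℕ.* (b ℕ.* b)) ≡ a ℕ.* 2 ℕ.* (a ℕ.* 2) ℕ.+ 7 ℕ.* (b ℕ.* 2 ℕ.* (b ℕ.* 2))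
      arith = ℕS.solve-∀
    divide-7 : ∀ {x y} → 7 ℕD.∣ x → normℕ 7 x y ≡ 7 ℕ.* p → ∃ λ u → ∃ λ v → normℕ 7 u v ≡ p
    divide-7 {y = y} (ℕD.divides a refl) e = y , a , ℕP.*-cancelˡ-≡ (normℕ 7 y a) p 7 (trans (arith y a) e)
      where
      arith : ∀ y a → 7 ℕ.* (y ℕ.* y ℕ.+ 7 ℕ.* (a ℕ.* a)) ≡ a ℕ.* 7 ℕ.* (a ℕ.* 7) ℕ.+ 7 ℕ.* (y ℕ.* y)
      arith = ℕS.solve-∀
    find : (∃ λ x → ∃ λ y → ∃ λ k → normℕ 7 x y ≡ k ℕ.* p × 0 ℕ.< k × k ℕ.≤ 7) → ∃ λ u → ∃ λ v → normℕ 7 u v ≡ p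
    find (x , y , 1 , e , _) = x , y , trans e (ℕP.*-identityˡ p)
    find (x , y , 2 , e , _) = ⊥-elim (not-represented 7 2 2 1 (from-yes (omits? 7 4 2)) {p} {x} {y} p%2 e)
    find (x , y , 3 , e , _) = ⊥-elim (not-represented 7 3 3 2 (from-yes (omits? 7 9 6)) {p} {x} {y} p%3 e)
    find (x , y , 4 , e , _) = halve-both {x} {y} (both-even x y e) e
    find (x , y , 5 , e , _) = ⊥-elim (p%5 (p ℕ.% 5) refl (ℕDM.m%n<n p 5) x y e)
    find (x , y , 6 , e , _) = ⊥-elim (not-represented 7 6 2 1 (from-yes (omits? 7 12 6)) {p} {x} {y} p%2 e)
    find (x , y , 7 , e , _) = divide-7 {x} {y} (reduce (euclidsLemma x x (from-yes (prime? 7)) 7∣x²)) e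
      where
      7∣x² : 7 ℕD.∣ x ℕ.* x
      7∣x² = ℕD.∣m+n∣m⇒∣n (subst (7 ℕD.∣_) (trans (sym e) (ℕP.+-comm (x ℕ.* x) _)) (ℕD.m∣m*n p)) (ℕD.m∣m*n (y ℕ.* y))
    find (x , y , suc (suc (suc (suc (suc (suc (suc (suc _))))))) , e , _ , s≤s (s≤s (s≤s (s≤s (s≤s (s≤s (s≤s ())))))))

  -- Primes that split in ℤ[√-7].

  χχ : ℤ → ℤ → ℤ
  χχ x y = χ₁₂ x * χ₁₂ y

  -- The character modulo 4.
  τ : ℤ → ℤ
  τ = halfWeight 2 (+ 1)

  τ-periodic : Periodic 4 τ
  τ-periodic = halfWeight-periodic 1 (+ 1)

  -- χ₁₂ is the product of (-3 / ·) and (-4 / ·), and (-3 / x) ≡ x (mod 3).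
  χ₁₂-mod-3 : ∀ x → χ₁₂ x ≡₃ x * τ x
  χ₁₂-mod-3 x with residue 12 x
  ... | i , l , refl = F₃.trans (F₃.reflexive (χ₁₂-periodic (+ toℕ i) l)) (F₃.trans (congruent (table i))
    (F₃.*-cong {+ toℕ i} {+ toℕ i + + 12 * l} (congruent (divides (- (+ 4 * l)) (arith₁ (+ toℕ i) l)))
      (F₃.reflexive (sym (trans (cong τ (arith₂ (+ toℕ i) l)) (τ-periodic (+ toℕ i) (+ 3 * l)))))))
    where
    table : ∀ (i : Fin 12) → + 3 ∣ℤ χ₁₂ (+ toℕ i) - + toℕ i * τ (+ toℕ i)
    table = from-yes (FinP.all? {12} λ i → + 3 ∣ℤ? χ₁₂ (+ toℕ i) - + toℕ i * τ (+ toℕ i))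
    arith₁ : ∀ i l → i - (i + + 12 * l) ≡ - (+ 4 * l) * + 3
    arith₁ = ℤT.solve-∀
    arith₂ : ∀ i l → i + + 12 * l ≡ i + + 4 * (+ 3 * l)
    arith₂ = ℤT.solve-∀

  τ-* : ∀ x y → τ x * τ y ≡ τ (x * y)
  τ-* x y with residue 4 x | residue 4 y
  ... | i , l , refl | j , l′ , refl = trans (cong₂ _*_ (τ-periodic (+ toℕ i) l) (τ-periodic (+ toℕ j) l′))
    (trans (table i j) (sym (trans (cong τ (arith (+ toℕ i) (+ toℕ j) l l′)) (τ-periodic (+ toℕ i * + toℕ j) _))))
    where
    table : ∀ (i j : Fin 4) → τ (+ toℕ i) * τ (+ toℕ j) ≡ τ (+ toℕ i * + toℕ j)
    table = from-yes (FinP.all? {4} λ i → FinP.all? {4} λ j → τ (+ toℕ i) * τ (+ toℕ j) ≟ τ (+ toℕ i * + toℕ j))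
    arith : ∀ i j l l′ → (i + + 4 * l) * (j + + 4 * l′) ≡ i * j + + 4 * (i * l′ + l * j + + 4 * l * l′)
    arith = ℤT.solve-∀

  χχ-mod-3 : ∀ x y → χχ x y ≡₃ (x * y) * τ (x * y)
  χχ-mod-3 x y = F₃.trans (F₃.*-cong {χ₁₂ x} {x * τ x} (χ₁₂-mod-3 x) (χ₁₂-mod-3 y))
    (F₃.reflexive (trans (arith x y (τ x) (τ y)) (cong (x * y *_) (τ-* x y))))
    where
    arith : ∀ x y s t → x * s * (y * t) ≡ x * y * (s * t)
    arith = ℤT.solve-∀

  -- Modulo 3 the sign `χχ x y` is a function of the product x y alone: its residue modulo 3 times
  -- the character modulo 4. Products that agree modulo 4 and are opposite modulo 3 therefore
  -- cancel.
  χχ-cancel : ∀ x y x′ y′ → + 4 ∣ℤ x * y - x′ * y′ → + 3 ∣ℤ x * y + x′ * y′ → χχ x y + χχ x′ y′ ≡₃ + 0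
  χχ-cancel x y x′ y′ (divides l e) (divides h e′) = F₃.trans (F₃.+-cong (χχ-mod-3 x y) (χχ-mod-3 x′ y′))
    (congruent (divides (h * t) (trans (cong (λ s → xy * s + x′y′ * t - + 0) same)
      (trans (arith xy x′y′ t) (trans (cong (_* t) e′) (arith₂ h t))))))
    where
    xy = x * y
    x′y′ = x′ * y′
    t = τ x′y′
    shift : ∀ x y → x ≡ y + (x - y)
    shift = ℤT.solve-∀
    same : τ xy ≡ t
    same = trans (cong τ (trans (shift xy x′y′) (cong (λ z → x′y′ + z) (trans e (ℤP.*-comm l (+ 4)))))) (τ-periodic x′y′ l)
    arith : ∀ a b t → a * t + b * t - + 0 ≡ (a + b) * t
    arith = ℤT.solve-∀
    arith₂ : ∀ h t → h * + 3 * t ≡ h * t * + 3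
    arith₂ = ℤT.solve-∀

  -- Multiplication by π = u + w √−7 maps the elements of norm p K onto the multiples of π of norm p² K.
  multiples-of-π : ∀ {p} → Prime p → ∀ u w → u * u + + 7 * (w * w) ≡ + p → ¬ + p ∣ℤ w → ∀ (Ω : ℤ → ℤ → ℤ) (K : ℕ) →
    formSum (λ x y → Ω (u * x - + 7 * w * y) (u * y + w * x)) (norm 7) (p ℕ.* K) ≡₃
    formSum (λ x y → Ω x y when (+ p ∣ℤ? u * y - w * x)) (norm 7) (p ℕ.* (p ℕ.* K))
  multiples-of-π {p} pr u w uw p∤w Ω K =
    formSum-reindex (norm-bounded 7 (s≤s z≤n)) (norm-bounded 7 (s≤s z≤n)) f inj forth value back
    where
    instance
      p≢0 : ℕ.NonZero p
      p≢0 = prime⇒nonZero pr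
    f : ℤ × ℤ → ℤ × ℤ
    f (x , y) = u * x - + 7 * w * y , u * y + w * x
    recover-y : ∀ x y → u * (u * y + w * x) - w * (u * x - + 7 * w * y) ≡ + p * y
    recover-y x y = trans (arith u w x y) (cong (_* y) uw)
      where
      arith : ∀ u w x y → u * (u * y + w * x) - w * (u * x - + 7 * w * y) ≡ (u * u + + 7 * (w * w)) * y
      arith = ℤT.solve-∀
    recover-x : ∀ x y → u * (u * x - + 7 * w * y) + + 7 * w * (u * y + w * x) ≡ + p * x
    recover-x x y = trans (arith u w x y) (cong (_* x) uw)
      where
      arith : ∀ u w x y → u * (u * x - + 7 * w * y) + + 7 * w * (u * y + w * x) ≡ (u * u + + 7 * (w * w)) * x
      arith = ℤT.solve-∀
    inj : ∀ {z z′} → f z ≡ f z′ → z ≡ z′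
    inj {x , y} {x′ , y′} e = cong₂ _,_
      (ℤP.*-cancelˡ-≡ (+ p) x x′ (trans (sym (recover-x x y)) (trans
        (cong (λ (s , t) → u * s + + 7 * w * t) e) (recover-x x′ y′))))
      (ℤP.*-cancelˡ-≡ (+ p) y y′ (trans (sym (recover-y x y)) (trans
        (cong (λ (s , t) → u * t - w * s) e) (recover-y x′ y′))))
    norm-f : ∀ x y → norm 7 (u * x - + 7 * w * y) (u * y + w * x) ≡ + p * norm 7 x y
    norm-f x y = trans (arith u w x y) (cong (_* norm 7 x y) uw)
      where
      arith : ∀ u w x y → (u * x - + 7 * w * y) * (u * x - + 7 * w * y) + + 7 * ((u * y + w * x) * (u * y + w * x))
        ≡ (u * u + + 7 * (w * w)) * (x * x + + 7 * (y * y))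
      arith = ℤT.solve-∀
    forth : ∀ x y → norm 7 x y ≡ + (p ℕ.* K) → norm 7 (u * x - + 7 * w * y) (u * y + w * x) ≡ + (p ℕ.* (p ℕ.* K))
    forth x y e = trans (norm-f x y) (trans (cong (+ p *_) e) (sym (ℤP.pos-* p (p ℕ.* K))))
    value : ∀ x y → norm 7 x y ≡ + (p ℕ.* K) →
      (Ω (u * x - + 7 * w * y) (u * y + w * x) when
        (+ p ∣ℤ? u * (u * y + w * x) - w * (u * x - + 7 * w * y))) ≡₃
      Ω (u * x - + 7 * w * y) (u * y + w * x)
    value x y _ = when-yes (+ p ∣ℤ? _) (divides y (trans (recover-y x y) (ℤP.*-comm (+ p) y)))
    back : ∀ x y → norm 7 x y ≡ + (p ℕ.* (p ℕ.* K)) → (Ω x y when (+ p ∣ℤ? u * y - w * x)) ≡₃ + 0 ⊎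
      ∃ λ z → f z ≡ (x , y) × norm 7 (proj₁ z) (proj₂ z) ≡ + (p ℕ.* K)
    back x y e = go (+ p ∣ℤ? u * y - w * x)
      where
      go : (d : Dec (+ p ∣ℤ u * y - w * x)) → (Ω x y when d) ≡₃ + 0 ⊎
        ∃ λ z → f z ≡ (x , y) × norm 7 (proj₁ z) (proj₂ z) ≡ + (p ℕ.* K)
      go (no _) = inj₁ F₃.refl
      -- One divisibility is enough for a preimage: w (u x + 7 w y) = p y - u (u y - w x), and p ∤
      -- w, so both coordinates of π̄ (x + y √-7) are divisible by p.
      go (yes dy@(divides b eb)) = preimage (prime-∣-* pr w (u * x + + 7 * w * y)
          (subst (+ p ∣ℤ_) (trans (cong (λ n → n * y + - (u * (u * y - w * x))) (sym uw)) (arith u w x y))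
            (ℤS.∣m∣n⇒∣m+n (ℤS.∣m⇒∣m*n y (ℤS.∣-refl {+ p})) (ℤS.∣m⇒∣-m (ℤS.∣n⇒∣m*n u dy)))))
        where
        arith : ∀ u w x y → (u * u + + 7 * (w * w)) * y + - (u * (u * y - w * x)) ≡ w * (u * x + + 7 * w * y)
        arith = ℤT.solve-∀
        preimage : + p ∣ℤ w ⊎ + p ∣ℤ u * x + + 7 * w * y → (Ω x y when (yes dy)) ≡₃ + 0 ⊎
          ∃ λ z → f z ≡ (x , y) × norm 7 (proj₁ z) (proj₂ z) ≡ + (p ℕ.* K)
        preimage (inj₁ p∣w) = ⊥-elim (p∤w p∣w)
        preimage (inj₂ (divides a ea)) = inj₂ ((a , b) , cong₂ _,_ x≡ y≡ ,
          ℤP.*-cancelˡ-≡ (+ p) (norm 7 a b) (+ (p ℕ.* K)) (trans (sym (norm-f a b))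
            (trans (cong₂ (norm 7) x≡ y≡) (trans e (ℤP.pos-* p (p ℕ.* K))))))
          where
          x≡ : u * a - + 7 * w * b ≡ x
          x≡ = ℤP.*-cancelˡ-≡ (+ p) _ x (trans (spread u w a b (+ p)) (trans
            (cong₂ (λ s t → u * s - + 7 * w * t) (sym ea) (sym eb)) (trans (collapse u w x y) (cong (_* x) uw))))
            where
            spread : ∀ u w a b p → p * (u * a - + 7 * w * b) ≡ u * (a * p) - + 7 * w * (b * p)
            spread = ℤT.solve-∀
            collapse : ∀ u w x y → u * (u * x + + 7 * w * y) - + 7 * w * (u * y - w * x) ≡ (u * u + + 7 * (w * w)) * x
            collapse = ℤT.solve-∀
          y≡ : u * b + w * a ≡ y
          y≡ = ℤP.*-cancelˡ-≡ (+ p) _ y (trans (spread u w a b (+ p)) (trans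
            (cong₂ (λ s t → u * t + w * s) (sym ea) (sym eb)) (trans (collapse u w x y) (cong (_* y) uw))))
            where
            spread : ∀ u w a b p → p * (u * b + w * a) ≡ u * (b * p) + w * (a * p)
            spread = ℤT.solve-∀
            collapse : ∀ u w x y → u * (u * y - w * x) + w * (u * x + + 7 * w * y) ≡ (u * u + + 7 * (w * w)) * y
            collapse = ℤT.solve-∀

  -- If p = π π̄ splits in ℤ[√−7] and p ≡ 2 mod 3, the contributions of π β and π̄ β cancel; the elements of
  -- norm p² K are counted once too often among the multiples of π and of π̄ exactly when p divides them.
  split-prime : ∀ {p u v} → Prime p → p ≢ 2 → p ℕ.% 3 ≡ 2 → normℕ 7 u v ≡ p → ∀ K → 2 ℕD.∣ K →
    formSum χχ (norm 7) (p ℕ.* p ℕ.* K) ≡₃ - formSum χχ (norm 7) K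
  split-prime {p} {u} {v} pr p≢2 p%3 uv K (ℕD.divides K/2 K≡) = negate (F₃.trans (F₃.sym double-count) vanishing)
    where
    U V : ℤ
    U = + u
    V = + v
    N² : ℕ
    N² = p ℕ.* (p ℕ.* K)
    UV : U * U + + 7 * (V * V) ≡ + p
    UV = trans (norm-abs 7 U V) (cong +_ uv)
    UV⁻ : U * U + + 7 * (- V * - V) ≡ + p
    UV⁻ = trans (arith U V) UV
      where
      arith : ∀ u v → u * u + + 7 * (- v * - v) ≡ u * u + + 7 * (v * v)
      arith = ℤT.solve-∀
    p∤small : ∀ {n} → p ≢ n → Prime n → ¬ + p ∣ℤ + n
    p∤small p≢n prn d with prime⇒irreducible prn (ℤS.∣⇒∣ᵤ d)
    ... | inj₁ refl = ¬prime[1] pr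
    ... | inj₂ e = p≢n e
    p≢7 : p ≢ 7
    p≢7 p≡7 = 1≢2 (subst (λ n → n ℕ.% 3 ≡ 2) p≡7 p%3)
      where
      1≢2 : ¬ 1 ≡ 2
      1≢2 ()
    p∤1 : ¬ + p ∣ℤ + 1
    p∤1 d = ¬prime[1] (subst Prime (ℕD.∣1⇒≡1 (ℤS.∣⇒∣ᵤ d)) pr)
    not-both : + p ∣ℤ U → + p ∣ℤ V → ⊥
    not-both (divides a ea) (divides b eb) = p∤1 (divides (a * a + + 7 * (b * b)) (ℤP.*-cancelˡ-≡ (+ p) (+ 1) _ {{prime⇒nonZero pr}}
      (trans (ℤP.*-identityʳ (+ p)) (trans (sym UV) (trans
        (cong₂ (λ s t → s * s + + 7 * (t * t)) ea eb) (arith a b (+ p)))))))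
      where
      arith : ∀ a b p → a * p * (a * p) + + 7 * (b * p * (b * p)) ≡ p * ((a * a + + 7 * (b * b)) * p)
      arith = ℤT.solve-∀
    p∣UU+7VV : + p ∣ℤ U * U + + 7 * (V * V)
    p∣UU+7VV = subst (+ p ∣ℤ_) (sym UV) ℤS.∣-refl
    p∤V : ¬ + p ∣ℤ V
    p∤V d = not-both (prime-∣-square pr U (ℤS.∣m+n∣n⇒∣m p∣UU+7VV (ℤS.∣n⇒∣m*n (+ 7) (ℤS.∣m⇒∣m*n V d)))) d
    p∤U : ¬ + p ∣ℤ U
    p∤U d = [ p∤small p≢7 (from-yes (prime? 7)) , (λ p∣VV → not-both d (prime-∣-square pr V p∣VV)) ]′
      (prime-∣-* pr (+ 7) (V * V) (ℤS.∣m+n∣m⇒∣n p∣UU+7VV (ℤS.∣m⇒∣m*n U d)))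
    p∤-V : ¬ + p ∣ℤ - V
    p∤-V d = p∤V (subst (+ p ∣ℤ_) (ℤP.neg-involutive V) (ℤS.∣m⇒∣-m d))
    p∤2 : ¬ + p ∣ℤ + 2
    p∤2 = p∤small p≢2 (from-yes (prime? 2))

    D₊? : ∀ x y → Dec (+ p ∣ℤ U * y - V * x)
    D₊? x y = + p ∣ℤ? U * y - V * x
    D₋? : ∀ x y → Dec (+ p ∣ℤ U * y - - V * x)
    D₋? x y = + p ∣ℤ? U * y - - V * x
    D₀? : ∀ x y → Dec (+ p ∣ℤ x × + p ∣ℤ y)
    D₀? x y = (+ p ∣ℤ? x) ×-dec (+ p ∣ℤ? y)

    -- (u y - v x)(u y + v x) = p y² - v² (x² + 7 y²), so p divides one of the factors as soon as it
    -- divides the norm.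
    one-of : ∀ x y → + p ∣ℤ norm 7 x y → + p ∣ℤ U * y - V * x ⊎ + p ∣ℤ U * y - - V * x
    one-of x y d = prime-∣-* pr _ _ (subst (+ p ∣ℤ_) (arith U V x y)
      (ℤS.∣m∣n⇒∣m+n (ℤS.∣m⇒∣m*n (y * y) p∣UU+7VV) (ℤS.∣m⇒∣-m (ℤS.∣n⇒∣m*n (V * V) d))))
      where
      arith : ∀ u v x y → (u * u + + 7 * (v * v)) * (y * y) + - (v * v * (x * x + + 7 * (y * y)))
        ≡ (u * y - v * x) * (u * y - - v * x)
      arith = ℤT.solve-∀
    strip : ∀ c x → ¬ + p ∣ℤ c → + p ∣ℤ + 2 * (c * x) → + p ∣ℤ x
    strip c x p∤c d = [ (λ p∣2 → ⊥-elim (p∤2 p∣2)) , (λ d′ → [ (λ p∣c → ⊥-elim (p∤c p∣c)) , (λ p∣x → p∣x) ]′ (prime-∣-* pr c x d′)) ]′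
      (prime-∣-* pr (+ 2) (c * x) d)
    both⇒ : ∀ x y → + p ∣ℤ U * y - V * x → + p ∣ℤ U * y - - V * x → + p ∣ℤ x × + p ∣ℤ y
    both⇒ x y d d′ = strip V x p∤V (subst (+ p ∣ℤ_) (arith₁ U V x y) (ℤS.∣m∣n⇒∣m+n d′ (ℤS.∣m⇒∣-m d))) ,
                     strip U y p∤U (subst (+ p ∣ℤ_) (arith₂ U V x y) (ℤS.∣m∣n⇒∣m+n d′ d))
      where
      arith₁ : ∀ u v x y → u * y - - v * x + - (u * y - v * x) ≡ + 2 * (v * x)
      arith₁ = ℤT.solve-∀
      arith₂ : ∀ u v x y → u * y - - v * x + (u * y - v * x) ≡ + 2 * (u * y)
      arith₂ = ℤT.solve-∀
    ⇒both : ∀ w x y → + p ∣ℤ x × + p ∣ℤ y → + p ∣ℤ U * y - w * x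
    ⇒both w x y (dx , dy) = ℤS.∣m∣n⇒∣m+n (ℤS.∣n⇒∣m*n U dy) (ℤS.∣m⇒∣-m (ℤS.∣n⇒∣m*n w dx))

    inclusion-exclusion : ∀ x y → norm 7 x y ≡ + N² → (χχ x y when D₊? x y) + (χχ x y when D₋? x y) ≡₃ χχ x y + (χχ x y when D₀? x y)
    inclusion-exclusion x y e = count (D₊? x y) (D₋? x y) (D₀? x y)
      where
      count : ∀ (d₊ : Dec (+ p ∣ℤ U * y - V * x)) (d₋ : Dec (+ p ∣ℤ U * y - - V * x)) (d₀ : Dec (+ p ∣ℤ x × + p ∣ℤ y)) →
        (χχ x y when d₊) + (χχ x y when d₋) ≡₃ χχ x y + (χχ x y when d₀)
      count (yes _)  (yes _)  (yes _)  = F₃.refl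
      count (yes d)  (yes d′) (no ¬d₀) = ⊥-elim (¬d₀ (both⇒ x y d d′))
      count (yes _)  (no ¬d)  (yes d₀) = ⊥-elim (¬d (⇒both (- V) x y d₀))
      count (yes _)  (no _)   (no _)   = F₃.refl
      count (no ¬d)  _        (yes d₀) = ⊥-elim (¬d (⇒both V x y d₀))
      count (no _)   (yes _)  (no _)   = F₃.+-comm (+ 0) (χχ x y)
      count (no ¬d)  (no ¬d′) (no _)   = ⊥-elim ([ ¬d , ¬d′ ]′ (one-of x y
        (divides (+ (p ℕ.* K)) (trans e (trans (ℤP.pos-* p (p ℕ.* K)) (ℤP.*-comm (+ p) _))))))

    Ω₊ Ω₋ Ω₀ : ℤ → ℤ → ℤ
    Ω₊ x y = χχ x y when D₊? x y
    Ω₋ x y = χχ x y when D₋? x y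
    Ω₀ x y = χχ x y when D₀? x y

    imprimitive : formSum χχ (norm 7) K ≡₃ formSum Ω₀ (norm 7) (p ℕ.* p ℕ.* K)
    imprimitive = F₃.trans (formSum-cong {χχ} {λ x y → Ω₀ (+ p * x) (+ p * y)} (norm 7) K dilated)
      (formSum-dilate {p} {7} pr (s≤s z≤n) Ω₀ K support)
      where
      support : ∀ x y → norm 7 x y ≡ + (p ℕ.* p ℕ.* K) → Ω₀ x y ≡₃ + 0 ⊎ (+ p ∣ℤ x × + p ∣ℤ y)
      support x y _ = go (D₀? x y)
        where
        go : (d : Dec (+ p ∣ℤ x × + p ∣ℤ y)) → (χχ x y when d) ≡₃ + 0 ⊎ (+ p ∣ℤ x × + p ∣ℤ y)
        go (yes d) = inj₂ d
        go (no _)  = inj₁ F₃.refl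
      dilated : ∀ x y → norm 7 x y ≡ + K → χχ x y ≡₃ Ω₀ (+ p * x) (+ p * y)
      dilated x y _ = F₃.sym (F₃.trans {Ω₀ (+ p * x) (+ p * y)} {χχ (+ p * x) (+ p * y)} {χχ x y}
        (when-yes {c = χχ (+ p * x) (+ p * y)} (D₀? (+ p * x) (+ p * y)) (ℤS.∣m⇒∣m*n x (ℤS.∣-refl {+ p}) , ℤS.∣m⇒∣m*n y (ℤS.∣-refl {+ p})))
        (F₃.reflexive (trans (χ₁₂-scale p p%2≢0 p%3≢0 x y) (ℤP.*-identityˡ (χχ x y)))))
        where
        p%2≢0 : p ℕ.% 2 ≢ 0
        p%2≢0 z = p≢2 (prime-%≡0 pr 2 (λ ()) z)
        p%3≢0 : p ℕ.% 3 ≢ 0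
        p%3≢0 z = 2≢0 (trans (sym p%3) z)
          where
          2≢0 : ¬ 2 ≡ 0
          2≢0 ()

    A : ℤ
    A = formSum χχ (norm 7) (p ℕ.* p ℕ.* K)

    double-count : formSum Ω₊ (norm 7) N² + formSum Ω₋ (norm 7) N² ≡₃ A + formSum χχ (norm 7) K
    double-count = F₃.trans (F₃.sym (formSum-+ Ω₊ Ω₋ (norm 7) N²))
      (F₃.trans (formSum-cong {λ x y → Ω₊ x y + Ω₋ x y} {λ x y → χχ x y + Ω₀ x y} (norm 7) N² inclusion-exclusion)
        (F₃.trans (formSum-+ χχ Ω₀ (norm 7) N²)
          (F₃.trans (F₃.reflexive (cong (λ n → formSum χχ (norm 7) n + formSum Ω₀ (norm 7) n) (sym (ℕP.*-assoc p p K))))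
            (F₃.+-congˡ {A} (F₃.sym imprimitive)))))

    -- This is where p ≡ 2 (mod 3) enters: u² + v² ≡ 2 forces u² ≡ v² ≡ 1. The table uses u² + 2 v²,
    -- congruent to u² - 7 v² and free of subtraction.
    3∣UU-7VV : + 3 ∣ℤ U * U - + 7 * (V * V)
    3∣UU-7VV = subst (+ 3 ∣ℤ_) (trans (cong (_+ - (+ 9 * (V * V))) (sym (norm-abs 2 U V))) (arith U V))
      (ℤS.∣m∣n⇒∣m+n (ℤS.∣ᵤ⇒∣ {+ 3} {+ normℕ 2 u v} (ℕD.m%n≡0⇒n∣m (normℕ 2 u v) 3 mod3)) (ℤS.∣m⇒∣-m {+ 3} {+ 9 * (V * V)} (ℤS.∣m⇒∣m*n {+ 3} {+ 9} (V * V) (divides (+ 3) refl))))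
      where
      arith : ∀ u v → u * u + + 2 * (v * v) + - (+ 9 * (v * v)) ≡ u * u - + 7 * (v * v)
      arith = ℤT.solve-∀
      table : ∀ (i j : Fin 3) → normℕ 7 (toℕ i) (toℕ j) ℕ.% 3 ≡ 2 → normℕ 2 (toℕ i) (toℕ j) ℕ.% 3 ≡ 0
      table = from-yes (FinP.all? {3} λ i → FinP.all? {3} λ j → (normℕ 7 (toℕ i) (toℕ j) ℕ.% 3 ℕ.≟ 2) →-dec (normℕ 2 (toℕ i) (toℕ j) ℕ.% 3 ℕ.≟ 0))
      u<3 = ℕDM.m%n<n u 3
      v<3 = ℕDM.m%n<n v 3
      reduce-norm : ∀ d → normℕ d (toℕ (fromℕ< u<3)) (toℕ (fromℕ< v<3)) ℕ.% 3 ≡ normℕ d u v ℕ.% 3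
      reduce-norm d = trans (cong₂ (λ i j → normℕ d i j ℕ.% 3) (FinP.toℕ-fromℕ< u<3) (FinP.toℕ-fromℕ< v<3)) (normℕ-mod 3 d u v)
      mod3 : normℕ 2 u v ℕ.% 3 ≡ 0
      mod3 = trans (sym (reduce-norm 2)) (table (fromℕ< u<3) (fromℕ< v<3)
        (trans (reduce-norm 7) (trans (cong (λ n → n ℕ.% 3) uv) p%3)))

    vanishing : formSum Ω₊ (norm 7) N² + formSum Ω₋ (norm 7) N² ≡₃ + 0
    vanishing = F₃.trans (F₃.+-cong {formSum Ω₊ (norm 7) N²} {formSum (twist V) (norm 7) (p ℕ.* K)} {formSum Ω₋ (norm 7) N²} {formSum (twist (- V)) (norm 7) (p ℕ.* K)}
        (F₃.sym (multiples-of-π pr U V UV p∤V χχ K)) (F₃.sym (multiples-of-π pr U (- V) UV⁻ p∤-V χχ K)))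
      (F₃.trans (F₃.sym (formSum-+ (twist V) (twist (- V)) (norm 7) (p ℕ.* K)))
        (formSum-0 (λ x y → twist V x y + twist (- V) x y) (norm 7) (p ℕ.* K) cancel))
      where
      twist : ℤ → ℤ → ℤ → ℤ
      twist w x y = χχ (U * x - + 7 * w * y) (U * y + w * x)
      -- The coordinate products of π β and π̄ β differ by 2 u v (x² - 7 y²) = 2 u v (p K - 14 y²),
      -- a multiple of 4 because K is even, and add up to 2 x y (u² - 7 v²), a multiple of 3.
      cancel : ∀ x y → norm 7 x y ≡ + (p ℕ.* K) → twist V x y + twist (- V) x y ≡₃ + 0
      cancel x y e = χχ-cancel (U * x - + 7 * V * y) (U * y + V * x) (U * x - + 7 * (- V) * y) (U * y + (- V) * x)
        (subst (+ 4 ∣ℤ_) (sym (trans (difference U V x y) (trans (cong (λ n → + 2 * U * V * (n - + 14 * (y * y))) even) (factor U V q y))))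
          (ℤS.∣m⇒∣m*n (U * V * (q - + 7 * (y * y))) (ℤS.∣-refl {+ 4})))
        (subst (+ 3 ∣ℤ_) (sym (total U V x y)) (ℤS.∣m⇒∣m*n (+ 2 * x * y) 3∣UU-7VV))
        where
        q : ℤ
        q = + (p ℕ.* K/2)
        even : norm 7 x y ≡ + 2 * q
        even = trans e (trans (cong +_ (trans (cong (p ℕ.*_) K≡) (arith p K/2))) (ℤP.pos-* 2 (p ℕ.* K/2)))
          where
          arith : ∀ p k → p ℕ.* (k ℕ.* 2) ≡ 2 ℕ.* (p ℕ.* k)
          arith = ℕS.solve-∀
        difference : ∀ u v x y →
          (u * x - + 7 * v * y) * (u * y + v * x) - (u * x - + 7 * (- v) * y) * (u * y + (- v) * x)
          ≡ + 2 * u * v * (x * x + + 7 * (y * y) - + 14 * (y * y))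
        difference = ℤT.solve-∀
        factor : ∀ u v q y → + 2 * u * v * (+ 2 * q - + 14 * (y * y)) ≡ + 4 * (u * v * (q - + 7 * (y * y)))
        factor = ℤT.solve-∀
        total : ∀ u v x y →
          (u * x - + 7 * v * y) * (u * y + v * x) + (u * x - + 7 * (- v) * y) * (u * y + (- v) * x)
          ≡ (u * u - + 7 * (v * v)) * (+ 2 * x * y)
        total = ℤT.solve-∀

    negate : ∀ {s t} → s + t ≡₃ + 0 → s ≡₃ - t
    negate {s} {t} (congruent d) = congruent (subst (+ 3 ∣ℤ_) (arith s t) d)
      where
      arith : ∀ s t → s + t - + 0 ≡ s - - t
      arith = ℤT.solve-∀

  -- The prime 2 and the form x² + 7 y².

  ∣-residue : ∀ {m x i n l} → + m ∣ℤ + n → x ≡ i + + n * l → + m ∣ℤ x → + m ∣ℤ i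
  ∣-residue {l = l} m∣n refl d = ℤS.∣m+n∣n⇒∣m d (ℤS.∣m⇒∣m*n l m∣n)

  residue-∣ : ∀ {m x i n l} → + m ∣ℤ + n → x ≡ i + + n * l → + m ∣ℤ i → + m ∣ℤ x
  residue-∣ {l = l} m∣n refl d = ℤS.∣m∣n⇒∣m+n d (ℤS.∣m⇒∣m*n l m∣n)

  χ₁₂-even : ∀ x → + 2 ∣ℤ x → χ₁₂ x ≡ + 0
  χ₁₂-even x d = go (residue 12 x)
    where
    table : ∀ (i : Fin 12) → + 2 ∣ℤ + toℕ i → χ₁₂ (+ toℕ i) ≡ + 0
    table = from-yes (FinP.all? {12} λ i → (+ 2 ∣ℤ? + toℕ i) →-dec (χ₁₂ (+ toℕ i) ≟ + 0))
    go : (∃ λ (i : Fin 12) → ∃ λ l → x ≡ + toℕ i + + 12 * l) → χ₁₂ x ≡ + 0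
    go (i , l , e) = trans (cong χ₁₂ e) (trans (χ₁₂-periodic (+ toℕ i) l)
      (table i (∣-residue {2} {x} {+ toℕ i} {12} {l} (divides (+ 6) refl) e d)))

  χχ-evenˡ : ∀ x y → + 2 ∣ℤ x → χχ x y ≡ + 0
  χχ-evenˡ x y d = cong (_* χ₁₂ y) (χ₁₂-even x d)

  χχ-evenʳ : ∀ x y → + 2 ∣ℤ y → χχ x y ≡ + 0
  χχ-evenʳ x y d = trans (cong (χ₁₂ x *_) (χ₁₂-even y d)) (ℤP.*-zeroʳ (χ₁₂ x))

  χχ-linear : ∀ a b c d a′ b′ c′ d′ s →
    (∀ (i j : Fin 12) → χχ (a * + toℕ i + b * + toℕ j) (c * + toℕ i + d * + toℕ j) ≡
      s * χχ (a′ * + toℕ i + b′ * + toℕ j) (c′ * + toℕ i + d′ * + toℕ j)) →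
    ∀ x y → χχ (a * x + b * y) (c * x + d * y) ≡ s * χχ (a′ * x + b′ * y) (c′ * x + d′ * y)
  χχ-linear a b c d a′ b′ c′ d′ s check x y = go (residue 12 x) (residue 12 y)
    where
    shift : ∀ a b i j l l′ → χ₁₂ (a * (i + + 12 * l) + b * (j + + 12 * l′)) ≡ χ₁₂ (a * i + b * j)
    shift a b i j l l′ = trans (cong χ₁₂ (arith a b i j l l′)) (χ₁₂-periodic (a * i + b * j) (a * l + b * l′))
      where
      arith : ∀ a b i j l l′ → a * (i + + 12 * l) + b * (j + + 12 * l′) ≡ (a * i + b * j) + + 12 * (a * l + b * l′)
      arith = ℤT.solve-∀
    go : (∃ λ (i : Fin 12) → ∃ λ l → x ≡ + toℕ i + + 12 * l) → (∃ λ (i : Fin 12) → ∃ λ l → y ≡ + toℕ i + + 12 * l) →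
      χχ (a * x + b * y) (c * x + d * y) ≡ s * χχ (a′ * x + b′ * y) (c′ * x + d′ * y)
    go (i , l , refl) (j , l′ , refl) = trans
      (cong₂ _*_ (shift a b (+ toℕ i) (+ toℕ j) l l′) (shift c d (+ toℕ i) (+ toℕ j) l l′))
      (trans (check i j) (cong (s *_) (sym
        (cong₂ _*_ (shift a′ b′ (+ toℕ i) (+ toℕ j) l l′) (shift c′ d′ (+ toℕ i) (+ toℕ j) l l′)))))

  -- The odd (x , y) with 4 ∣ x − ε y are those with x = 4 k + ε y; in the coordinates (k , y) both these solutions of
  -- norm K and those of norm 4 K (multiplied by the square of (1 ± √−7)/2) are parametrised by the same set.
  module Half (ε : ℤ) (ε² : ε * ε ≡ + 1) (∣ε∣ : ∣ ε ∣ ≡ 1)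
    (sign-change : ∀ k y → χχ (- + 6 * k + - + 5 * ε * y) (+ 2 * ε * k + - + 1 * y) ≡
       - + 1 * χχ (+ 4 * k + ε * y) (+ 0 * k + + 1 * y))
    (odd-case : ∀ k y → ¬ + 2 ∣ℤ y → + 4 ∣ℤ y * y + ε * k * y + + 2 * k * k → + 4 ∣ℤ ε * y - k)
    where

    Ω : ℤ → ℤ → ℤ
    Ω x y = χχ x y when (+ 4 ∣ℤ? x - ε * y)

    Q : ℤ → ℤ → ℤ
    Q k y = norm 7 (+ 4 * k + ε * y) y

    -- 4 k is x - ε y, and both |x| and |y| are at most K.
    Q-bounded : Bounded Q
    Q-bounded k y K e = ℕP.*-cancelˡ-≤ 4 (ℕP.≤-trans 4k≤ (subst (K ℕ.+ K ℕ.≤_) (quadruple K) (ℕP.m≤m+n (K ℕ.+ K) (K ℕ.+ K)))) , y≤K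
      where
      y≤K : ∣ y ∣ ℕ.≤ K
      y≤K = proj₂ (norm-bounded 7 (s≤s z≤n) (+ 4 * k + ε * y) y K e)
      quadruple : ∀ K → K ℕ.+ K ℕ.+ (K ℕ.+ K) ≡ 4 ℕ.* K
      quadruple = ℕS.solve-∀
      cancel : ∀ s t → s + t - t ≡ s
      cancel = ℤT.solve-∀
      4k≤ : 4 ℕ.* ∣ k ∣ ℕ.≤ K ℕ.+ K
      4k≤ = subst (ℕ._≤ K ℕ.+ K) (trans (cong ∣_∣ (cancel (+ 4 * k) (ε * y))) (ℤP.abs-* (+ 4) k))
        (ℕP.≤-trans (ℤP.∣i-j∣≤∣i∣+∣j∣ (+ 4 * k + ε * y) (ε * y))
          (ℕP.+-mono-≤ (proj₁ (norm-bounded 7 (s≤s z≤n) (+ 4 * k + ε * y) y K e))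
            (subst (ℕ._≤ K) (sym (trans (ℤP.abs-* ε y) (trans (cong (ℕ._* ∣ y ∣) ∣ε∣) (ℕP.*-identityˡ ∣ y ∣)))) y≤K)))

    private
      -- The ring solver treats ε as a variable, so each identity is stated with an explicit
      -- multiple of ε² - 1, which is removed here.
      trivial-ε : ∀ {s t u} → s ≡ t + (ε * ε - + 1) * u → s ≡ t
      trivial-ε {s} {t} {u} e = trans e (trans (cong (λ z → t + (z - + 1) * u) ε²) (ℤP.+-identityʳ t))

    parametrise : ∀ K → formSum (λ k y → χχ (+ 4 * k + ε * y) y) Q K ≡₃ formSum Ω (norm 7) K
    parametrise K = formSum-reindex Q-bounded (norm-bounded 7 (s≤s z≤n)) f inj (λ _ _ e → e) value back
      where
      f : ℤ × ℤ → ℤ × ℤ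
      f (k , y) = + 4 * k + ε * y , y
      cancel : ∀ s t → s + t - t ≡ s
      cancel = ℤT.solve-∀
      inj : ∀ {z z′} → f z ≡ f z′ → z ≡ z′
      inj {k , y} {k′ , y′} e = cong₂ _,_ (ℤP.*-cancelˡ-≡ (+ 4) k k′
        (trans (sym (cancel (+ 4 * k) (ε * y))) (trans (cong (λ (s , t) → s - ε * t) e) (cancel (+ 4 * k′) (ε * y′)))))
        (,-injectiveʳ e)
      value : ∀ k y → Q k y ≡ + K → Ω (+ 4 * k + ε * y) y ≡₃ χχ (+ 4 * k + ε * y) y
      value k y _ = when-yes (+ 4 ∣ℤ? (+ 4 * k + ε * y) - ε * y) (divides k (trans (cancel (+ 4 * k) (ε * y)) (ℤP.*-comm (+ 4) k)))
      back : ∀ x y → norm 7 x y ≡ + K → Ω x y ≡₃ + 0 ⊎ ∃ λ z → f z ≡ (x , y) × Q (proj₁ z) (proj₂ z) ≡ + K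
      back x y e = go (+ 4 ∣ℤ? x - ε * y)
        where
        restore : ∀ s t → s ≡ s - t + t
        restore = ℤT.solve-∀
        go : (d : Dec (+ 4 ∣ℤ x - ε * y)) → (χχ x y when d) ≡₃ + 0 ⊎ ∃ λ z → f z ≡ (x , y) × Q (proj₁ z) (proj₂ z) ≡ + K
        go (no _) = inj₁ F₃.refl
        go (yes (divides k ek)) = inj₂ ((k , y) , cong (_, y) x≡ , trans (cong (λ s → norm 7 s y) x≡) e)
          where
          x≡ : + 4 * k + ε * y ≡ x
          x≡ = sym (trans (restore x (ε * y)) (cong (_+ ε * y) (trans ek (ℤP.*-comm k (+ 4)))))

    parametrise-4K : ∀ n → formSum (λ k y → χχ (- + 6 * k + - + 5 * ε * y) (+ 2 * ε * k + - + 1 * y)) Q (8 ℕ.* n)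
      ≡₃ formSum Ω (norm 7) (4 ℕ.* (8 ℕ.* n))
    parametrise-4K n = formSum-reindex Q-bounded (norm-bounded 7 (s≤s z≤n)) f inj forth value back
      where
      -- The coordinates of (4 k + ε y + y √-7) · (-3 + ε √-7) / 2. The second factor is the square
      -- of (1 + ε √-7) / 2 and has norm 4.
      X Y : ℤ → ℤ → ℤ
      X k y = - + 6 * k + - + 5 * ε * y
      Y k y = + 2 * ε * k + - + 1 * y
      f : ℤ × ℤ → ℤ × ℤ
      f (k , y) = X k y , Y k y
      recover-k : ∀ k y → + 5 * ε * Y k y - X k y ≡ + 16 * k
      recover-k k y = trivial-ε (arith ε k y)
        where
        arith : ∀ ε k y → + 5 * ε * (+ 2 * ε * k + - + 1 * y) - (- + 6 * k + - + 5 * ε * y) ≡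
          + 16 * k + (ε * ε - + 1) * (+ 10 * k)
        arith = ℤT.solve-∀
      recover-y : ∀ k y → + 2 * ε * k - Y k y ≡ y
      recover-y k y = arith (+ 2 * ε * k) y
        where
        arith : ∀ s y → s - (s + - + 1 * y) ≡ y
        arith = ℤT.solve-∀
      inj : ∀ {z z′} → f z ≡ f z′ → z ≡ z′
      inj {k , y} {k′ , y′} e = cong₂ _,_ k≡ (trans (sym (recover-y k y))
          (trans (cong₂ (λ s t → + 2 * ε * s - t) k≡ (,-injectiveʳ e)) (recover-y k′ y′)))
        where
        k≡ : k ≡ k′
        k≡ = ℤP.*-cancelˡ-≡ (+ 16) k k′ (trans (sym (recover-k k y))
          (trans (cong (λ (s , t) → + 5 * ε * t - s) e) (recover-k k′ y′)))
      norm-f : ∀ k y → norm 7 (X k y) (Y k y) ≡ + 4 * Q k y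
      norm-f k y = trivial-ε (arith ε k y)
        where
        arith : ∀ ε k y →
          (- + 6 * k + - + 5 * ε * y) * (- + 6 * k + - + 5 * ε * y)
            + + 7 * ((+ 2 * ε * k + - + 1 * y) * (+ 2 * ε * k + - + 1 * y)) ≡
          + 4 * ((+ 4 * k + ε * y) * (+ 4 * k + ε * y) + + 7 * (y * y))
            + (ε * ε - + 1) * (+ 28 * (k * k) + + 21 * (y * y))
        arith = ℤT.solve-∀
      forth : ∀ k y → Q k y ≡ + (8 ℕ.* n) → norm 7 (X k y) (Y k y) ≡ + (4 ℕ.* (8 ℕ.* n))
      forth k y e = trans (norm-f k y) (trans (cong (+ 4 *_) e) (sym (ℤP.pos-* 4 (8 ℕ.* n))))
      value : ∀ k y → Q k y ≡ + (8 ℕ.* n) → Ω (X k y) (Y k y) ≡₃ χχ (X k y) (Y k y)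
      value k y _ = when-yes (+ 4 ∣ℤ? X k y - ε * Y k y) (divides (- + 2 * k - ε * y) (trivial-ε (arith ε k y)))
        where
        arith : ∀ ε k y → (- + 6 * k + - + 5 * ε * y) - ε * (+ 2 * ε * k + - + 1 * y) ≡
          (- + 2 * k - ε * y) * + 4 + (ε * ε - + 1) * (- + 2 * k)
        arith = ℤT.solve-∀
      back : ∀ x y → norm 7 x y ≡ + (4 ℕ.* (8 ℕ.* n)) → Ω x y ≡₃ + 0 ⊎ ∃ λ z → f z ≡ (x , y) × Q (proj₁ z) (proj₂ z) ≡ + (8 ℕ.* n)
      back x y e = go (+ 4 ∣ℤ? x - ε * y) (+ 2 ∣ℤ? y)
        where
        go : (d : Dec (+ 4 ∣ℤ x - ε * y)) → Dec (+ 2 ∣ℤ y) →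
          (χχ x y when d) ≡₃ + 0 ⊎ ∃ λ z → f z ≡ (x , y) × Q (proj₁ z) (proj₂ z) ≡ + (8 ℕ.* n)
        go (no _) _ = inj₁ F₃.refl
        go (yes _) (yes even) = inj₁ (F₃.reflexive (χχ-evenʳ x y even))
        -- With x = 4 k′ + ε y one has x² + 7 y² = 8 (y² + ε k′ y + 2 k′²). Norm 32 n makes the
        -- bracket 4 n, and for odd y this forces k′ ≡ ε y (mod 4), the integrality of the preimage.
        go (yes (divides k′ ek′)) (no odd) = preimage (odd-case k′ y odd (divides (+ n) (ℤP.*-cancelˡ-≡ (+ 8) _ _
            (trans (expand ε k′ y) (trans (cong (λ s → norm 7 s y + (+ 1 - ε * ε) * (y * y)) (sym x≡))
              (trans (cong₂ (λ s t → s + (+ 1 - t) * (y * y)) e ε²) (trans (ℤP.+-identityʳ _)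
                (trans (cong +_ (reorder n)) (trans (ℤP.pos-* 8 (n ℕ.* 4)) (cong (+ 8 *_) (ℤP.pos-* n 4)))))))))))
          where
          restore : ∀ s t → s ≡ s - t + t
          restore = ℤT.solve-∀
          x≡ : x ≡ k′ * + 4 + ε * y
          x≡ = trans (restore x (ε * y)) (cong (_+ ε * y) ek′)
          reorder : ∀ n → 4 ℕ.* (8 ℕ.* n) ≡ 8 ℕ.* (n ℕ.* 4)
          reorder = ℕS.solve-∀
          expand : ∀ ε k y → + 8 * (y * y + ε * k * y + + 2 * k * k) ≡
            ((k * + 4 + ε * y) * (k * + 4 + ε * y) + + 7 * (y * y)) + (+ 1 - ε * ε) * (y * y)
          expand = ℤT.solve-∀
          preimage : + 4 ∣ℤ ε * y - k′ → χχ x y ≡₃ + 0 ⊎ ∃ λ z → f z ≡ (x , y) × Q (proj₁ z) (proj₂ z) ≡ + (8 ℕ.* n)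
          preimage (divides k ek) = inj₂ ((k , y₀) , cong₂ _,_ X≡ Y≡ ,
            ℤP.*-cancelˡ-≡ (+ 4) (Q k y₀) (+ (8 ℕ.* n)) (trans (sym (norm-f k y₀))
              (trans (cong₂ (norm 7) X≡ Y≡) (trans e (ℤP.pos-* 4 (8 ℕ.* n))))))
            where
            y₀ : ℤ
            y₀ = + 2 * ε * k - y
            Y≡ : Y k y₀ ≡ y
            Y≡ = arith (+ 2 * ε * k) y
              where
              arith : ∀ s y → s + - + 1 * (s - y) ≡ y
              arith = ℤT.solve-∀
            X≡ : X k y₀ ≡ x
            X≡ = trans (trivial-ε (arith ε k y)) (trans (cong (λ s → + 5 * ε * y - + 4 * s) (sym ek))
              (trans (arith₂ k′ ε y) (sym x≡)))
              where
              arith : ∀ ε k y → - + 6 * k + - + 5 * ε * (+ 2 * ε * k - y) ≡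
                + 5 * ε * y - + 4 * (k * + 4) + (ε * ε - + 1) * (- + 10 * k)
              arith = ℤT.solve-∀
              arith₂ : ∀ k ε y → + 5 * ε * y - + 4 * (ε * y - k) ≡ k * + 4 + ε * y
              arith₂ = ℤT.solve-∀

    half-sum : ∀ n → formSum Ω (norm 7) (4 ℕ.* (8 ℕ.* n)) ≡₃ - + 1 * formSum Ω (norm 7) (8 ℕ.* n)
    half-sum n = F₃.trans (F₃.sym (parametrise-4K n)) (F₃.trans
      (formSum-cong {λ k y → χχ (- + 6 * k + - + 5 * ε * y) (+ 2 * ε * k + - + 1 * y)} {λ k y → - + 1 * Ω₁ k y} Q (8 ℕ.* n)
        (λ k y _ → F₃.reflexive (trans (sign-change k y) (cong (λ s → - + 1 * χχ (+ 4 * k + ε * y) s) (tidy k y)))))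
      (F₃.trans (formSum-*ˡ (- + 1) Ω₁ Q (8 ℕ.* n)) (F₃.*-congˡ { - + 1} (parametrise (8 ℕ.* n)))))
      where
      Ω₁ : ℤ → ℤ → ℤ
      Ω₁ k y = χχ (+ 4 * k + ε * y) y
      tidy : ∀ k y → + 0 * k + + 1 * y ≡ y
      tidy = ℤT.solve-∀

  odd-case-check : ∀ ε →
    (∀ (i j : Fin 4) → ¬ + 2 ∣ℤ + toℕ j → + 4 ∣ℤ + toℕ j * + toℕ j + ε * + toℕ i * + toℕ j + + 2 * + toℕ i * + toℕ i →
      + 4 ∣ℤ ε * + toℕ j - + toℕ i) →
    ∀ k y → ¬ + 2 ∣ℤ y → + 4 ∣ℤ y * y + ε * k * y + + 2 * k * k → + 4 ∣ℤ ε * y - k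
  odd-case-check ε check k y odd d = go (residue 4 k) (residue 4 y)
    where
    4∣4 : + 4 ∣ℤ + 4
    4∣4 = ℤS.∣-refl
    go : (∃ λ (i : Fin 4) → ∃ λ l → k ≡ + toℕ i + + 4 * l) → (∃ λ (j : Fin 4) → ∃ λ l → y ≡ + toℕ j + + 4 * l) → + 4 ∣ℤ ε * y - k
    go (i , l , ek) (j , l′ , ey) = residue-∣ {4} {ε * y - k} {ε * + toℕ j - + toℕ i} {4} {ε * l′ - l} 4∣4
      (trans (cong₂ (λ s t → ε * s - t) ey ek) (linear ε (+ toℕ i) (+ toℕ j) l l′))
      (check i j
        (λ even → odd (residue-∣ {2} {y} {+ toℕ j} {4} {l′} (divides (+ 2) refl) ey even))
        (∣-residue {4} {y * y + ε * k * y + + 2 * k * k} {_} {4} {+ 2 * + toℕ j * l′ + + 4 * l′ * l′ + ε * (+ toℕ i * l′ + l * + toℕ j + + 4 * l * l′) + + 4 * + toℕ i * l + + 8 * l * l} 4∣4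
          (trans (cong₂ (λ s t → s * s + ε * t * s + + 2 * t * t) ey ek) (quadratic ε (+ toℕ i) (+ toℕ j) l l′)) d))
      where
      linear : ∀ ε i j l l′ → ε * (j + + 4 * l′) - (i + + 4 * l) ≡ ε * j - i + + 4 * (ε * l′ - l)
      linear = ℤT.solve-∀
      quadratic : ∀ ε i j l l′ →
        (j + + 4 * l′) * (j + + 4 * l′) + ε * (i + + 4 * l) * (j + + 4 * l′) + + 2 * (i + + 4 * l) * (i + + 4 * l) ≡
        j * j + ε * i * j + + 2 * i * i + + 4 *
          (+ 2 * j * l′ + + 4 * l′ * l′ + ε * (i * l′ + l * j + + 4 * l * l′) + + 4 * i * l + + 8 * l * l)
      quadratic = ℤT.solve-∀

  odd-case? : ∀ ε → Dec (∀ (i j : Fin 4) → ¬ + 2 ∣ℤ + toℕ j →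
    + 4 ∣ℤ + toℕ j * + toℕ j + ε * + toℕ i * + toℕ j + + 2 * + toℕ i * + toℕ i → + 4 ∣ℤ ε * + toℕ j - + toℕ i)
  odd-case? ε = FinP.all? {4} λ i → FinP.all? {4} λ j → ¬? (+ 2 ∣ℤ? + toℕ j) →-dec
    ((+ 4 ∣ℤ? + toℕ j * + toℕ j + ε * + toℕ i * + toℕ j + + 2 * + toℕ i * + toℕ i) →-dec (+ 4 ∣ℤ? ε * + toℕ j - + toℕ i))

  sign-change? : ∀ ε → Dec (∀ (i j : Fin 12) →
    χχ (- + 6 * + toℕ i + - + 5 * ε * + toℕ j) (+ 2 * ε * + toℕ i + - + 1 * + toℕ j) ≡
    - + 1 * χχ (+ 4 * + toℕ i + ε * + toℕ j) (+ 0 * + toℕ i + + 1 * + toℕ j))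
  sign-change? ε = FinP.all? {12} λ i → FinP.all? {12} λ j → _ ≟ _

  module H₊ = Half (+ 1) refl refl
    (χχ-linear (- + 6) (- + 5) (+ 2) (- + 1) (+ 4) (+ 1) (+ 0) (+ 1) (- + 1) (from-yes (sign-change? (+ 1))))
    (odd-case-check (+ 1) (from-yes (odd-case? (+ 1))))
  module H₋ = Half (- + 1) refl refl
    (χχ-linear (- + 6) (+ 5) (- + 2) (- + 1) (+ 4) (- + 1) (+ 0) (+ 1) (- + 1) (from-yes (sign-change? (- + 1))))
    (odd-case-check (- + 1) (from-yes (odd-case? (- + 1))))

  -- A nonzero sign requires x and y odd, and then x ≡ y or x ≡ -y (mod 4), never both; if both
  -- hold, y is even and everything vanishes.
  χχ-halves : ∀ x y → χχ x y ≡₃ H₊.Ω x y + H₋.Ω x y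
  χχ-halves x y = go (+ 4 ∣ℤ? x - + 1 * y) (+ 4 ∣ℤ? x - - + 1 * y)
    where
    table : ∀ (i j : Fin 4) → + 2 ∣ℤ + toℕ i ⊎ + 2 ∣ℤ + toℕ j ⊎ + 4 ∣ℤ + toℕ i - + toℕ j ⊎ + 4 ∣ℤ + toℕ i + + toℕ j
    table = from-yes (FinP.all? {4} λ i → FinP.all? {4} λ j → (+ 2 ∣ℤ? + toℕ i) ⊎-dec ((+ 2 ∣ℤ? + toℕ j) ⊎-dec
      ((+ 4 ∣ℤ? + toℕ i - + toℕ j) ⊎-dec (+ 4 ∣ℤ? + toℕ i + + toℕ j))))
    4∣4 : + 4 ∣ℤ + 4
    4∣4 = ℤS.∣-refl
    2∣4 : + 2 ∣ℤ + 4
    2∣4 = divides (+ 2) refl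
    trichotomy : (∃ λ (i : Fin 4) → ∃ λ l → x ≡ + toℕ i + + 4 * l) → (∃ λ (j : Fin 4) → ∃ λ l → y ≡ + toℕ j + + 4 * l) →
      χχ x y ≡ + 0 ⊎ + 4 ∣ℤ x - + 1 * y ⊎ + 4 ∣ℤ x - - + 1 * y
    trichotomy (i , l , ex) (j , l′ , ey) = lift (table i j)
      where
      lift : + 2 ∣ℤ + toℕ i ⊎ + 2 ∣ℤ + toℕ j ⊎ + 4 ∣ℤ + toℕ i - + toℕ j ⊎ + 4 ∣ℤ + toℕ i + + toℕ j →
        χχ x y ≡ + 0 ⊎ + 4 ∣ℤ x - + 1 * y ⊎ + 4 ∣ℤ x - - + 1 * y
      lift (inj₁ d) = inj₁ (χχ-evenˡ x y (residue-∣ {2} {x} {+ toℕ i} {4} {l} 2∣4 ex d))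
      lift (inj₂ (inj₁ d)) = inj₁ (χχ-evenʳ x y (residue-∣ {2} {y} {+ toℕ j} {4} {l′} 2∣4 ey d))
      lift (inj₂ (inj₂ (inj₁ d))) = inj₂ (inj₁ (residue-∣ {4} {x - + 1 * y} {+ toℕ i - + toℕ j} {4} {l - l′} 4∣4
        (trans (cong₂ (λ s t → s - + 1 * t) ex ey) (arith (+ toℕ i) (+ toℕ j) l l′)) d))
        where
        arith : ∀ i j l l′ → i + + 4 * l - + 1 * (j + + 4 * l′) ≡ i - j + + 4 * (l - l′)
        arith = ℤT.solve-∀
      lift (inj₂ (inj₂ (inj₂ d))) = inj₂ (inj₂ (residue-∣ {4} {x - - + 1 * y} {+ toℕ i + + toℕ j} {4} {l + l′} 4∣4
        (trans (cong₂ (λ s t → s - - + 1 * t) ex ey) (arith (+ toℕ i) (+ toℕ j) l l′)) d))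
        where
        arith : ∀ i j l l′ → i + + 4 * l - - + 1 * (j + + 4 * l′) ≡ i + j + + 4 * (l + l′)
        arith = ℤT.solve-∀
    go : (d : Dec (+ 4 ∣ℤ x - + 1 * y)) (d′ : Dec (+ 4 ∣ℤ x - - + 1 * y)) → χχ x y ≡₃ (χχ x y when d) + (χχ x y when d′)
    go (yes _) (no _) = F₃.sym (F₃.+-identityʳ (χχ x y))
    go (no _) (yes _) = F₃.sym (F₃.+-identityˡ (χχ x y))
    go (yes (divides a ea)) (yes (divides b eb)) = F₃.reflexive (trans vanishes (sym (cong₂ _+_ vanishes vanishes)))
      where
      arith : ∀ x y → + 2 * y ≡ x - - + 1 * y - (x - + 1 * y)
      arith = ℤT.solve-∀
      arith₂ : ∀ a b → b * + 4 - a * + 4 ≡ + 2 * ((b - a) * + 2)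
      arith₂ = ℤT.solve-∀
      vanishes : χχ x y ≡ + 0
      vanishes = χχ-evenʳ x y (divides (b - a) (ℤP.*-cancelˡ-≡ (+ 2) y _ (trans (arith x y) (trans (cong₂ _-_ eb ea) (arith₂ a b)))))
    go (no ¬d) (no ¬d′) = [ F₃.reflexive , (λ r → ⊥-elim ([ ¬d , ¬d′ ]′ r)) ]′ (trichotomy (residue 4 x) (residue 4 y))

  prime-2 : ∀ n → formSum χχ (norm 7) (4 ℕ.* (8 ℕ.* n)) ≡₃ - formSum χχ (norm 7) (8 ℕ.* n)
  prime-2 n = F₃.trans (split (4 ℕ.* (8 ℕ.* n))) (F₃.trans
    (F₃.+-cong {a₊ (4 ℕ.* (8 ℕ.* n))} { - + 1 * a₊ (8 ℕ.* n)} {a₋ (4 ℕ.* (8 ℕ.* n))} { - + 1 * a₋ (8 ℕ.* n)} (H₊.half-sum n) (H₋.half-sum n))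
    (F₃.trans (F₃.reflexive (arith (a₊ (8 ℕ.* n)) (a₋ (8 ℕ.* n)))) (F₃.-‿cong (F₃.sym (split (8 ℕ.* n))))))
    where
    a₊ a₋ : ℕ → ℤ
    a₊ = formSum H₊.Ω (norm 7)
    a₋ = formSum H₋.Ω (norm 7)
    split : ∀ K → formSum χχ (norm 7) K ≡₃ a₊ K + a₋ K
    split K = F₃.trans (formSum-cong {χχ} {λ x y → H₊.Ω x y + H₋.Ω x y} (norm 7) K (λ x y _ → χχ-halves x y)) (formSum-+ H₊.Ω H₋.Ω (norm 7) K)
    arith : ∀ s t → - + 1 * s + - + 1 * t ≡ - (s + t)
    arith = ℤT.solve-∀

  -- Arguments of B and the three congruences.

  ⊘-exact : ∀ f d → 0 ℕ.< d → (f ℕ.* d) ⊘ d ≡ f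
  ⊘-exact f (suc d) _ = ℕDM.m*n/n≡m f (suc d)

  -- Since p ≡ c and c² ≡ 1 (mod m), all divisions are exact: c p = 1 + g m, and m r + c = e p with
  -- e = 1 + f m. Both arguments of B then become polynomial expressions, and the relation between
  -- them follows by expansion.
  index : ∀ m c → .{{_ : ℕ.NonZero m}} → 1 ℕ.< m → (c ℕ.* c) ℕ.% m ≡ 1 → ∀ {p} → Prime p → p ℕ.% m ≡ c →
    ∀ r → p ℕD.∣ m ℕ.* r ℕ.+ c → ∀ k n → 1 ℕ.≤ k →
    m ℕ.* (p ℕ.^ (k ℕ.+ 1) ℕ.* n ℕ.+ p ℕ.* r ℕ.+ (c ℕ.* p ℕ.∸ 1) ℕ./ m) ℕ.+ 1 ≡
    p ℕ.* p ℕ.* (m ℕ.* (p ℕ.^ (k ℕ.∸ 1) ℕ.* n ℕ.+ (m ℕ.* r ℕ.+ c ℕ.∸ p) ⊘ (m ℕ.* p)) ℕ.+ 1)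
  index m c 1<m c²%m {p} pr p%m r (ℕD.divides e mr+c) (suc k) n _ = begin
    m ℕ.* (p ℕ.^ (suc k ℕ.+ 1) ℕ.* n ℕ.+ p ℕ.* r ℕ.+ (c ℕ.* p ℕ.∸ 1) ℕ./ m) ℕ.+ 1
      ≡⟨ cong₂ (λ s t → m ℕ.* (s ℕ.* n ℕ.+ p ℕ.* r ℕ.+ t) ℕ.+ 1) (cong (λ i → p ℕ.* p ℕ.^ i) (ℕP.+-comm k 1)) quotient₁ ⟩
    m ℕ.* (p ℕ.* (p ℕ.* P) ℕ.* n ℕ.+ p ℕ.* r ℕ.+ g) ℕ.+ 1 ≡⟨ arith₁ m p P n r g ⟩
    m ℕ.* (p ℕ.* (p ℕ.* P) ℕ.* n ℕ.+ p ℕ.* r) ℕ.+ (1 ℕ.+ g ℕ.* m) ≡⟨ cong (λ s → m ℕ.* (p ℕ.* (p ℕ.* P) ℕ.* n ℕ.+ p ℕ.* r) ℕ.+ s) (sym cp) ⟩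
    m ℕ.* (p ℕ.* (p ℕ.* P) ℕ.* n ℕ.+ p ℕ.* r) ℕ.+ c ℕ.* p ≡⟨ arith₂ m p P n r c ⟩
    p ℕ.* (m ℕ.* (p ℕ.* P) ℕ.* n ℕ.+ (m ℕ.* r ℕ.+ c)) ≡⟨ cong (λ s → p ℕ.* (m ℕ.* (p ℕ.* P) ℕ.* n ℕ.+ s)) (trans mr+c (cong (ℕ._* p) e≡)) ⟩
    p ℕ.* (m ℕ.* (p ℕ.* P) ℕ.* n ℕ.+ (1 ℕ.+ f ℕ.* m) ℕ.* p) ≡⟨ arith₃ m p P n f ⟩
    p ℕ.* p ℕ.* (m ℕ.* (P ℕ.* n ℕ.+ f) ℕ.+ 1) ≡⟨ cong (λ s → p ℕ.* p ℕ.* (m ℕ.* (P ℕ.* n ℕ.+ s) ℕ.+ 1)) (sym quotient₂) ⟩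
    p ℕ.* p ℕ.* (m ℕ.* (P ℕ.* n ℕ.+ (m ℕ.* r ℕ.+ c ℕ.∸ p) ⊘ (m ℕ.* p)) ℕ.+ 1) ∎
    where
    open ≡.≡-Reasoning
    P = p ℕ.^ k
    s = (c ℕ.* c) ℕ./ m
    t = p ℕ./ m
    g = s ℕ.+ c ℕ.* t
    f = e ℕ./ m
    cc : c ℕ.* c ≡ 1 ℕ.+ s ℕ.* m
    cc = trans (ℕDM.m≡m%n+[m/n]*n (c ℕ.* c) m) (cong (ℕ._+ s ℕ.* m) c²%m)
    p≡ : p ≡ c ℕ.+ t ℕ.* m
    p≡ = trans (ℕDM.m≡m%n+[m/n]*n p m) (cong (ℕ._+ t ℕ.* m) p%m)
    cp : c ℕ.* p ≡ 1 ℕ.+ g ℕ.* m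
    cp = trans (cong (c ℕ.*_) p≡) (trans (expand c t m) (trans (cong (ℕ._+ c ℕ.* t ℕ.* m) cc) (collect c t m s)))
      where
      expand : ∀ c t m → c ℕ.* (c ℕ.+ t ℕ.* m) ≡ c ℕ.* c ℕ.+ c ℕ.* t ℕ.* m
      expand = ℕS.solve-∀
      collect : ∀ c t m s → 1 ℕ.+ s ℕ.* m ℕ.+ c ℕ.* t ℕ.* m ≡ 1 ℕ.+ (s ℕ.+ c ℕ.* t) ℕ.* m
      collect = ℕS.solve-∀
    -- c e p read in two ways: as e (c p) it is e modulo m, as c (m r + c) it is c², that is 1.
    e+ : e ℕ.+ (e ℕ.* g) ℕ.* m ≡ 1 ℕ.+ (r ℕ.* c ℕ.+ s) ℕ.* m
    e+ = trans (left e g m) (trans (cong (e ℕ.*_) (sym cp)) (trans (swap e c p)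
      (trans (cong (c ℕ.*_) (sym mr+c)) (trans (right c m r) (trans (cong (c ℕ.* m ℕ.* r ℕ.+_) cc) (collect c m r s))))))
      where
      left : ∀ e g m → e ℕ.+ e ℕ.* g ℕ.* m ≡ e ℕ.* (1 ℕ.+ g ℕ.* m)
      left = ℕS.solve-∀
      swap : ∀ e c p → e ℕ.* (c ℕ.* p) ≡ c ℕ.* (e ℕ.* p)
      swap = ℕS.solve-∀
      right : ∀ c m r → c ℕ.* (m ℕ.* r ℕ.+ c) ≡ c ℕ.* m ℕ.* r ℕ.+ c ℕ.* c
      right = ℕS.solve-∀
      collect : ∀ c m r s → c ℕ.* m ℕ.* r ℕ.+ (1 ℕ.+ s ℕ.* m) ≡ 1 ℕ.+ (r ℕ.* c ℕ.+ s) ℕ.* m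
      collect = ℕS.solve-∀
    e≡ : e ≡ 1 ℕ.+ f ℕ.* m
    e≡ = trans (ℕDM.m≡m%n+[m/n]*n e m) (cong (ℕ._+ f ℕ.* m)
      (trans (sym (ℕDM.[m+kn]%n≡m%n e (e ℕ.* g) m)) (trans (cong (λ z → z ℕ.% m) e+)
        (trans (ℕDM.[m+kn]%n≡m%n 1 (r ℕ.* c ℕ.+ s) m) (ℕDM.m<n⇒m%n≡m 1<m)))))
    quotient₁ : (c ℕ.* p ℕ.∸ 1) ℕ./ m ≡ g
    quotient₁ = trans (cong (λ z → (z ℕ.∸ 1) ℕ./ m) cp) (ℕDM.m*n/n≡m g m)
    -- m r + c = p + f (m p), so the truncated subtraction of p is a true one and the quotient is f
    -- without remainder.
    quotient₂ : (m ℕ.* r ℕ.+ c ℕ.∸ p) ⊘ (m ℕ.* p) ≡ f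
    quotient₂ = trans (cong (λ z → (z ℕ.∸ p) ⊘ (m ℕ.* p)) (trans mr+c (trans (cong (ℕ._* p) e≡) (expand f m p))))
      (trans (cong (_⊘ (m ℕ.* p)) (ℕP.m+n∸m≡n p (f ℕ.* (m ℕ.* p)))) (⊘-exact f (m ℕ.* p) (ℕP.*-mono-≤ (ℕP.<⇒≤ 1<m) (prime>0 pr))))
      where
      expand : ∀ f m p → (1 ℕ.+ f ℕ.* m) ℕ.* p ≡ p ℕ.+ f ℕ.* (m ℕ.* p)
      expand = ℕS.solve-∀
    arith₁ : ∀ m p P n r g → m ℕ.* (p ℕ.* (p ℕ.* P) ℕ.* n ℕ.+ p ℕ.* r ℕ.+ g) ℕ.+ 1 ≡ m ℕ.* (p ℕ.* (p ℕ.* P) ℕ.* n ℕ.+ p ℕ.* r) ℕ.+ (1 ℕ.+ g ℕ.* m)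
    arith₁ = ℕS.solve-∀
    arith₂ : ∀ m p P n r c → m ℕ.* (p ℕ.* (p ℕ.* P) ℕ.* n ℕ.+ p ℕ.* r) ℕ.+ c ℕ.* p ≡ p ℕ.* (m ℕ.* (p ℕ.* P) ℕ.* n ℕ.+ (m ℕ.* r ℕ.+ c))
    arith₂ = ℕS.solve-∀
    arith₃ : ∀ m p P n f → p ℕ.* (m ℕ.* (p ℕ.* P) ℕ.* n ℕ.+ (1 ℕ.+ f ℕ.* m) ℕ.* p) ≡ p ℕ.* p ℕ.* (m ℕ.* (P ℕ.* n ℕ.+ f) ℕ.+ 1)
    arith₃ = ℕS.solve-∀

  prime>2 : ∀ {p} → Prime p → p ≢ 2 → 2 ℕ.< p
  prime>2 {0} pr _ = ⊥-elim (¬prime[0] pr)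
  prime>2 {1} pr _ = ⊥-elim (¬prime[1] pr)
  prime>2 {2} pr p≢2 = ⊥-elim (p≢2 refl)
  prime>2 {suc (suc (suc _))} _ _ = s≤s (s≤s (s≤s z≤n))

  prime∤prime : ∀ {p q} → Prime p → Prime q → p ≢ q → ¬ p ℕD.∣ q
  prime∤prime pr prq p≢q d with prime⇒irreducible prq d
  ... | inj₁ refl = ¬prime[1] pr
  ... | inj₂ e = p≢q e

  opposite-sign : ∀ {l s t} → l ≡ + 1 → s ≡₃ - t → s ≡₃ - (l * t)
  opposite-sign {t = t} refl e = F₃.trans e (F₃.reflexive (cong -_ (sym (ℤP.*-identityˡ t))))

  same-sign : ∀ {l s t} → l ≡ -[1+ 0 ] → s ≡₃ t → s ≡₃ - (l * t)
  same-sign {t = t} refl e = F₃.trans e (F₃.reflexive (arith t))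
    where
    arith : ∀ t → t ≡ - (-[1+ 0 ] * t)
    arith = ℤT.solve-∀

  -- Representations of p² K are exactly p times those of K, and the signs change by χ₁₂(p)² = 1.
  nonresidue-step : ∀ {p} v → Prime p → p ℕ.% 2 ≢ 0 → p ℕ.% 3 ≢ 0 → (∀ z → ¬ + p ∣ℤ z * z + + suc v) →
    ∀ K → formSum χχ (norm (suc v)) (p ℕ.* p ℕ.* K) ≡₃ formSum χχ (norm (suc v)) K
  nonresidue-step {p} v pr p%2 p%3 nr K = F₃.trans
    (anisotropic-dilate {p} {suc v} pr (s≤s z≤n) (nonresidue⇒anisotropic pr nr) χχ K)
    (formSum-cong {λ x y → χχ (+ p * x) (+ p * y)} {χχ} (norm (suc v)) K
      (λ x y _ → F₃.reflexive (trans (χ₁₂-scale p p%2 p%3 x y) (ℤP.*-identityˡ (χχ x y)))))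

  -- If 3 ∣ 1 + v, then −v ≡ 1² is a square modulo 3.
  nonresidue-≢3 : ∀ {p} v → Prime p → (∀ z → ¬ + p ∣ℤ z * z + + v) → 3 ℕD.∣ 1 ℕ.+ v → p ℕ.% 3 ≢ 0
  nonresidue-≢3 v pr nr d e = nr (+ 1) (subst (λ q → + q ∣ℤ + 1 * + 1 + + v) (sym (prime-%≡0 pr 3 (λ ()) e)) (ℤS.∣ᵤ⇒∣ d))

  relation-7 : ∀ {p} → Prime p → p ℕ.% 3 ≡ 2 → ∀ n →
    formSum χχ (norm 7) (p ℕ.* p ℕ.* (24 ℕ.* n ℕ.+ 8)) ≡₃ - (legendre (- + 7) p * formSum χχ (norm 7) (24 ℕ.* n ℕ.+ 8))
  relation-7 {p} pr p%3 n = cases (p ℕ.≟ 2)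
    where
    K = 24 ℕ.* n ℕ.+ 8
    not-mod-3 : ∀ {q} → q ℕ.% 3 ≢ 2 → p ≢ q
    not-mod-3 bad e = bad (subst (λ q → q ℕ.% 3 ≡ 2) e p%3)
    Goal : Set
    Goal = formSum χχ (norm 7) (p ℕ.* p ℕ.* K) ≡₃ - (legendre (- + 7) p * formSum χχ (norm 7) K)
    odd : p ≢ 2 → (legendre (- + 7) p ≡ + 1 × ∃ λ z → + p ∣ℤ z * z + + 7) ⊎
      (legendre (- + 7) p ≡ -[1+ 0 ] × ∀ z → ¬ + p ∣ℤ z * z + + 7) → Goal
    odd p≢2 (inj₁ (l , z , dz)) = opposite-sign l (split (represented-7 pr p≢2 p≢5 p%3 z dz))
      where
      -- At p = 5 the symbol (-7 / 5) evaluates to -1, against `l`.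
      p≢5 : p ≢ 5
      p≢5 e = absurd (trans (sym (cong (legendre (- + 7)) e)) l)
        where
        absurd : ¬ -[1+ 0 ] ≡ + 1
        absurd ()
      split : (∃ λ u → ∃ λ v → normℕ 7 u v ≡ p) → formSum χχ (norm 7) (p ℕ.* p ℕ.* K) ≡₃ - formSum χχ (norm 7) K
      split (u , v , uv) = split-prime {p} {u} {v} pr p≢2 p%3 uv K (ℕD.divides (12 ℕ.* n ℕ.+ 4) (arith n))
        where
        arith : ∀ n → 24 ℕ.* n ℕ.+ 8 ≡ (12 ℕ.* n ℕ.+ 4) ℕ.* 2
        arith = ℕS.solve-∀
    odd p≢2 (inj₂ (l , nr)) = same-sign l (nonresidue-step 6 pr (λ e → p≢2 (prime-%≡0 pr 2 (λ ()) e)) p%3≢0 nr K)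
      where
      p%3≢0 : p ℕ.% 3 ≢ 0
      p%3≢0 e = absurd (trans (sym p%3) e)
        where
        absurd : ¬ 2 ≡ 0
        absurd ()
    cases : Dec (p ≡ 2) → Goal
    -- -7 ≡ 1 (mod 8), so the Kronecker symbol at 2 is 1; and 24 n + 8 = 8 (3 n + 1) has the shape
    -- treated for the prime 2.
    cases (yes e) = opposite-sign {legendre (- + 7) p} (cong (legendre (- + 7)) e) (subst₂ (λ q k → formSum χχ (norm 7) (q ℕ.* q ℕ.* k) ≡₃ - formSum χχ (norm 7) k)
        (sym e) (arith n) (prime-2 (3 ℕ.* n ℕ.+ 1)))
      where
      arith : ∀ n → 8 ℕ.* (3 ℕ.* n ℕ.+ 1) ≡ 24 ℕ.* n ℕ.+ 8
      arith = ℕS.solve-∀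
    cases (no p≢2) = odd p≢2 (legendre-cases (prime>2 pr p≢2) 7 (prime∤prime pr (from-yes (prime? 7)) (not-mod-3 (λ ()))))

  combine-3 : ∀ {b b′ l} → + b′ ≡₃ - (l * + b) → + 3 ℤD.∣ (+ b′ + l * + b)
  combine-3 {b} {b′} {l} (congruent d) = ℤS.∣⇒∣ᵤ (subst (+ 3 ∣ℤ_) (cong (λ z → + b′ + z) (ℤP.neg-involutive (l * + b))) d)

  -- The represented number f n is m (m′ n + 1), so the relation between N′ and N says precisely
  -- that it is multiplied by p².
  transfer : ∀ {v a α a′ α′ d l p m m′ N N′} {f : ℕ → ℕ} → (∀ n → + B 3 v n ≡₃ representations a α a′ α′ d (f n)) →
    (∀ n → f n ≡ m ℕ.* (m′ ℕ.* n ℕ.+ 1)) → m′ ℕ.* N′ ℕ.+ 1 ≡ p ℕ.* p ℕ.* (m′ ℕ.* N ℕ.+ 1) →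
    representations a α a′ α′ d (p ℕ.* p ℕ.* f N) ≡₃ - (l * representations a α a′ α′ d (f N)) →
    + 3 ℤD.∣ (+ B 3 v N′ + l * + B 3 v N)
  transfer {v} {a} {α} {a′} {α′} {d} {l} {p} {m} {m′} {N} {N′} {f} count linear step rel = combine-3 {B 3 v N} {B 3 v N′} {l} (F₃.trans (count N′)
    (F₃.trans (F₃.reflexive (cong (representations a α a′ α′ d) scale))
      (F₃.trans rel (F₃.-‿cong {l * representations a α a′ α′ d (f N)} (F₃.*-congˡ {l} (F₃.sym (count N)))))))
    where
    reorder : ∀ m q w → m ℕ.* (q ℕ.* w) ≡ q ℕ.* (m ℕ.* w)
    reorder = ℕS.solve-∀
    scale : f N′ ≡ p ℕ.* p ℕ.* f N
    scale = trans (linear N′) (trans (cong (m ℕ.*_) step) (trans (reorder m (p ℕ.* p) (m′ ℕ.* N ℕ.+ 1)) (cong (p ℕ.* p ℕ.*_) (sym (linear N)))))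

  part-7 : ∀ {p} → Prime p → p ℕ.% 3 ≡ 2 → ∀ {N N′} → 3 ℕ.* N′ ℕ.+ 1 ≡ p ℕ.* p ℕ.* (3 ℕ.* N ℕ.+ 1) →
    + 3 ℤD.∣ (+ B 3 7 N′ + legendre (- + 7) p * + B 3 7 N)
  part-7 {p} pr p%3 {N} {N′} step = transfer {7} {6} { - + 1} {6} { - + 1} {7} {legendre (- + 7) p} {p} {8} {3} {N} {N′} {λ n → 24 ℕ.* n ℕ.+ 8} (B-euler 6) linear step (relation-7 pr p%3 N)
    where
    linear : ∀ n → 24 ℕ.* n ℕ.+ 8 ≡ 8 ℕ.* (3 ℕ.* n ℕ.+ 1)
    linear = ℕS.solve-∀

  odd-%2 : ∀ {p} m → .{{_ : ℕ.NonZero m}} → 2 ℕD.∣ m → ∀ {c} → c ℕ.% 2 ≡ 1 → p ℕ.% m ≡ c → p ℕ.% 2 ≢ 0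
  odd-%2 {p} m d {c} c%2 p%m z = absurd (trans (sym z) (trans (sym (ℕDM.m∣n⇒o%n%m≡o%m 2 m p d)) (trans (cong (λ i → i ℕ.% 2) p%m) c%2)))
    where
    absurd : ¬ 0 ≡ 1
    absurd ()

  part-5 : ∀ {p} → Prime p → p ℕ.% 4 ≡ 3 → ∀ {N N′} → 4 ℕ.* N′ ℕ.+ 1 ≡ p ℕ.* p ℕ.* (4 ℕ.* N ℕ.+ 1) →
    + 3 ℤD.∣ (+ B 3 5 N′ + legendre (- + 5) p * + B 3 5 N)
  part-5 {p} pr p%4 {N} {N′} step = cases (legendre-cases (prime>2 pr p≢2) 5 (prime∤prime pr (from-yes (prime? 5)) p≢5))
    where
    not-mod-4 : ∀ {q} → q ℕ.% 4 ≢ 3 → p ≢ q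
    not-mod-4 bad e = bad (subst (λ q → q ℕ.% 4 ≡ 3) e p%4)
    p≢2 : p ≢ 2
    p≢2 = not-mod-4 (λ ())
    p≢5 : p ≢ 5
    p≢5 = not-mod-4 (λ ())
    w₃ w₁ : ℤ → ℤ
    w₃ = weight 10 (- + 3)
    w₁ = weight 10 (- + 1)
    Ω : ℤ → ℤ → ℤ
    Ω x y = w₃ x * w₁ y
    -- The weights live on ±3 and ±1 modulo 10, and multiplication by 3 or 7 swaps these classes.
    -- The two weights change places at the cost of a sign, and the symmetry of x² + y² puts them
    -- back.
    exchange? : ∀ r → Dec (∀ (i j : Fin 20) → w₃ (+ (r ℕ.* toℕ i)) * w₁ (+ (r ℕ.* toℕ j)) ≡ -[1+ 0 ] * (w₁ (+ toℕ i) * w₃ (+ toℕ j)))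
    exchange? r = FinP.all? {20} λ i → FinP.all? {20} λ j → _ ≟ _
    exchange : p ℕ.% 20 ≡ 3 ⊎ p ℕ.% 20 ≡ 7 → ∀ x y → w₃ (+ p * x) * w₁ (+ p * y) ≡ -[1+ 0 ] * (w₁ x * w₃ y)
    exchange (inj₁ e) = scale-check {20} {3} {p} e {w₃} {w₁} {w₁} {w₃} -[1+ 0 ]
      (weight-periodic 9 (- + 3)) (weight-periodic 9 (- + 1)) (weight-periodic 9 (- + 1)) (weight-periodic 9 (- + 3)) (from-yes (exchange? 3))
    exchange (inj₂ e) = scale-check {20} {7} {p} e {w₃} {w₁} {w₁} {w₃} -[1+ 0 ]
      (weight-periodic 9 (- + 3)) (weight-periodic 9 (- + 1)) (weight-periodic 9 (- + 1)) (weight-periodic 9 (- + 3)) (from-yes (exchange? 7))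
    relation : p ℕ.% 20 ≡ 3 ⊎ p ℕ.% 20 ≡ 7 → ∀ K → formSum Ω (norm 1) (p ℕ.* p ℕ.* K) ≡₃ - formSum Ω (norm 1) K
    relation p%20 K = F₃.trans (anisotropic-dilate {p} {1} pr (s≤s z≤n) (anisotropic-1 pr p%4) Ω K)
      (F₃.trans (formSum-flip (λ x y → Ω (+ p * x) (+ p * y)) K)
        (F₃.trans (formSum-cong {λ x y → Ω (+ p * y) (+ p * x)} {λ x y → -[1+ 0 ] * Ω x y} (norm 1) K
            (λ x y _ → F₃.reflexive (trans (exchange p%20 y x) (cong (-[1+ 0 ] *_) (ℤP.*-comm (w₁ y) (w₃ x))))))
          (F₃.trans (formSum-*ˡ -[1+ 0 ] Ω (norm 1) K) (F₃.reflexive (ℤP.-1*i≡-i (formSum Ω (norm 1) K))))))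
    cases : (legendre (- + 5) p ≡ + 1 × ∃ λ z → + p ∣ℤ z * z + + 5) ⊎
      (legendre (- + 5) p ≡ -[1+ 0 ] × ∀ z → ¬ + p ∣ℤ z * z + + 5) → + 3 ℤD.∣ (+ B 3 5 N′ + legendre (- + 5) p * + B 3 5 N)
    cases (inj₁ (l , z , dz)) = transfer {5} {10} { - + 3} {10} { - + 1} {1} {legendre (- + 5) p} {p} {10} {4} {N} {N′} {λ n → 40 ℕ.* n ℕ.+ 10} B-quintic linear step
      (opposite-sign l (relation (residue-5 pr p%4 z dz) (40 ℕ.* N ℕ.+ 10)))
      where
      linear : ∀ n → 40 ℕ.* n ℕ.+ 10 ≡ 10 ℕ.* (4 ℕ.* n ℕ.+ 1)
      linear = ℕS.solve-∀
    cases (inj₂ (l , nr)) = transfer {5} {6} { - + 1} {6} { - + 1} {5} {legendre (- + 5) p} {p} {6} {4} {N} {N′} {λ n → 24 ℕ.* n ℕ.+ 6} (B-euler 4) linear step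
      (same-sign l (nonresidue-step 4 pr (odd-%2 {p} 4 (ℕD.divides 2 refl) {3} refl p%4) (nonresidue-≢3 5 pr nr (ℕD.divides 2 refl)) nr (24 ℕ.* N ℕ.+ 6)))
      where
      linear : ∀ n → 24 ℕ.* n ℕ.+ 6 ≡ 6 ℕ.* (4 ℕ.* n ℕ.+ 1)
      linear = ℕS.solve-∀

  part-2 : ∀ {p t} → t ≡ 3 ⊎ t ≡ 5 ⊎ t ≡ 7 → Prime p → p ℕ.% 8 ≡ t → ∀ {N N′} → 8 ℕ.* N′ ℕ.+ 1 ≡ p ℕ.* p ℕ.* (8 ℕ.* N ℕ.+ 1) →
    + 3 ℤD.∣ (+ B 3 2 N′ + legendre (- + 2) p * + B 3 2 N)
  part-2 {p} {t} t≡ pr p%8 {N} {N′} step = cases (legendre-cases (prime>2 pr p≢2) 2 (prime∤prime pr (from-yes (prime? 2)) p≢2))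
    where
    t%2 : t ≡ 3 ⊎ t ≡ 5 ⊎ t ≡ 7 → t ℕ.% 2 ≡ 1
    t%2 (inj₁ refl) = refl
    t%2 (inj₂ (inj₁ refl)) = refl
    t%2 (inj₂ (inj₂ refl)) = refl
    p%2 : p ℕ.% 2 ≢ 0
    p%2 = odd-%2 {p} 8 (ℕD.divides 4 refl) {t} (t%2 t≡) p%8
    p≢2 : p ≢ 2
    p≢2 e = p%2 (cong (λ q → q ℕ.% 2) e)
    w₁ w₀ : ℤ → ℤ
    w₁ = weight 4 (- + 1)
    w₀ = weight 4 (+ 0)
    Ω : ℤ → ℤ → ℤ
    Ω x y = w₁ x * w₀ y
    -- On odd x the weight `w₁` is (2 / x), which changes sign under multiplication by 3; `w₀` lives
    -- on multiples of 4 and does not change. The product changes sign.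
    twist? : Dec (∀ (i j : Fin 8) → w₁ (+ (3 ℕ.* toℕ i)) * w₀ (+ (3 ℕ.* toℕ j)) ≡ -[1+ 0 ] * (w₁ (+ toℕ i) * w₀ (+ toℕ j)))
    twist? = FinP.all? {8} λ i → FinP.all? {8} λ j → _ ≟ _
    twist : p ℕ.% 8 ≡ 3 → ∀ x y → w₁ (+ p * x) * w₀ (+ p * y) ≡ -[1+ 0 ] * (w₁ x * w₀ y)
    twist e = scale-check {8} {3} {p} e {w₁} {w₀} {w₁} {w₀} -[1+ 0 ]
      (weight-periodic 3 (- + 1)) (weight-periodic 3 (+ 0)) (weight-periodic 3 (- + 1)) (weight-periodic 3 (+ 0)) (from-yes twist?)
    relation : p ℕ.% 8 ≡ 3 → ∀ K → formSum Ω (norm 1) (p ℕ.* p ℕ.* K) ≡₃ - formSum Ω (norm 1) K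
    relation p%8≡3 K = F₃.trans (anisotropic-dilate {p} {1} pr (s≤s z≤n) (anisotropic-1 pr p%4) Ω K)
      (F₃.trans (formSum-cong {λ x y → Ω (+ p * x) (+ p * y)} {λ x y → -[1+ 0 ] * Ω x y} (norm 1) K
          (λ x y _ → F₃.reflexive (twist p%8≡3 x y)))
        (F₃.trans (formSum-*ˡ -[1+ 0 ] Ω (norm 1) K) (F₃.reflexive (ℤP.-1*i≡-i (formSum Ω (norm 1) K)))))
      where
      p%4 : p ℕ.% 4 ≡ 3
      p%4 = trans (sym (ℕDM.m∣n⇒o%n%m≡o%m 4 8 p (ℕD.divides 2 refl))) (cong (λ i → i ℕ.% 4) p%8≡3)
    -- If -2 is a square modulo p, the classes 5 and 7 are impossible; the class 3 that remains is
    -- also 3 modulo 4, so p is inert for x² + y².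
    mod-8 : ∀ z → + p ∣ℤ z * z + + 2 → t ≡ 3 ⊎ t ≡ 5 ⊎ t ≡ 7 → p ℕ.% 8 ≡ 3
    mod-8 z dz (inj₁ e) = trans p%8 e
    mod-8 z dz (inj₂ (inj₁ e)) = ⊥-elim (residue-2 pr (inj₁ (trans p%8 e)) z dz)
    mod-8 z dz (inj₂ (inj₂ e)) = ⊥-elim (residue-2 pr (inj₂ (trans p%8 e)) z dz)
    cases : (legendre (- + 2) p ≡ + 1 × ∃ λ z → + p ∣ℤ z * z + + 2) ⊎
      (legendre (- + 2) p ≡ -[1+ 0 ] × ∀ z → ¬ + p ∣ℤ z * z + + 2) → + 3 ℤD.∣ (+ B 3 2 N′ + legendre (- + 2) p * + B 3 2 N)
    cases (inj₁ (l , z , dz)) = transfer {2} {4} { - + 1} {4} {+ 0} {1} {legendre (- + 2) p} {p} {1} {8} {N} {N′} {λ n → 8 ℕ.* n ℕ.+ 1} B-quartic (λ n → sym (ℕP.*-identityˡ _)) step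
      (opposite-sign l (relation (mod-8 z dz t≡) (8 ℕ.* N ℕ.+ 1)))
    cases (inj₂ (l , nr)) = transfer {2} {6} { - + 1} {6} { - + 1} {2} {legendre (- + 2) p} {p} {3} {8} {N} {N′} {λ n → 24 ℕ.* n ℕ.+ 3} (B-euler 1) linear step
      (same-sign l (nonresidue-step 1 pr p%2 (nonresidue-≢3 2 pr nr (ℕD.divides 1 refl)) nr (24 ℕ.* N ℕ.+ 3)))
      where
      linear : ∀ n → 24 ℕ.* n ℕ.+ 3 ≡ 3 ℕ.* (8 ℕ.* n ℕ.+ 1)
      linear = ℕS.solve-∀

open import Data.Nat using (_+_; _*_; _∸_; _^_; _/_; _%_)
open import Data.Nat.Divisibility using (_∣_)
open import Data.Integer using (-_)

theorem1p6 : (k n : ℕ) → 1 ℕ.≤ k → 1 ℕ.≤ n →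
    (((p r : ℕ) → Prime p → p % 3 ≡ 2 → p ∣ 3 * r + 2 →
    (+ 3) ℤD.∣ ((+ B 3 7 (p ^ (k + 1) * n + p * r + (2 * p ∸ 1) / 3))
    ℤ.+ legendre (- (+ 7)) p ℤ.* (+ B 3 7 (p ^ (k ∸ 1) * n + (3 * r + 2 ∸ p) ⊘ (3 * p)))))
    × ((p r : ℕ) → Prime p → p % 4 ≡ 3 → p ∣ 4 * r + 3 →
    (+ 3) ℤD.∣ ((+ B 3 5 (p ^ (k + 1) * n + p * r + (3 * p ∸ 1) / 4))
    ℤ.+ legendre (- (+ 5)) p ℤ.* (+ B 3 5 (p ^ (k ∸ 1) * n + (4 * r + 3 ∸ p) ⊘ (4 * p)))))
    × ((t p r : ℕ) → (t ≡ 3 ⊎ t ≡ 5 ⊎ t ≡ 7) → Prime p → p % 8 ≡ t → p ∣ 8 * r + t →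
    (+ 3) ℤD.∣ ((+ B 3 2 (p ^ (k + 1) * n + p * r + (t * p ∸ 1) / 8))
    ℤ.+ legendre (- (+ 2)) p ℤ.* (+ B 3 2 (p ^ (k ∸ 1) * n + (8 * r + t ∸ p) ⊘ (8 * p))))))
theorem1p6 k n 1≤k _ =
    (λ p r pr p%3 d → part-7 pr p%3 {reduced 3 2 p r} {dilated 3 2 p r} (index 3 2 (s≤s (s≤s z≤n)) ≡.refl pr p%3 r d k n 1≤k))
  , (λ p r pr p%4 d → part-5 pr p%4 {reduced 4 3 p r} {dilated 4 3 p r} (index 4 3 (s≤s (s≤s z≤n)) ≡.refl pr p%4 r d k n 1≤k))
  , (λ t p r t≡ pr p%8 d → part-2 t≡ pr p%8 {reduced 8 t p r} {dilated 8 t p r} (index 8 t (s≤s (s≤s z≤n)) (t²%8 t≡) pr p%8 r d k n 1≤k))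
  where
  dilated reduced : (m c p r : ℕ) → .{{_ : ℕ.NonZero m}} → ℕ
  dilated m c p r = p ^ (k + 1) * n + p * r + (c * p ∸ 1) / m
  reduced m c p r = p ^ (k ∸ 1) * n + (m * r + c ∸ p) ⊘ (m * p)
  t²%8 : ∀ {t} → t ≡ 3 ⊎ t ≡ 5 ⊎ t ≡ 7 → (t * t) % 8 ≡ 1
  t²%8 (inj₁ ≡.refl) = ≡.refl
  t²%8 (inj₂ (inj₁ ≡.refl)) = ≡.refl
  t²%8 (inj₂ (inj₂ ≡.refl)) = ≡.refl
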